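{- Let $P$ be an Eulerian Sheffer poset with binomial factorial function $B(n) = n!$. Then the Sheffer factorial function $D(n)$ satisfies one of the following three alternatives: (i) $D(n) = 2\cdot(n-1)!$ for all $n\ge 2$; in this case every Sheffer $n$-interval is isomorphic to $\Sigma^*(B_{n-1})$; (ii) $D(n) = n!$ for all $n\ge1$; in this case $P$ is a binomial poset and every Sheffer $n$-interval is isomorphic to the Boolean algebra $B_n$; (iii) $D(n) = 2^{n-1}\cdot(n-1)!$ for all $n\ge1$; in this case, if a Sheffer $n$-interval $[\hat 0,y]$ is furthermore a lattice, then $[\hat0,y]$ is isomorphic to the cubical lattice $C_n$.
   Context: All posets are locally finite with a unique minimal element $\hat 0$. A Sheffer poset is such a poset $P$ that (i) contains an infinite chain, (ii) has every interval graded (rank function $\rho$, $\rho(\hat0)=0$; $[x,y]$ is an $n$-interval if $\rho(y)-\rho(x)=n$), (iii) any two $n$-intervals $[\hat0,y]$, $[\hat0,v]$ with $y,v\neq\hat0$ have the same number $D(n)$ of maximal chains, and (iv) any two $n$-intervals $[x,y]$, $[u,v]$ with $x,u\neq\hat0$ have the same number $B(n)$ of maximal chains. Intervals $[\hat0,y]$ are Sheffer intervals. A binomial poset is a poset satisfying (i), (ii) and in which any two $n$-intervals have the same number of maximal chains. A poset is Eulerian if $\mu(x,y)=(-1)^{\rho(y)-\rho(x)}$ for all $x\le y$. $B_n$ is the Boolean algebra of subsets of an $n$-set. For a poset $R$ with minimum $\hat0$, the dual suspension $\Sigma^*(R)$ is $R$ with two new elements $a_1,a_2$ added, with $\hat 0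 < a_i < y$ for all $y > \hat 0$ in $R$ and $i=1,2$. The cubical lattice $C_n$ is the face lattice of the $(n-1)$-dimensional cube (including the empty face), a lattice of rank $n$; equivalently $C_n = \Pi^{n-1}\cup\{\hat0\}$ where $\Pi$ is the three-element poset $\{0,1,*\}$ with $0,1<*$ and $\Pi^{n-1}$ has the componentwise order. -}

module Defs where

open import Level using (0ℓ)
open import Data.Nat using (ℕ; zero; suc; _∸_)
open import Data.Integer using (ℤ; _^_; -_; 1ℤ; 0ℤ)
open import Data.Integer as ℤ using ()
open import Data.Fin using (Fin)
open import Data.Fin.Subset as Sub using (Subset)
open import Data.Maybe using (Maybe; just; nothing)
open import Data.Vec using (Vec)
open import Data.Vec.Relation.Binary.Pointwise.Inductive using (Pointwise)
open import Data.List using (List; map; foldr)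
open import Data.List.Relation.Unary.All using (All)
open import Data.List.Relation.Unary.Linked using (Linked)
open import Data.List.Relation.Unary.Unique.Propositional using (Unique)
open import Data.List.Membership.Propositional using (_∈_)
open import Data.Product using (Σ; ∃; _×_; _,_; proj₁)
open import Data.Sum using (_⊎_)
open import Data.Empty using (⊥)
open import Relation.Nullary using (¬_)
open import Relation.Binary using (Rel; IsPartialOrder)
open import Relation.Binary.PropositionalEquality using (_≡_; _≢_)
open import Function using (_⇔_)
open import Function.Definitions using (Injective)

record GradedPoset : Set₁ where
  field
    Carrier        : Set
    _≤_            : Rel Carrier 0ℓ
    isPartialOrder : IsPartialOrder _≡_ _≤_
    𝟘              : Carrier
    𝟘-min          : ∀ x → 𝟘 ≤ x

  _<_ : Rel Carrier 0ℓ
  x < y = x ≤ y × x ≢ y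

  _⋖_ : Rel Carrier 0ℓ
  x ⋖ y = x < y × (∀ z → ¬ (x < z × z < y))

  field
    interval          : Carrier → Carrier → List Carrier
    interval-unique   : ∀ x y → Unique (interval x y)
    interval-complete : ∀ x y z → (z ∈ interval x y) ⇔ (x ≤ z × z ≤ y)
    ρ      : Carrier → ℕ
    ρ-𝟘    : ρ 𝟘 ≡ 0
    ρ-⋖    : ∀ x y → x ⋖ y → ρ y ≡ suc (ρ x)
    chain        : ℕ → Carrier
    chain-strict : ∀ n → chain n < chain (suc n)

module _ (P : GradedPoset) where
  open GradedPoset P

  IsMaxChain : Carrier → Carrier → List Carrier → Set
  IsMaxChain x y l =
    Linked _<_ l ×
    All (λ z → x ≤ z × z ≤ y) l ×
    (∀ w → x ≤ w → w ≤ y → All (λ z → z ≤ w ⊎ w ≤ z) l → w ∈ l)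

  NumMaxChains : Carrier → Carrier → ℕ → Set
  NumMaxChains x y n =
    Σ (Fin n → List Carrier) λ f →
      Injective _≡_ _≡_ f ×
      (∀ i → IsMaxChain x y (f i)) ×
      (∀ l → IsMaxChain x y l → ∃ λ i → f i ≡ l)

  IsSheffer : (ℕ → ℕ) → (ℕ → ℕ) → Set
  IsSheffer D B =
    (∀ y → y ≢ 𝟘 → NumMaxChains 𝟘 y (D (ρ y))) ×
    (∀ x y → x ≢ 𝟘 → x ≤ y → NumMaxChains x y (B (ρ y ∸ ρ x)))

  IsBinomial : Set
  IsBinomial = Σ (ℕ → ℕ) λ F → ∀ x y → x ≤ y → NumMaxChains x y (F (ρ y ∸ ρ x))

  sumℤ : List ℤ → ℤ
  sumℤ = foldr ℤ._+_ 0ℤ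

  IsMobius : (Carrier → Carrier → ℤ) → Set
  IsMobius μ =
    (∀ x → μ x x ≡ 1ℤ) ×
    (∀ x y → x < y → sumℤ (map (μ x) (interval x y)) ≡ 0ℤ)

  IsEulerian : Set
  IsEulerian = IsMobius (λ x y → (- 1ℤ) ^ (ρ y ∸ ρ x))

  Below : Carrier → Set
  Below y = Σ Carrier (λ z → z ≤ y)

  IsLatticeBelow : Carrier → Set
  IsLatticeBelow y =
    (∀ a b → a ≤ y → b ≤ y → ∃ λ j → j ≤ y × a ≤ j × b ≤ j ×
        (∀ c → c ≤ y → a ≤ c → b ≤ c → j ≤ c)) ×
    (∀ a b → a ≤ y → b ≤ y → ∃ λ m → m ≤ y × m ≤ a × m ≤ b ×
        (∀ c → c ≤ y → c ≤ a → c ≤ b → c ≤ m))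

  IntervalIso : Carrier → (A : Set) → Rel A 0ℓ → Set
  IntervalIso y A _⊑_ =
    Σ (Below y → A) λ f → Σ (A → Below y) λ g →
      (∀ z → proj₁ (g (f z)) ≡ proj₁ z) ×
      (∀ a → f (g a) ≡ a) ×
      (∀ z w → (proj₁ z ≤ proj₁ w) ⇔ (f z ⊑ f w))

Bool-≤ : ∀ {n} → Rel (Subset n) 0ℓ
Bool-≤ = Sub._⊆_

-- dual suspension Σ*(R) of a poset R with minimum ⊥R
data DS (A : Set) : Set where
  old : A → DS A
  new : Fin 2 → DS A

data DS-≤ {A : Set} (_⊑_ : Rel A 0ℓ) (⊥R : A) : Rel (DS A) 0ℓ where
  old≤old : ∀ {a b} → a ⊑ b → DS-≤ _⊑_ ⊥R (old a) (old b)
  new≤new : ∀ {i} → DS-≤ _⊑_ ⊥R (new i) (new i)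
  bot≤new : ∀ {i} → DS-≤ _⊑_ ⊥R (old ⊥R) (new i)
  new≤old : ∀ {i b} → b ≢ ⊥R → DS-≤ _⊑_ ⊥R (new i) (old b)

DSBool : ℕ → Set
DSBool m = DS (Subset m)

DSBool-≤ : ∀ m → Rel (DSBool m) 0ℓ
DSBool-≤ m = DS-≤ Sub._⊆_ Sub.⊥

-- cubical lattice C_n = Π^(n-1) ∪ {0̂}
data Π3 : Set where
  π0 π1 π* : Π3

data Π-≤ : Rel Π3 0ℓ where
  Π-refl : ∀ {a} → Π-≤ a a
  Π-top  : ∀ {a} → Π-≤ a π*

Cube : ℕ → Set
Cube n = Maybe (Vec Π3 (n ∸ 1))

data Cube-≤ (n : ℕ) : Rel (Cube n) 0ℓ where
  bot≤  : ∀ {c} → Cube-≤ n nothing c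
  vec≤  : ∀ {u v} → Pointwise Π-≤ u v → Cube-≤ n (just u) (just v)

{-# OPTIONS --safe #-}

-- Counting maximal chains shows that the intervals not containing 0̂ have the cover numbers of Boolean algebras,
-- and that a Sheffer n-interval has A(n) = D(n) / (n − 1)! atoms, C(n) = D(n) / D(n − 1) ≥ n − 1 coatoms and
-- F(n,k) = D(n) / (D(k) (n − k)!) elements of rank k ≥ 1.  The Eulerian relations 1 + Σ (−1)^k F(n,k) = 0 for even n
-- determine D(2m + 2) from the earlier values.  For n = 4 they force D(3) = 2r with r ∈ {2, 3, 4, 5}, and r = 5 breaks
-- down for n = 6.  If D agrees with one of the three model sequences up to 2m, then comparing the relations for
-- n = 2m + 2 and n = 2m + 4 (and n = 2m + 6 in five small cases) with those of the model, and using C(n) ≥ n − 1 and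
-- the integrality of A(n), excludes every value of C(2m + 1) other than that of the model.
--
-- In an interval with Boolean cover numbers an atom a ≰ z lies below exactly one cover of z (double counting and
-- induction on the rank), so elements are determined by their sets of atoms, and all sets occur since there are 2^n
-- elements.  When D(n) = 2 (n − 1)! there are two atoms, and both lie below everything of rank at least 2.  In a lattice
-- with D(n) = 2^(n−1) (n − 1)! each facet F shares a ridge with all but one of the other facets, its antipode, which is
-- disjoint from F.  Every antipodal pair has exactly one member above a fixed vertex; recording the position of an
-- element with respect to these n − 1 pairs embeds the nonzero elements into Π^(n−1), and there are 3^(n−1) of them.
module Submission where

open import Defs
open import Level using (0ℓ)
open import Data.Bool using (true; false) renaming (_≟_ to _≟ᵇ_)
open import Data.Empty using (⊥; ⊥-elim)
open import Data.Fin as Fin using (Fin)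
open import Data.Fin.Subset as Subset using (Subset)
import Data.Fin.Subset.Properties as Subset
open import Data.Integer as ℤ using (ℤ; 0ℤ; 1ℤ; -1ℤ) renaming (+_ to pos)
import Data.Integer.Properties as ℤ
open import Data.Integer.Tactic.RingSolver using () renaming (solve-∀ to ringℤ)
open import Data.List using (List; []; _∷_; _++_; map; filter; length; foldr; concatMap; tabulate; cartesianProductWith)
open import Data.List.Properties using (length-map; length-++; length-tabulate; map-∘; map-cong)
open import Data.List.Membership.Propositional using (_∈_; find)
open import Data.List.Membership.Propositional.Properties
  using (∈-∃++; ∈-map⁺; ∈-map⁻; ∈-tabulate⁺; ∈-tabulate⁻; ∈-filter⁺; ∈-filter⁻; ∈-++⁺ˡ; ∈-++⁺ʳ; ∈-++⁻; ∈-cartesianProductWith⁺)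
open import Data.List.Relation.Unary.All as All using (All; []; _∷_)
open import Data.List.Relation.Unary.AllPairs using ([]; _∷_)
open import Data.List.Relation.Unary.Any as Any using (here; there; any?)
open import Data.List.Relation.Unary.Linked using (Linked; [-]; _∷_)
open import Data.List.Relation.Unary.Linked.Properties using (Linked⇒AllPairs)
open import Data.List.Relation.Unary.Unique.Propositional using (Unique)
import Data.List.Relation.Unary.Unique.Propositional.Properties as Unique
open import Data.Maybe using (just; nothing)
open import Data.Nat
open import Data.Nat.Combinatorics using (_C_; nCk≡n!/k![n-k]!; nCk+nC[k+1]≡[n+1]C[k+1]; k>n⇒nCk≡0)
open import Data.Nat.Combinatorics.Specification using ([n∸k]!k!∣n!)
open import Data.Nat.Divisibility using (_∣_)
open import Data.Nat.DivMod using (m/n*n≡m; _%_; m*n%n≡0)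
open import Data.Nat.Properties
open import Data.Nat.Tactic.RingSolver using () renaming (solve-∀ to ringℕ)
open import Data.Product using (∃; _×_; _,_; proj₁; proj₂)
open import Data.Sum as Sum using (_⊎_; inj₁; inj₂)
open import Data.Vec as Vec using (Vec; []; _∷_)
import Data.Vec.Properties as Vec
open import Data.Vec.Relation.Binary.Pointwise.Inductive as Pointwise using (Pointwise)
open import Function using (_∘_; Equivalence; mk⇔)
open import Relation.Binary using (Rel; IsPartialOrder)
open import Relation.Binary.PropositionalEquality hiding (isPartialOrder)
open import Relation.Nullary using (¬_; Dec; yes; no; does; contradiction; recompute)
open import Relation.Nullary.Decidable using (_×-dec_; ¬?; map′; dec-true)

-- Sums and counting over finite lists

-- The relation in an even rank n contains both D(n - 1) and D(n), so it ties D(n) to D(n - 1) but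
-- never fixes D(n - 1): every odd rank opens a free parameter, and each further even rank adds two
-- more unknowns. Only inequalities and divisibility can close the induction, and the estimates are
-- tight enough to fail in a few small ranks. The sums over low ranks are never evaluated. As long
-- as D(k) agrees with the model value D′(k), the number F(n,k) is the model number times D(n) /
-- D′(n), a factor independent of k. Cross-multiplying with the relation of the model, which the
-- binomial theorem supplies, therefore cancels all these ranks together and leaves an identity
-- between at most six consecutive coatom numbers of each side. Identities are arranged so that no
-- subtraction occurs, and each impossible case is refuted by a polynomial identity that exhibits a
-- positive surplus. No inverse of an isomorphism is constructed either: each code is shown to
-- preserve and reflect the order, and a comparison of cardinalities makes it onto.

module _ {A : Set} where

  ∑ : List A → (A → ℕ) → ℕ
  ∑ []       f = 0
  ∑ (x ∷ xs) f = f x + ∑ xs f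

  ∑-cong : ∀ xs {f g : A → ℕ} → (∀ {z} → z ∈ xs → f z ≡ g z) → ∑ xs f ≡ ∑ xs g
  ∑-cong []       eq = refl
  ∑-cong (x ∷ xs) eq = cong₂ _+_ (eq (here refl)) (∑-cong xs (eq ∘ there))

  ∑-mono : ∀ xs {f g : A → ℕ} → (∀ {z} → z ∈ xs → f z ≤ g z) → ∑ xs f ≤ ∑ xs g
  ∑-mono []       le = z≤n
  ∑-mono (x ∷ xs) le = +-mono-≤ (le (here refl)) (∑-mono xs (le ∘ there))

  ∑-+ : ∀ xs (f g : A → ℕ) → ∑ xs (λ z → f z + g z) ≡ ∑ xs f + ∑ xs g
  ∑-+ []       f g = refl
  ∑-+ (x ∷ xs) f g = trans (cong (f x + g x +_) (∑-+ xs f g)) (shuffle (f x) (g x) (∑ xs f) (∑ xs g))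
    where
    shuffle : ∀ a b c d → a + b + (c + d) ≡ a + c + (b + d)
    shuffle = ringℕ

  ∑-*ʳ : ∀ xs (f : A → ℕ) c → ∑ xs (λ z → f z * c) ≡ ∑ xs f * c
  ∑-*ʳ []       f c = refl
  ∑-*ʳ (x ∷ xs) f c = trans (cong (f x * c +_) (∑-*ʳ xs f c)) (sym (*-distribʳ-+ c (f x) (∑ xs f)))

  ∑-zero : ∀ xs → ∑ xs (λ _ → 0) ≡ 0
  ∑-zero []       = refl
  ∑-zero (x ∷ xs) = ∑-zero xs

  -- The equality case of a termwise bound. Most structural facts below arise so: each term is
  -- bounded, and a double count shows that the total attains the bound.
  ∑-squeeze : ∀ xs {f g : A → ℕ} → (∀ {z} → z ∈ xs → f z ≤ g z) → ∑ xs g ≤ ∑ xs f →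
              ∀ {z} → z ∈ xs → f z ≡ g z
  ∑-squeeze (x ∷ xs) {f} {g} le ge (here refl) = ≤-antisym (le (here refl)) gx≤fx
    where
    gx≤fx : g x ≤ f x
    gx≤fx = +-cancelʳ-≤ (∑ xs g) (g x) (f x) (≤-trans ge (+-monoʳ-≤ (f x) (∑-mono xs (le ∘ there))))
  ∑-squeeze (x ∷ xs) {f} {g} le ge (there z∈) = ∑-squeeze xs (le ∘ there) rest z∈
    where
    rest : ∑ xs g ≤ ∑ xs f
    rest = +-cancelˡ-≤ (g x) (∑ xs g) (∑ xs f) (≤-trans ge (+-monoˡ-≤ (∑ xs f) (le (here refl))))

  ∑-mem : ∀ {xs} (f : A → ℕ) {z} → z ∈ xs → f z ≤ ∑ xs f
  ∑-mem f (here refl)          = m≤m+n _ _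
  ∑-mem {x ∷ xs} f (there z∈)  = ≤-trans (∑-mem f z∈) (m≤n+m _ (f x))

  ∑-mem₂ : ∀ {xs} (f : A → ℕ) {z w} → z ≢ w → z ∈ xs → w ∈ xs → f z + f w ≤ ∑ xs f
  ∑-mem₂ f z≢w (here refl) (here refl) = contradiction refl z≢w
  ∑-mem₂ f z≢w (here refl) (there w∈)  = +-monoʳ-≤ _ (∑-mem f w∈)
  ∑-mem₂ {x ∷ xs} f {z} {w} z≢w (there z∈) (here refl) =
    subst (_≤ f w + ∑ xs f) (+-comm (f w) (f z)) (+-monoʳ-≤ (f w) (∑-mem f z∈))
  ∑-mem₂ {x ∷ xs} f z≢w (there z∈) (there w∈)  = ≤-trans (∑-mem₂ f z≢w z∈ w∈) (m≤n+m _ (f x))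

  ∑-< : ∀ xs (f g : A → ℕ) → ∑ xs f < ∑ xs g → ∃ λ z → z ∈ xs × f z < g z
  ∑-< (x ∷ xs) f g lt with f x <? g x
  ... | yes fx<gx = x , here refl , fx<gx
  ... | no  fx≮gx with ∑-< xs f g (+-cancelˡ-< (f x) _ _ (<-≤-trans lt (+-monoˡ-≤ _ (≮⇒≥ fx≮gx))))
  ...   | z , z∈ , p = z , there z∈ , p

  ∑-pos : ∀ xs (f : A → ℕ) → 0 < ∑ xs f → ∃ λ z → z ∈ xs × 0 < f z
  ∑-pos xs f 0<n = ∑-< xs (λ _ → 0) f (subst (_< ∑ xs f) (sym (∑-zero xs)) 0<n)

  ∑-single : ∀ {xs} {f : A → ℕ} {z} → Unique xs → z ∈ xs → (∀ {w} → w ≢ z → f w ≡ 0) → ∑ xs f ≡ f z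
  ∑-single {x ∷ xs} {f} (x∉ ∷ u) (here refl) off =
    trans (cong (f x +_) (trans (∑-cong xs (λ w∈ → off (λ { refl → All.lookup x∉ w∈ refl }))) (∑-zero xs)))
          (+-identityʳ (f x))
  ∑-single {x ∷ xs} {f} (x∉ ∷ u) (there z∈) off =
    trans (cong (_+ ∑ xs f) (off (λ { refl → All.lookup x∉ z∈ refl }))) (∑-single u z∈ off)

∑-swap : {A B : Set} (xs : List A) (ys : List B) (f : A → B → ℕ) →
         ∑ xs (λ x → ∑ ys (f x)) ≡ ∑ ys (λ y → ∑ xs (λ x → f x y))
∑-swap []       ys f = sym (∑-zero ys)
∑-swap (x ∷ xs) ys f =
  trans (cong (∑ ys (f x) +_) (∑-swap xs ys f)) (sym (∑-+ ys (f x) (λ y → ∑ xs (λ x → f x y))))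

infixr 8 _▹_

-- An Iverson bracket with a weight. All counts become sums over one fixed list, so that double
-- counting is an exchange of two sums.
_▹_ : {P : Set} → Dec P → ℕ → ℕ
yes _ ▹ n = n
no  _ ▹ n = 0

module _ {P : Set} where

  ▹-yes : (d : Dec P) {n : ℕ} → P → d ▹ n ≡ n
  ▹-yes (yes _) p = refl
  ▹-yes (no ¬p) p = contradiction p ¬p

  ▹-no : (d : Dec P) {n : ℕ} → ¬ P → d ▹ n ≡ 0
  ▹-no (yes p) ¬p = contradiction p ¬p
  ▹-no (no _)  ¬p = refl

  ▹-pos : (d : Dec P) {n : ℕ} → 0 < d ▹ n → P × 0 < n
  ▹-pos (yes p) 0<n = p , 0<n

  ▹-congʳ : (d : Dec P) {m n : ℕ} → (P → m ≡ n) → d ▹ m ≡ d ▹ n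
  ▹-congʳ (yes p) eq = eq p
  ▹-congʳ (no _)  eq = refl

  ▹-monoʳ : (d : Dec P) {m n : ℕ} → (P → m ≤ n) → d ▹ m ≤ d ▹ n
  ▹-monoʳ (yes p) le = le p
  ▹-monoʳ (no _)  le = z≤n

  ▹-* : (d : Dec P) (n : ℕ) → d ▹ n ≡ d ▹ 1 * n
  ▹-* (yes _) n = sym (*-identityˡ n)
  ▹-* (no _)  n = refl

  ▹-+ : (d : Dec P) (m n : ℕ) → d ▹ (m + n) ≡ d ▹ m + d ▹ n
  ▹-+ (yes _) m n = refl
  ▹-+ (no _)  m n = refl

  ▹-∑ : {A : Set} (d : Dec P) (xs : List A) (f : A → ℕ) → d ▹ ∑ xs f ≡ ∑ xs (λ z → d ▹ f z)
  ▹-∑ (yes _) xs f = refl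
  ▹-∑ (no _)  xs f = sym (∑-zero xs)

module _ {P Q : Set} where

  ▹-cong : (d : Dec P) (e : Dec Q) {m n : ℕ} → (P → Q) → (Q → P) → (P → Q → m ≡ n) → d ▹ m ≡ e ▹ n
  ▹-cong (yes p) (yes q) to from eq = eq p q
  ▹-cong (yes p) (no ¬q) to from eq = contradiction (to p) ¬q
  ▹-cong (no ¬p) (yes q) to from eq = contradiction (from q) ¬p
  ▹-cong (no ¬p) (no ¬q) to from eq = refl

  ▹-mono : (d : Dec P) (e : Dec Q) {n : ℕ} → (P → Q) → d ▹ n ≤ e ▹ n
  ▹-mono (yes p) (yes q) to = ≤-refl
  ▹-mono (yes p) (no ¬q) to = contradiction (to p) ¬q
  ▹-mono (no ¬p) e       to = z≤n

  ▹-▹ : (d : Dec P) (e : Dec Q) {n : ℕ} → d ▹ e ▹ n ≡ (d ×-dec e) ▹ n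
  ▹-▹ (yes _) (yes _) = refl
  ▹-▹ (yes _) (no _)  = refl
  ▹-▹ (no _)  e       = refl

module _ {A : Set} where

  ∑-▹-const : (xs : List A) {P : A → Set} (P? : ∀ z → Dec (P z)) (f : A → ℕ) {c : ℕ} →
              (∀ z → P z → f z ≡ c) → ∑ xs (λ z → P? z ▹ f z) ≡ ∑ xs (λ z → P? z ▹ 1) * c
  ∑-▹-const xs P? f {c} eq =
    trans (∑-cong xs (λ {z} _ → trans (▹-congʳ (P? z) (eq z)) (▹-* (P? z) c)))
          (∑-*ʳ xs (λ z → P? z ▹ 1) c)

  ∑-▹-cong : (xs : List A) {P Q : A → Set} (P? : ∀ z → Dec (P z)) (Q? : ∀ z → Dec (Q z)) {f g : A → ℕ} →
             (∀ z → P z → Q z) → (∀ z → Q z → P z) → (∀ z → P z → f z ≡ g z) →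
             ∑ xs (λ z → P? z ▹ f z) ≡ ∑ xs (λ z → Q? z ▹ g z)
  ∑-▹-cong xs P? Q? to from eq = ∑-cong xs (λ {z} _ → ▹-cong (P? z) (Q? z) (to z) (from z) (λ p _ → eq z p))

  -- The general double count: both pairs of guards describe the same incidences (z, w). The weight
  -- `f` makes it apply to chains as well as to pairs.
  ∑-▹-swap : {B : Set} (xs : List A) (ys : List B)
             {P : A → Set} {Q : A → B → Set} {R : B → Set} {S : B → A → Set}
             (P? : ∀ z → Dec (P z)) (Q? : ∀ z w → Dec (Q z w)) (R? : ∀ w → Dec (R w)) (S? : ∀ w z → Dec (S w z))
             (f : A → B → ℕ) →
             (∀ z w → P z → Q z w → R w × S w z) → (∀ z w → R w → S w z → P z × Q z w) →
             ∑ xs (λ z → P? z ▹ ∑ ys (λ w → Q? z w ▹ f z w)) ≡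
             ∑ ys (λ w → R? w ▹ ∑ xs (λ z → S? w z ▹ f z w))
  ∑-▹-swap xs ys P? Q? R? S? f to from = begin
    ∑ xs (λ z → P? z ▹ ∑ ys (λ w → Q? z w ▹ f z w))
      ≡⟨ ∑-cong xs (λ {z} _ → ▹-∑ (P? z) ys _) ⟩
    ∑ xs (λ z → ∑ ys (λ w → P? z ▹ Q? z w ▹ f z w))
      ≡⟨ ∑-swap xs ys _ ⟩
    ∑ ys (λ w → ∑ xs (λ z → P? z ▹ Q? z w ▹ f z w))
      ≡⟨ ∑-cong ys (λ {w} _ → ∑-cong xs (λ {z} _ → guards z w)) ⟩
    ∑ ys (λ w → ∑ xs (λ z → R? w ▹ S? w z ▹ f z w))
      ≡⟨ ∑-cong ys (λ {w} _ → ▹-∑ (R? w) xs _) ⟨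
    ∑ ys (λ w → R? w ▹ ∑ xs (λ z → S? w z ▹ f z w)) ∎
    where
    open ≡-Reasoning
    guards : ∀ z w → P? z ▹ Q? z w ▹ f z w ≡ R? w ▹ S? w z ▹ f z w
    guards z w = trans (▹-▹ (P? z) (Q? z w)) (trans
      (▹-cong (P? z ×-dec Q? z w) (R? w ×-dec S? w z)
              (λ (p , q) → to z w p q) (λ (r , s) → from z w r s) (λ _ _ → refl))
      (sym (▹-▹ (R? w) (S? w z))))

module Counting {A : Set} {L : List A} (L-unique : Unique L) (L-complete : ∀ z → z ∈ L) (_≟ᴬ_ : (z w : A) → Dec (z ≡ w)) where

  # : {P : A → Set} → (∀ z → Dec (P z)) → ℕ
  # P? = ∑ L (λ z → P? z ▹ 1)

  module _ {P : A → Set} (P? : ∀ z → Dec (P z)) where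

    #-exists : 0 < # P? → ∃ P
    #-exists 0<n with ∑-pos L _ 0<n
    ... | z , _ , 0<f = z , proj₁ (▹-pos (P? z) 0<f)

    #-pos : ∀ {z} → P z → 0 < # P?
    #-pos {z} p = subst (_≤ # P?) (▹-yes (P? z) p) (∑-mem (λ z → P? z ▹ 1) (L-complete z))

    #≤1⇒unique : # P? ≤ 1 → ∀ {z w} → P z → P w → z ≡ w
    #≤1⇒unique le {z} {w} p q with z ≟ᴬ w
    ... | yes z≡w = z≡w
    ... | no  z≢w = contradiction
      (≤-trans (subst₂ (λ m n → m + n ≤ # P?) (▹-yes (P? z) p) (▹-yes (P? w) q)
                       (∑-mem₂ (λ z → P? z ▹ 1) z≢w (L-complete z) (L-complete w))) le)
      λ { (s≤s ()) }

    #≡1 : ∀ {z} → P z → (∀ w → P w → w ≡ z) → # P? ≡ 1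
    #≡1 {z} p uniq = trans
      (∑-single L-unique (L-complete z) (λ {w} w≢z → ▹-no (P? w) (w≢z ∘ uniq w)))
      (▹-yes (P? z) p)

    #≡0 : (∀ z → ¬ P z) → # P? ≡ 0
    #≡0 none = trans (∑-cong L (λ {z} _ → ▹-no (P? z) (none z))) (∑-zero L)

    unique⇒#≤1 : (∀ z w → P z → P w → z ≡ w) → # P? ≤ 1
    unique⇒#≤1 uniq with # P? in eq
    ... | zero  = z≤n
    ... | suc n with #-exists (subst (0 <_) (sym eq) z<s)
    ...   | z , p = ≤-reflexive (trans (sym eq) (#≡1 p (λ w q → uniq w z q p)))

    #-remove : (f : A → ℕ) {a : A} → P a →
               ∑ L (λ z → P? z ▹ f z) ≡ f a + ∑ L (λ z → (P? z ×-dec ¬? (z ≟ᴬ a)) ▹ f z)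
    #-remove f {a} pa = begin
      ∑ L (λ z → P? z ▹ f z)
        ≡⟨ ∑-cong L (λ {z} _ → split z) ⟩
      ∑ L (λ z → (z ≟ᴬ a) ▹ f z + (P? z ×-dec ¬? (z ≟ᴬ a)) ▹ f z)
        ≡⟨ ∑-+ L _ _ ⟩
      ∑ L (λ z → (z ≟ᴬ a) ▹ f z) + rest
        ≡⟨ cong (_+ rest) (∑-single L-unique (L-complete a) (λ {w} w≢a → ▹-no (w ≟ᴬ a) w≢a)) ⟩
      (a ≟ᴬ a) ▹ f a + rest
        ≡⟨ cong (_+ rest) (▹-yes (a ≟ᴬ a) refl) ⟩
      f a + rest ∎
      where
      open ≡-Reasoning
      rest = ∑ L (λ z → (P? z ×-dec ¬? (z ≟ᴬ a)) ▹ f z)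
      split : ∀ z → P? z ▹ f z ≡ (z ≟ᴬ a) ▹ f z + (P? z ×-dec ¬? (z ≟ᴬ a)) ▹ f z
      split z with P? z | z ≟ᴬ a
      ... | yes p | yes refl = sym (+-identityʳ _)
      ... | yes p | no  _    = refl
      ... | no ¬p | yes refl = contradiction pa ¬p
      ... | no ¬p | no  _    = refl

  module _ {P Q : A → Set} (P? : ∀ z → Dec (P z)) (Q? : ∀ z → Dec (Q z)) where

    #-cong : (∀ z → P z → Q z) → (∀ z → Q z → P z) → # P? ≡ # Q?
    #-cong to from = ∑-▹-cong L P? Q? to from (λ _ _ → refl)

    #-mono : (∀ z → P z → Q z) → # P? ≤ # Q?
    #-mono to = ∑-mono L (λ {z} _ → ▹-mono (P? z) (Q? z) (to z))

    #-< : # P? < # Q? → ∃ λ z → Q z × ¬ P z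
    #-< lt with ∑-< L _ _ lt
    ... | z , _ , p<q with P? z | Q? z
    ...   | no ¬p | yes q = z , q , ¬p
    ...   | yes _ | yes _ = contradiction p<q λ { (s≤s ()) }

  module _ {P : A → Set} (P? : ∀ z → Dec (P z)) (f : A → ℕ) where

    all-≤1⇒all-≡1 : (∀ z → P z → f z ≤ 1) → # P? ≤ ∑ L (λ z → P? z ▹ f z) → ∀ z → P z → f z ≡ 1
    all-≤1⇒all-≡1 le ge z p =
      trans (sym (▹-yes (P? z) p))
        (trans (∑-squeeze L (λ {z} _ → ▹-monoʳ (P? z) (le z)) ge (L-complete z)) (▹-yes (P? z) p))

    all-≥1⇒all-≡1 : (∀ z → P z → 1 ≤ f z) → ∑ L (λ z → P? z ▹ f z) ≤ # P? → ∀ z → P z → f z ≡ 1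
    all-≥1⇒all-≡1 ge le z p =
      trans (sym (▹-yes (P? z) p))
        (trans (sym (∑-squeeze L (λ {z} _ → ▹-monoʳ (P? z) (ge z)) le (L-complete z))) (▹-yes (P? z) p))

-- Finite graded posets

record FinPoset : Set₁ where
  field
    Carrier        : Set
    _⊑_            : Rel Carrier 0ℓ
    isPartialOrder : IsPartialOrder _≡_ _⊑_
    _⊑?_           : ∀ x y → Dec (x ⊑ y)
    elems          : List Carrier
    elems-unique   : Unique elems
    elems-complete : ∀ z → z ∈ elems
    bot top        : Carrier
    bot-min        : ∀ z → bot ⊑ z
    top-max        : ∀ z → z ⊑ top
    ρ              : Carrier → ℕ
    ρ-bot          : ρ bot ≡ 0
    ρ-strict       : ∀ {x y} → x ⊑ y → x ≢ y → ρ x < ρ y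
    cover-above    : ∀ {x y} → x ⊑ y → x ≢ y → ∃ λ z → x ⊑ z × ρ z ≡ suc (ρ x) × z ⊑ y
    cover-below    : ∀ {x y} → x ⊑ y → x ≢ y → ∃ λ z → x ⊑ z × z ⊑ y × ρ y ≡ suc (ρ z)

module FinPosetTheory (Q : FinPoset) where
  open FinPoset Q public
  open IsPartialOrder isPartialOrder public using ()
    renaming (refl to ⊑-refl; trans to ⊑-trans; antisym to ⊑-antisym)

  infix 4 _◃_

  _≟ᶜ_ : (x y : Carrier) → Dec (x ≡ y)
  x ≟ᶜ y = map′ (λ (p , q) → ⊑-antisym p q) (λ { refl → ⊑-refl , ⊑-refl }) ((x ⊑? y) ×-dec (y ⊑? x))

  open Counting elems-unique elems-complete _≟ᶜ_ public

  _◃_ : Rel Carrier 0ℓ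
  x ◃ y = x ⊑ y × ρ y ≡ suc (ρ x)

  _◃?_ : ∀ x y → Dec (x ◃ y)
  x ◃? y = (x ⊑? y) ×-dec (ρ y ≟ suc (ρ x))

  ρ-mono : ∀ {x y} → x ⊑ y → ρ x ≤ ρ y
  ρ-mono {x} {y} x⊑y with x ≟ᶜ y
  ... | yes refl = ≤-refl
  ... | no  x≢y  = <⇒≤ (ρ-strict x⊑y x≢y)

  ρ-eq : ∀ {x y} → x ⊑ y → ρ y ≤ ρ x → x ≡ y
  ρ-eq {x} {y} x⊑y ge with x ≟ᶜ y
  ... | yes x≡y = x≡y
  ... | no  x≢y = contradiction (ρ-strict x⊑y x≢y) (≤⇒≯ ge)

  ρ≡0⇒bot : ∀ {x} → ρ x ≡ 0 → bot ≡ x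
  ρ≡0⇒bot {x} ρ≡0 = ρ-eq (bot-min x) (≤-trans (≤-reflexive ρ≡0) z≤n)

  bot-least : ∀ {x} → x ⊑ bot → x ≡ bot
  bot-least x⊑bot = ⊑-antisym x⊑bot (bot-min _)

  above-≢bot : ∀ {x y} → x ≢ bot → x ⊑ y → y ≢ bot
  above-≢bot x≢bot x⊑y refl = x≢bot (bot-least x⊑y)

  ρ-suc⇒≢bot : ∀ {x k} → ρ x ≡ suc k → x ≢ bot
  ρ-suc⇒≢bot ρ≡ refl with trans (sym ρ≡) ρ-bot
  ... | ()

  rank-gap : ∀ {x y} → x ⊑ y → ∃ λ k → ρ y ≡ k + ρ x
  rank-gap {x} {y} x⊑y = ρ y ∸ ρ x , sym (m∸n+n≡m (ρ-mono x⊑y))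

  up? : ∀ x y z → Dec (x ◃ z × z ⊑ y)
  up? x y z = (x ◃? z) ×-dec (z ⊑? y)

  down? : ∀ x y z → Dec (x ⊑ z × z ◃ y)
  down? x y z = (x ⊑? z) ×-dec (z ◃? y)

  within? : ∀ r x y z → Dec ((x ⊑ z × z ⊑ y) × ρ z ≡ r)
  within? r x y z = ((x ⊑? z) ×-dec (z ⊑? y)) ×-dec (ρ z ≟ r)

  up down : Carrier → Carrier → ℕ
  up x y = # (up? x y)
  down x y = # (down? x y)

  level : ℕ → Carrier → Carrier → ℕ
  level r x y = # (within? r x y)

  ∃-up : ∀ {x y} → x ⊑ y → x ≢ y → ∃ λ z → x ◃ z × z ⊑ y
  ∃-up x⊑y x≢y with cover-above x⊑y x≢y
  ... | z , x⊑z , ρ≡ , z⊑y = z , (x⊑z , ρ≡) , z⊑y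

  ∃-down : ∀ {x y} → x ⊑ y → x ≢ y → ∃ λ z → x ⊑ z × z ◃ y
  ∃-down = cover-below

  up-reaches : ∀ {x y z} → ρ y ≡ suc (ρ x) → x ◃ z × z ⊑ y → z ≡ y
  up-reaches ρy ((_ , ρz) , z⊑y) = ρ-eq z⊑y (≤-reflexive (trans ρy (sym ρz)))

  down-reaches : ∀ {x y z} → ρ y ≡ suc (ρ x) → x ⊑ z × z ◃ y → z ≡ x
  down-reaches ρy (x⊑z , _ , ρz) = sym (ρ-eq x⊑z (≤-reflexive (suc-injective (trans (sym ρz) ρy))))

  up-≡0 : ∀ {x y} → ρ y ≡ ρ x → up x y ≡ 0
  up-≡0 ρ≡ = #≡0 (up? _ _) λ { z ((_ , ρz) , z⊑y) →
    1+n≰n (≤-trans (≤-reflexive (sym ρz)) (≤-trans (ρ-mono z⊑y) (≤-reflexive ρ≡))) }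

  down-≡0 : ∀ {x y} → ρ y ≡ ρ x → down x y ≡ 0
  down-≡0 ρ≡ = #≡0 (down? _ _) λ { z (x⊑z , _ , ρz) →
    1+n≰n (≤-trans (≤-reflexive (sym ρz)) (≤-trans (≤-reflexive ρ≡) (ρ-mono x⊑z))) }

  -- Both sides count the cover pairs between ranks r and r + 1, by their lower and by their upper
  -- members.
  level-pairs : ∀ r x y → ∑ elems (λ z → within? r x y z ▹ up z y) ≡
                          ∑ elems (λ w → within? (suc r) x y w ▹ down x w)
  level-pairs r x y = ∑-▹-swap elems elems (within? r x y) (λ z w → up? z y w)
    (within? (suc r) x y) (λ w z → down? x w z) (λ _ _ → 1)
    (λ { z w ((x⊑z , z⊑y) , ρz) ((z⊑w , ρw) , w⊑y) →
         ((⊑-trans x⊑z z⊑w , w⊑y) , trans ρw (cong suc ρz)) , x⊑z , z⊑w , ρw })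
    (λ { w z ((x⊑w , w⊑y) , ρw) (x⊑z , z⊑w , ρw′) →
         ((x⊑z , ⊑-trans z⊑w w⊑y) , suc-injective (trans (sym ρw′) ρw)) , (z⊑w , ρw′) , w⊑y })

  level-bottom : ∀ {x y} → x ⊑ y → level (ρ x) x y ≡ 1
  level-bottom x⊑y = #≡1 (within? _ _ _) ((⊑-refl , x⊑y) , refl)
    (λ { w ((x⊑w , _) , ρw) → sym (ρ-eq x⊑w (≤-reflexive ρw)) })

  chains : ℕ → Carrier → Carrier → ℕ
  chains zero    x y = 1
  chains (suc k) x y = ∑ elems (λ z → up? x y z ▹ chains k z y)

  -- `chains` peels off the first step, which gives access to upper covers only. Exchanging the
  -- choices of the first and the last step turns the recursion around and brings in the coatoms.
  chains-below : ∀ k {x y} → x ⊑ y → ρ y ≡ suc k + ρ x →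
                 chains (suc k) x y ≡ ∑ elems (λ c → down? x y c ▹ chains k x c)
  chains-below zero {x} {y} x⊑y ρ≡ = trans
    (#≡1 (up? x y) ((x⊑y , ρ≡) , ⊑-refl) (λ _ → up-reaches ρ≡))
    (sym (#≡1 (down? x y) (⊑-refl , x⊑y , ρ≡) (λ _ → down-reaches ρ≡)))
  chains-below (suc k) {x} {y} x⊑y ρ≡ = trans
    (∑-▹-cong elems (up? x y) (up? x y) (λ _ p → p) (λ _ p → p)
      λ { z ((_ , ρz) , z⊑y) → chains-below k z⊑y (trans ρ≡ (trans (sym (+-suc (suc k) (ρ x))) (cong (suc k +_) (sym ρz)))) })
    (∑-▹-swap elems elems (up? x y) (λ z c → down? z y c) (down? x y) (λ c z → up? x c z) (λ z c → chains k z c)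
      (λ { z c ((x⊑z , ρz) , _) (z⊑c , c◃y) → (⊑-trans x⊑z z⊑c , c◃y) , (x⊑z , ρz) , z⊑c })
      (λ { c z (_ , c⊑y , ρy) (x◃z , z⊑c) → (x◃z , ⊑-trans z⊑c c⊑y) , z⊑c , c⊑y , ρy }))

  -- Purely numerical: every subinterval of rank k has k atoms and k coatoms. `BooleanJoins`
  -- extracts the order structure from these numbers.
  IsBoolean : Carrier → Carrier → Set
  IsBoolean x y = ∀ {u w} k → x ⊑ u → u ⊑ w → w ⊑ y → ρ w ≡ k + ρ u → up u w ≡ k × down u w ≡ k

  IsBoolean-sub : ∀ {x y u w} → x ⊑ u → w ⊑ y → IsBoolean x y → IsBoolean u w
  IsBoolean-sub x⊑u w⊑y B k u⊑a a⊑b b⊑w = B k (⊑-trans x⊑u u⊑a) a⊑b (⊑-trans b⊑w w⊑y)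

  -- Sorting k! chains by their first or last step leaves (k - 1)! for each cover, and this factor
  -- cancels.
  factorials⇒IsBoolean : ∀ {x y} →
    (∀ k {u w} → x ⊑ u → u ⊑ w → w ⊑ y → ρ w ≡ k + ρ u → chains k u w ≡ k !) → IsBoolean x y
  factorials⇒IsBoolean h zero x⊑u u⊑w w⊑y ρ≡ = up-≡0 ρ≡ , down-≡0 ρ≡
  factorials⇒IsBoolean {x} {y} h {u} {w} (suc k) x⊑u u⊑w w⊑y ρ≡ =
    cancel (up u w) (trans (sym (∑-▹-const elems (up? u w) _ λ { z ((u⊑z , ρz) , z⊑w) →
             h k (⊑-trans x⊑u u⊑z) z⊑w w⊑y (trans ρ≡ (trans (sym (+-suc k (ρ u))) (cong (k +_) (sym ρz)))) }))
             (h (suc k) x⊑u u⊑w w⊑y ρ≡)) ,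
    cancel (down u w) (trans (sym (∑-▹-const elems (down? u w) _ λ { c (u⊑c , c⊑w , ρw) →
             h k x⊑u u⊑c (⊑-trans c⊑w w⊑y) (suc-injective (trans (sym ρw) ρ≡)) }))
             (trans (sym (chains-below k u⊑w ρ≡)) (h (suc k) x⊑u u⊑w w⊑y ρ≡)))
    where
    cancel : ∀ m → m * k ! ≡ suc k ! → m ≡ suc k
    cancel m = *-cancelʳ-≡ m (suc k) (k !) {{k !≢0}}

  -- Elements of relative rank k have j + 1 upper covers and those of relative rank k + 1 have k + 1
  -- lower ones, so the level sizes obey the recursion of the binomial coefficients.
  level-! : ∀ {x y} → IsBoolean x y → x ⊑ y → ∀ k j → ρ y ≡ k + j + ρ x →
            level (k + ρ x) x y * (k ! * j !) ≡ (k + j) !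
  level-! {x} {y} B x⊑y zero j ρ≡ =
    trans (cong (_* (1 * j !)) (level-bottom x⊑y)) (trans (*-identityˡ (1 * j !)) (*-identityˡ (j !)))
  level-! {x} {y} B x⊑y (suc k) j ρ≡ = begin
    level (suc k + ρ x) x y * (suc k * k ! * j !)    ≡⟨ move (level (suc k + ρ x) x y) (suc k) (k !) (j !) ⟩
    level (suc k + ρ x) x y * suc k * (k ! * j !)    ≡⟨ cong (_* (k ! * j !)) step ⟨
    level (k + ρ x) x y * suc j * (k ! * j !)        ≡⟨ move′ (level (k + ρ x) x y) (suc j) (k !) (j !) ⟩
    level (k + ρ x) x y * (k ! * suc j !)            ≡⟨ level-! B x⊑y k (suc j) (trans ρ≡ (cong (_+ ρ x) (sym (+-suc k j)))) ⟩
    (k + suc j) !                                    ≡⟨ cong _! (+-suc k j) ⟩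
    suc (k + j) !                                    ∎
    where
    open ≡-Reasoning
    move : ∀ l s a b → l * (s * a * b) ≡ l * s * (a * b)
    move = ringℕ
    move′ : ∀ l s a b → l * s * (a * b) ≡ l * (a * (s * b))
    move′ = ringℕ
    gap : ∀ k j p → suc k + j + p ≡ suc j + (k + p)
    gap = ringℕ
    step : level (k + ρ x) x y * suc j ≡ level (suc k + ρ x) x y * suc k
    step = trans
      (sym (∑-▹-const elems (within? (k + ρ x) x y) _ λ { z ((x⊑z , z⊑y) , ρz) →
        proj₁ (B (suc j) x⊑z z⊑y ⊑-refl (trans ρ≡ (trans (gap k j (ρ x)) (cong (suc j +_) (sym ρz))))) }))
      (trans (level-pairs (k + ρ x) x y)
      (∑-▹-const elems (within? (suc k + ρ x) x y) _ λ { w ((x⊑w , w⊑y) , ρw) →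
        proj₂ (B (suc k) ⊑-refl x⊑w w⊑y ρw) }))

-- Unique joins with atoms from Boolean cover numbers

module BooleanJoins (Q : FinPoset) where
  open FinPosetTheory Q

  joins? : ∀ z a y w → Dec ((z ◃ w × w ⊑ y) × a ⊑ w)
  joins? z a y w = up? z y w ×-dec (a ⊑? w)

  joins : Carrier → Carrier → Carrier → ℕ
  joins z a y = # (joins? z a y)

  UniqueJoin : ℕ → Set
  UniqueJoin n = ∀ {x y z a} → IsBoolean x y → ρ y ≡ n + ρ x → x ⊑ z → z ⊑ y → x ◃ a → a ⊑ y →
                 ¬ a ⊑ z → joins z a y ≡ 1

  UniqueAtomJoin : ℕ → Set
  UniqueAtomJoin n = ∀ {x y a b} → IsBoolean x y → ρ y ≡ n + ρ x → x ◃ a → a ⊑ y → x ◃ b → b ⊑ y →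
                     a ≢ b → joins b a y ≡ 1

  atom-≡ : ∀ {x a b} → x ◃ a → x ◃ b → a ⊑ b → a ≡ b
  atom-≡ (_ , ρa) (_ , ρb) a⊑b = ρ-eq a⊑b (≤-reflexive (trans ρb (sym ρa)))

  joins-sym : ∀ {x a b y} → x ◃ a → x ◃ b → joins b a y ≡ joins a b y
  joins-sym {x} {a} {b} {y} (_ , ρa) (_ , ρb) = #-cong (joins? b a y) (joins? a b y)
    (λ { w (((b⊑w , ρw) , w⊑y) , a⊑w) → ((a⊑w , trans ρw (cong suc (trans ρb (sym ρa)))) , w⊑y) , b⊑w })
    (λ { w (((a⊑w , ρw) , w⊑y) , b⊑w) → ((b⊑w , trans ρw (cong suc (trans ρa (sym ρb)))) , w⊑y) , a⊑w })

  otherAtom? : ∀ x y b c → Dec ((x ◃ c × c ⊑ y) × c ≢ b)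
  otherAtom? x y b c = up? x y c ×-dec ¬? (c ≟ᶜ b)

  module _ {x y b : Carrier} {n : ℕ} (B : IsBoolean x y) (ρy : ρ y ≡ suc n + ρ x) (x◃b : x ◃ b) (b⊑y : b ⊑ y) where
    private
      x⊑y = ⊑-trans (proj₁ x◃b) b⊑y

    otherAtom-count : # (otherAtom? x y b) ≡ n
    otherAtom-count = suc-injective (trans (sym (#-remove (up? x y) (λ _ → 1) (x◃b , b⊑y)))
                                           (proj₁ (B (suc n) ⊑-refl x⊑y ⊑-refl ρy)))

    -- Each of the n covers w of b bounds a rank 2 interval [x, w] with exactly one atom besides b.
    -- As there are n other atoms, the join numbers average to 1, and a bound on one side suffices
    -- to make them all 1.
    joins-total : ∑ elems (λ c → otherAtom? x y b c ▹ joins b c y) ≡ n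
    joins-total = begin
      ∑ elems (λ c → otherAtom? x y b c ▹ joins b c y)
        ≡⟨ ∑-▹-swap elems elems (otherAtom? x y b) (λ c w → joins? b c y w) (up? b y) (λ w c → otherAtom? x w b c) (λ _ _ → 1)
             (λ { c w ((x◃c , _) , c≢b) (b◃w⊑y , c⊑w) → b◃w⊑y , (x◃c , c⊑w) , c≢b })
             (λ { w c (b◃w , w⊑y) ((x◃c , c⊑w) , c≢b) → ((x◃c , ⊑-trans c⊑w w⊑y) , c≢b) , (b◃w , w⊑y) , c⊑w }) ⟩
      ∑ elems (λ w → up? b y w ▹ # (otherAtom? x w b))
        ≡⟨ ∑-▹-const elems (up? b y) _ (λ { w ((b⊑w , ρw) , w⊑y) → one b⊑w ρw w⊑y }) ⟩
      up b y * 1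
        ≡⟨ *-identityʳ (up b y) ⟩
      up b y
        ≡⟨ proj₁ (B n (proj₁ x◃b) b⊑y ⊑-refl (trans ρy (trans (sym (+-suc n (ρ x))) (cong (n +_) (sym (proj₂ x◃b)))))) ⟩
      n ∎
      where
      open ≡-Reasoning
      one : ∀ {w} → b ⊑ w → ρ w ≡ suc (ρ b) → w ⊑ y → # (otherAtom? x w b) ≡ 1
      one {w} b⊑w ρw w⊑y = suc-injective (trans (sym (#-remove (up? x w) (λ _ → 1) (x◃b , b⊑w)))
        (proj₁ (B 2 ⊑-refl (⊑-trans (proj₁ x◃b) b⊑w) w⊑y (trans ρw (cong suc (proj₂ x◃b))))))

  -- In rank 3 the pairwise join numbers K of the three atoms satisfy K ab + K ac = K ab + K bc = K ac + K bc = 2.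
  joins-rank3 : ∀ {x y a b} → IsBoolean x y → ρ y ≡ 3 + ρ x → x ◃ a → a ⊑ y → x ◃ b → b ⊑ y → a ≢ b → 1 ≤ joins b a y
  joins-rank3 {x} {y} {a} {b} B ρy x◃a a⊑y x◃b b⊑y a≢b = conclude (joins b a y) total
    where
    third? : ∀ c → Dec (((x ◃ c × c ⊑ y) × c ≢ b) × c ≢ a)
    third? c = otherAtom? x y b c ×-dec ¬? (c ≟ᶜ a)

    third-count : # third? ≡ 1
    third-count = suc-injective (trans (sym (#-remove (otherAtom? x y b) (λ _ → 1) ((x◃a , a⊑y) , a≢b)))
                                       (otherAtom-count B ρy x◃b b⊑y))

    sum-b : joins b a y + ∑ elems (λ c → third? c ▹ joins b c y) ≡ 2
    sum-b = trans (sym (#-remove (otherAtom? x y b) (λ c → joins b c y) ((x◃a , a⊑y) , a≢b)))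
                  (joins-total B ρy x◃b b⊑y)

    sum-a : joins b a y + ∑ elems (λ c → third? c ▹ joins a c y) ≡ 2
    sum-a = trans (cong₂ _+_ (joins-sym x◃a x◃b)
                    (∑-▹-cong elems third? (λ c → otherAtom? x y a c ×-dec ¬? (c ≟ᶜ b))
                      (λ { _ ((p , q) , r) → (p , r) , q }) (λ { _ ((p , q) , r) → (p , r) , q }) (λ _ _ → refl)))
            (trans (sym (#-remove (otherAtom? x y a) (λ c → joins a c y) ((x◃b , b⊑y) , a≢b ∘ sym)))
                   (joins-total B ρy x◃a a⊑y))

    bound : ∀ c → ((x ◃ c × c ⊑ y) × c ≢ b) × c ≢ a → joins b c y + joins a c y ≤ 2
    bound c (((x◃c , c⊑y) , c≢b) , c≢a) = subst₂ (λ m n → m + n ≤ 2)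
      (trans (▹-yes (otherAtom? x y c b) ((x◃b , b⊑y) , c≢b ∘ sym)) (sym (joins-sym x◃c x◃b)))
      (trans (▹-yes (otherAtom? x y c a) ((x◃a , a⊑y) , c≢a ∘ sym)) (sym (joins-sym x◃c x◃a)))
      (≤-trans (∑-mem₂ (λ d → otherAtom? x y c d ▹ joins c d y) (a≢b ∘ sym) (elems-complete b) (elems-complete a))
               (≤-reflexive (joins-total B ρy x◃c c⊑y)))

    rest : ∑ elems (λ c → third? c ▹ joins b c y) + ∑ elems (λ c → third? c ▹ joins a c y) ≤ 2
    rest = begin
      ∑ elems (λ c → third? c ▹ joins b c y) + ∑ elems (λ c → third? c ▹ joins a c y)
        ≡⟨ ∑-+ elems _ _ ⟨
      ∑ elems (λ c → third? c ▹ joins b c y + third? c ▹ joins a c y)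
        ≡⟨ ∑-cong elems (λ {c} _ → sym (▹-+ (third? c) (joins b c y) (joins a c y))) ⟩
      ∑ elems (λ c → third? c ▹ (joins b c y + joins a c y))
        ≤⟨ ∑-mono elems (λ {c} _ → ▹-monoʳ (third? c) (bound c)) ⟩
      ∑ elems (λ c → third? c ▹ 2)
        ≡⟨ ∑-▹-const elems third? (λ _ → 2) (λ _ _ → refl) ⟩
      # third? * 2
        ≡⟨ cong (_* 2) third-count ⟩
      2 ∎
      where open ≤-Reasoning

    total : joins b a y + joins b a y + 2 ≥ 4
    total = ≤-trans (≤-reflexive (trans (cong₂ _+_ (sym sum-b) (sym sum-a)) (shuffle (joins b a y) _ _))) (+-monoʳ-≤ (joins b a y + joins b a y) rest)
      where
      shuffle : ∀ k p q → k + p + (k + q) ≡ k + k + (p + q)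
      shuffle = ringℕ

    conclude : ∀ k → k + k + 2 ≥ 4 → 1 ≤ k
    conclude zero    (s≤s (s≤s ()))
    conclude (suc k) _ = z<s

  private
    -- In ranks 2 and 3 every join number is at least 1. From rank 4 on it is at most 1: two covers
    -- e and f of b above c are atoms of [b, y], hence have a common cover g by induction, and
    -- [x, g] has rank 3, where e = f by induction again. In rank 3 the element g would be y itself
    -- and nothing would descend, so that rank needs its own argument.
    atomJoin-step : ∀ {N} → (∀ {m} → m < N → UniqueJoin m) → ∀ n → n ≤ N → UniqueAtomJoin n
    atomJoin-step IH 0 n≤N {x} {y} {a} B ρy x◃a a⊑y x◃b b⊑y a≢b =
      contradiction (≤-trans (≤-reflexive (sym (proj₂ x◃a))) (≤-trans (ρ-mono a⊑y) (≤-reflexive ρy))) 1+n≰n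
    atomJoin-step IH 1 n≤N B ρy x◃a a⊑y x◃b b⊑y a≢b =
      contradiction (trans (up-reaches ρy (x◃a , a⊑y)) (sym (up-reaches ρy (x◃b , b⊑y)))) a≢b
    atomJoin-step IH 2 n≤N {x} {y} {a} {b} B ρy x◃a a⊑y x◃b b⊑y a≢b =
      all-≥1⇒all-≡1 (otherAtom? x y b) (λ c → joins b c y)
        (λ { c ((x◃c , c⊑y) , _) → #-pos (joins? b c y) (((b⊑y , trans ρy (cong suc (sym (proj₂ x◃b)))) , ⊑-refl) , c⊑y) })
        (≤-reflexive (trans (joins-total B ρy x◃b b⊑y) (sym (otherAtom-count B ρy x◃b b⊑y))))
        a ((x◃a , a⊑y) , a≢b)
    atomJoin-step IH 3 n≤N {x} {y} {a} {b} B ρy x◃a a⊑y x◃b b⊑y a≢b =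
      all-≥1⇒all-≡1 (otherAtom? x y b) (λ c → joins b c y)
        (λ { c ((x◃c , c⊑y) , c≢b) → joins-rank3 B ρy x◃c c⊑y x◃b b⊑y c≢b })
        (≤-reflexive (trans (joins-total B ρy x◃b b⊑y) (sym (otherAtom-count B ρy x◃b b⊑y))))
        a ((x◃a , a⊑y) , a≢b)
    atomJoin-step IH (suc (suc (suc (suc k)))) n≤N {x} {y} {a} {b} B ρy x◃a a⊑y x◃b b⊑y a≢b =
      all-≤1⇒all-≡1 (otherAtom? x y b) (λ c → joins b c y)
        (λ { c ((x◃c , c⊑y) , c≢b) → unique⇒#≤1 (joins? b c y) (same x◃c c≢b) })
        (≤-reflexive (trans (otherAtom-count B ρy x◃b b⊑y) (sym (joins-total B ρy x◃b b⊑y))))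
        a ((x◃a , a⊑y) , a≢b)
      where
      ρy′ : ρ y ≡ suc (suc (suc k)) + ρ b
      ρy′ = trans ρy (trans (sym (+-suc (suc (suc (suc k))) (ρ x))) (cong (suc (suc (suc k)) +_) (sym (proj₂ x◃b))))

      same : ∀ {c} → x ◃ c → c ≢ b → ∀ e f → (b ◃ e × e ⊑ y) × c ⊑ e → (b ◃ f × f ⊑ y) × c ⊑ f → e ≡ f
      same {c} x◃c c≢b e f ((b◃e , e⊑y) , c⊑e) ((b◃f , f⊑y) , c⊑f) with e ≟ᶜ f
      ... | yes e≡f = e≡f
      ... | no  e≢f with #-exists (joins? e f y) (subst (0 <_) (sym (IH n≤N (IsBoolean-sub (proj₁ x◃b) ⊑-refl B) ρy′
                                     (proj₁ b◃e) e⊑y b◃f f⊑y (e≢f ∘ sym ∘ atom-≡ b◃f b◃e))) z<s)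
      ...   | g , ((e⊑g , ρg) , g⊑y) , f⊑g =
        #≤1⇒unique (joins? b c g)
          (≤-reflexive (IH (≤-trans (s≤s (s≤s (s≤s (s≤s z≤n)))) n≤N) (IsBoolean-sub ⊑-refl g⊑y B)
            (trans ρg (cong suc (trans (proj₂ b◃e) (cong suc (proj₂ x◃b)))))
            (proj₁ x◃b) (⊑-trans (proj₁ b◃e) e⊑g) x◃c (⊑-trans c⊑e e⊑g) (c≢b ∘ atom-≡ x◃c x◃b)))
          ((b◃e , e⊑g) , c⊑e) ((b◃f , f⊑g) , c⊑f)

    -- Take an atom b below z and the cover e of b above a. A cover of z above a lies above some
    -- cover of b above a, and this is e by uniqueness in [x, y]. So a may be replaced by e, which
    -- is an atom of the smaller interval [b, y].
    join-step : ∀ {N} → (∀ {m} → m < N → UniqueJoin m) → ∀ {n} → n ≤ N → UniqueJoin n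
    join-step {N} IH {n} n≤N {x} {y} {z} {a} B ρy x⊑z z⊑y x◃a a⊑y a⋢z with x ≟ᶜ z
    ... | yes refl = #≡1 (joins? z a y) ((x◃a , a⊑y) , ⊑-refl) (λ { w ((x◃w , _) , a⊑w) → sym (atom-≡ x◃a x◃w a⊑w) })
    ... | no  x≢z with ∃-up x⊑z x≢z
    ...   | b , x◃b , b⊑z = via n n≤N ρy
      where
      a≢b : a ≢ b
      a≢b refl = a⋢z b⊑z
      b⊑y = ⊑-trans b⊑z z⊑y
      via : ∀ n → n ≤ N → ρ y ≡ n + ρ x → joins z a y ≡ 1
      via zero n≤N ρy = contradiction (≤-trans (≤-reflexive (sym (proj₂ x◃a))) (≤-trans (ρ-mono a⊑y) (≤-reflexive ρy))) 1+n≰n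
      via (suc m) n≤N ρy with #-exists (joins? b a y) (subst (0 <_) (sym (atomJoin-step IH (suc m) n≤N B ρy x◃a a⊑y x◃b b⊑y a≢b)) z<s)
      ... | e , (b◃e , e⊑y) , a⊑e = trans
        (#-cong (joins? z a y) (joins? z e y)
          (λ { w (z◃w , a⊑w) → z◃w , e⊑ z◃w a⊑w }) (λ { w (z◃w , e⊑w) → z◃w , ⊑-trans a⊑e e⊑w }))
        (IH n≤N (IsBoolean-sub (proj₁ x◃b) ⊑-refl B)
          (trans ρy (trans (sym (+-suc m (ρ x))) (cong (m +_) (sym (proj₂ x◃b)))))
          b⊑z z⊑y b◃e e⊑y (λ e⊑z → a⋢z (⊑-trans a⊑e e⊑z)))
        where
        e⊑ : ∀ {w} → z ◃ w × w ⊑ y → a ⊑ w → e ⊑ w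
        e⊑ {w} ((z⊑w , _) , w⊑y) a⊑w with rank-gap (⊑-trans x⊑z z⊑w)
        ... | k , ρw with #-exists (joins? b a w) (subst (0 <_) (sym (atomJoin-step IH k k≤N (IsBoolean-sub ⊑-refl w⊑y B) ρw
                             x◃a a⊑w x◃b (⊑-trans b⊑z z⊑w) a≢b)) z<s)
          where
          k≤N : k ≤ N
          k≤N = ≤-trans (+-cancelʳ-≤ (ρ x) k (suc m) (subst₂ _≤_ ρw ρy (ρ-mono w⊑y))) n≤N
        ...   | f , (b◃f , f⊑w) , a⊑f = subst (_⊑ w)
          (#≤1⇒unique (joins? b a y) (≤-reflexive (atomJoin-step IH (suc m) n≤N B ρy x◃a a⊑y x◃b b⊑y a≢b))
            ((b◃f , ⊑-trans f⊑w w⊑y) , a⊑f) ((b◃e , e⊑y) , a⊑e)) f⊑w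

    joins-below : ∀ N {n} → n < N → UniqueJoin n
    joins-below (suc N) (s≤s n≤N) = join-step (joins-below N) n≤N

  uniqueJoin : ∀ n → UniqueJoin n
  uniqueJoin n = joins-below (suc n) ≤-refl

  -- A coatom c of z lies below w by induction. Counting atoms yields one, a, below z but not below
  -- c. Some cover of c above a lies below w, and since c has only one such cover in [x, y], it is
  -- z.
  atoms-reflect : ∀ {x y} → IsBoolean x y → ∀ k {z w} → ρ z ≡ k + ρ x → x ⊑ z → z ⊑ y → x ⊑ w → w ⊑ y →
                  (∀ {a} → x ◃ a → a ⊑ z → a ⊑ w) → z ⊑ w
  atoms-reflect B zero ρz x⊑z z⊑y x⊑w w⊑y sub = subst (_⊑ _) (ρ-eq x⊑z (≤-reflexive ρz)) x⊑w
  atoms-reflect {x} {y} B (suc k) {z} {w} ρz x⊑z z⊑y x⊑w w⊑y sub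
    with ∃-down x⊑z (λ { refl → m≢1+n+m (ρ x) ρz })
  ... | c , x⊑c , c⊑z , ρz′
    with #-< (up? x c) (up? x z) (subst₂ _<_ (sym (proj₁ (B k ⊑-refl x⊑c (⊑-trans c⊑z z⊑y) ρc)))
                                              (sym (proj₁ (B (suc k) ⊑-refl x⊑z z⊑y ρz))) ≤-refl)
    where
    ρc = suc-injective (trans (sym ρz′) ρz)
  ...   | a , (x◃a , a⊑z) , a⋢c
    with #-exists (joins? c a w) (subst (0 <_) (sym (uniqueJoin _ (IsBoolean-sub ⊑-refl w⊑y B) (proj₂ (rank-gap x⊑w)) x⊑c
                     (atoms-reflect B k ρc x⊑c (⊑-trans c⊑z z⊑y) x⊑w w⊑y (λ x◃b b⊑c → sub x◃b (⊑-trans b⊑c c⊑z)))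
                     x◃a (sub x◃a a⊑z) (λ a⊑c → a⋢c (x◃a , a⊑c)))) z<s)
    where
    ρc = suc-injective (trans (sym ρz′) ρz)
  ...   | f , (c◃f , f⊑w) , a⊑f = subst (_⊑ w)
          (#≤1⇒unique (joins? c a y)
            (≤-reflexive (uniqueJoin _ B (proj₂ (rank-gap (⊑-trans x⊑z z⊑y))) x⊑c (⊑-trans c⊑z z⊑y) x◃a (⊑-trans a⊑z z⊑y)
                           (λ a⊑c → a⋢c (x◃a , a⊑c))))
            ((c◃f , ⊑-trans f⊑w w⊑y) , a⊑f) (((c⊑z , ρz′) , z⊑y) , a⊑z)) f⊑w

-- Integer sums and the binomial theorem

∑< : ℕ → (ℕ → ℤ) → ℤ
∑< zero    f = 0ℤ
∑< (suc n) f = ∑< n f ℤ.+ f n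

∑<-cong : ∀ n {f g} → (∀ k → k < n → f k ≡ g k) → ∑< n f ≡ ∑< n g
∑<-cong zero    eq = refl
∑<-cong (suc n) eq = cong₂ ℤ._+_ (∑<-cong n (λ k k<n → eq k (m<n⇒m<1+n k<n))) (eq n ≤-refl)

∑<-+ : ∀ n f g → ∑< n (λ k → f k ℤ.+ g k) ≡ ∑< n f ℤ.+ ∑< n g
∑<-+ zero    f g = refl
∑<-+ (suc n) f g = trans (cong (ℤ._+ (f n ℤ.+ g n)) (∑<-+ n f g)) (shuffle (∑< n f) (∑< n g) (f n) (g n))
  where
  shuffle : ∀ a b c d → a ℤ.+ b ℤ.+ (c ℤ.+ d) ≡ a ℤ.+ c ℤ.+ (b ℤ.+ d)
  shuffle = ringℤ

∑<-*ˡ : ∀ n c f → ∑< n (λ k → c ℤ.* f k) ≡ c ℤ.* ∑< n f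
∑<-*ˡ zero    c f = sym (ℤ.*-zeroʳ c)
∑<-*ˡ (suc n) c f = trans (cong (ℤ._+ c ℤ.* f n) (∑<-*ˡ n c f)) (sym (ℤ.*-distribˡ-+ c (∑< n f) (f n)))

∑<-zero : ∀ n → ∑< n (λ _ → 0ℤ) ≡ 0ℤ
∑<-zero zero    = refl
∑<-zero (suc n) = trans (ℤ.+-identityʳ _) (∑<-zero n)

∑<-split : ∀ n f → ∑< (suc n) f ≡ f 0 ℤ.+ ∑< n (f ∘ suc)
∑<-split zero    f = trans (ℤ.+-identityˡ (f 0)) (sym (ℤ.+-identityʳ (f 0)))
∑<-split (suc n) f = trans (cong (ℤ._+ f (suc n)) (∑<-split n f)) (ℤ.+-assoc (f 0) (∑< n (f ∘ suc)) (f (suc n)))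

C-! : ∀ k j → ((k + j) C k) * (k ! * j !) ≡ (k + j) !
C-! k j = trans
  (cong (λ i → ((k + j) C k) * (k ! * i !)) (sym (m+n∸m≡n k j)))
  (trans (cong (_* (k ! * (k + j ∸ k) !)) (nCk≡n!/k![n-k]! k≤k+j))
         (m/n*n≡m (subst (_∣ (k + j) !) (*-comm ((k + j ∸ k) !) (k !)) ([n∸k]!k!∣n! k≤k+j))))
  where
  k≤k+j = m≤m+n k j
  instance _ = k !* (k + j ∸ k) !≢0

binomialSum : ℕ → (ℕ → ℤ) → ℤ
binomialSum n h = ∑< (suc n) (λ k → pos (n C k) ℤ.* h k)

binomialSum-suc : ∀ n h → binomialSum (suc n) h ≡ binomialSum n h ℤ.+ binomialSum n (h ∘ suc)
binomialSum-suc n h = begin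
  ∑< (suc (suc n)) (λ k → pos (suc n C k) ℤ.* h k)
    ≡⟨ ∑<-split (suc n) _ ⟩
  c₀ ℤ.+ ∑< (suc n) (λ k → pos (suc n C suc k) ℤ.* h (suc k))
    ≡⟨ cong (λ s → c₀ ℤ.+ s) (trans (∑<-cong (suc n) (λ k _ → pascal k)) (∑<-+ (suc n) _ _)) ⟩
  c₀ ℤ.+ (binomialSum n (h ∘ suc) ℤ.+ tail)
    ≡⟨ rotate c₀ (binomialSum n (h ∘ suc)) tail ⟩
  (c₀ ℤ.+ tail) ℤ.+ binomialSum n (h ∘ suc)
    ≡⟨ cong (ℤ._+ binomialSum n (h ∘ suc)) (∑<-split (suc n) (λ k → pos (n C k) ℤ.* h k)) ⟨
  (binomialSum n h ℤ.+ pos (n C suc n) ℤ.* h (suc n)) ℤ.+ binomialSum n (h ∘ suc)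
    ≡⟨ cong (ℤ._+ binomialSum n (h ∘ suc)) (trans (cong (λ c → binomialSum n h ℤ.+ pos c ℤ.* h (suc n)) (k>n⇒nCk≡0 (n<1+n n))) (ℤ.+-identityʳ (binomialSum n h))) ⟩
  binomialSum n h ℤ.+ binomialSum n (h ∘ suc) ∎
  where
  open ≡-Reasoning
  c₀ = pos 1 ℤ.* h 0
  tail = ∑< (suc n) (λ k → pos (n C suc k) ℤ.* h (suc k))
  rotate : ∀ a b c → a ℤ.+ (b ℤ.+ c) ≡ (a ℤ.+ c) ℤ.+ b
  rotate = ringℤ
  pascal : ∀ k → pos (suc n C suc k) ℤ.* h (suc k) ≡ pos (n C k) ℤ.* h (suc k) ℤ.+ pos (n C suc k) ℤ.* h (suc k)
  pascal k = trans (cong (λ c → pos c ℤ.* h (suc k)) (sym (nCk+nC[k+1]≡[n+1]C[k+1] n k)))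
                   (trans (cong (ℤ._* h (suc k)) (ℤ.pos-+ (n C k) (n C suc k)))
                          (ℤ.*-distribʳ-+ (h (suc k)) (pos (n C k)) (pos (n C suc k))))

binomialSum-cong : ∀ n {f g} → (∀ k → k ≤ n → f k ≡ g k) → binomialSum n f ≡ binomialSum n g
binomialSum-cong n eq = ∑<-cong (suc n) (λ k k<1+n → cong (pos (n C k) ℤ.*_) (eq k (≤-pred k<1+n)))

binomialSum-*ˡ : ∀ n c f → binomialSum n (λ k → c ℤ.* f k) ≡ c ℤ.* binomialSum n f
binomialSum-*ˡ n c f = trans (∑<-cong (suc n) (λ k _ → swap (pos (n C k)) c (f k))) (∑<-*ˡ (suc n) c _)
  where
  swap : ∀ a b d → a ℤ.* (b ℤ.* d) ≡ b ℤ.* (a ℤ.* d)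
  swap = ringℤ

-- The spare exponent m makes the induction over n go through.
binomialTheorem-shifted : ∀ x y n m → binomialSum n (λ k → x ℤ.^ k ℤ.* y ℤ.^ (n + m ∸ k)) ≡ (x ℤ.+ y) ℤ.^ n ℤ.* y ℤ.^ m
binomialTheorem-shifted x y zero    m = simplify (y ℤ.^ m)
  where
  simplify : ∀ a → 0ℤ ℤ.+ pos 1 ℤ.* (1ℤ ℤ.* a) ≡ 1ℤ ℤ.* a
  simplify = ringℤ
binomialTheorem-shifted x y (suc n) m = begin
  binomialSum (suc n) h
    ≡⟨ binomialSum-suc n h ⟩
  binomialSum n h ℤ.+ binomialSum n (h ∘ suc)
    ≡⟨ cong₂ ℤ._+_ (binomialSum-cong n (λ k _ → cong (λ e → x ℤ.^ k ℤ.* y ℤ.^ (e ∸ k)) (sym (+-suc n m))))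
                   (trans (binomialSum-cong n (λ k _ → ℤ.*-assoc x (x ℤ.^ k) (y ℤ.^ (n + m ∸ k)))) (binomialSum-*ˡ n x _)) ⟩
  binomialSum n (λ k → x ℤ.^ k ℤ.* y ℤ.^ (n + suc m ∸ k)) ℤ.+ x ℤ.* binomialSum n (λ k → x ℤ.^ k ℤ.* y ℤ.^ (n + m ∸ k))
    ≡⟨ cong₂ (λ a b → a ℤ.+ x ℤ.* b) (binomialTheorem-shifted x y n (suc m)) (binomialTheorem-shifted x y n m) ⟩
  (x ℤ.+ y) ℤ.^ n ℤ.* (y ℤ.* y ℤ.^ m) ℤ.+ x ℤ.* ((x ℤ.+ y) ℤ.^ n ℤ.* y ℤ.^ m)
    ≡⟨ collect x y ((x ℤ.+ y) ℤ.^ n) (y ℤ.^ m) ⟩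
  (x ℤ.+ y) ℤ.* (x ℤ.+ y) ℤ.^ n ℤ.* y ℤ.^ m ∎
  where
  open ≡-Reasoning
  h = λ k → x ℤ.^ k ℤ.* y ℤ.^ (suc n + m ∸ k)
  collect : ∀ x y a b → a ℤ.* (y ℤ.* b) ℤ.+ x ℤ.* (a ℤ.* b) ≡ (x ℤ.+ y) ℤ.* a ℤ.* b
  collect = ringℤ

binomialTheorem : ∀ x y n → binomialSum n (λ k → x ℤ.^ k ℤ.* y ℤ.^ (n ∸ k)) ≡ (x ℤ.+ y) ℤ.^ n
binomialTheorem x y n = trans
  (binomialSum-cong n (λ k _ → cong (λ e → x ℤ.^ k ℤ.* y ℤ.^ (e ∸ k)) (sym (+-identityʳ n))))
  (trans (binomialTheorem-shifted x y n 0) (ℤ.*-identityʳ _))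

pos-^ : ∀ b j → pos (b ^ j) ≡ pos b ℤ.^ j
pos-^ b zero    = refl
pos-^ b (suc j) = trans (ℤ.pos-* b (b ^ j)) (cong (pos b ℤ.*_) (pos-^ b j))

∑<-pick : ∀ n r (h : ℕ → ℤ) → r < n → ∑< n (λ k → pos ((r ≟ k) ▹ 1) ℤ.* h k) ≡ h r
∑<-pick (suc n) r h r<1+n with r ≟ n
... | yes refl = trans
  (cong (ℤ._+ 1ℤ ℤ.* h r) (trans (∑<-cong r (λ k k<r → cong (λ c → pos c ℤ.* h k) (▹-no (r ≟ k) (λ { refl → <-irrefl refl k<r })))) (∑<-zero r)))
  (trans (ℤ.+-identityˡ _) (ℤ.*-identityˡ (h r)))
... | no r≢n = trans (ℤ.+-identityʳ _) (∑<-pick n r h (≤∧≢⇒< (≤-pred r<1+n) r≢n))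

sum-by-rank : {A : Set} (xs : List A) (r : A → ℕ) (h : ℕ → ℤ) (n : ℕ) → (∀ {z} → z ∈ xs → r z < n) →
              foldr ℤ._+_ 0ℤ (map (h ∘ r) xs) ≡ ∑< n (λ k → pos (∑ xs (λ z → (r z ≟ k) ▹ 1)) ℤ.* h k)
sum-by-rank []       r h n bound = sym (∑<-zero n)
sum-by-rank (x ∷ xs) r h n bound = begin
  h (r x) ℤ.+ foldr ℤ._+_ 0ℤ (map (h ∘ r) xs)
    ≡⟨ cong₂ ℤ._+_ (sym (∑<-pick n (r x) h (bound (here refl)))) (sum-by-rank xs r h n (bound ∘ there)) ⟩
  ∑< n (λ k → pos ((r x ≟ k) ▹ 1) ℤ.* h k) ℤ.+ ∑< n (λ k → pos (∑ xs (λ z → (r z ≟ k) ▹ 1)) ℤ.* h k)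
    ≡⟨ ∑<-+ n _ _ ⟨
  ∑< n (λ k → pos ((r x ≟ k) ▹ 1) ℤ.* h k ℤ.+ pos (∑ xs (λ z → (r z ≟ k) ▹ 1)) ℤ.* h k)
    ≡⟨ ∑<-cong n (λ k _ → collect ((r x ≟ k) ▹ 1) (∑ xs (λ z → (r z ≟ k) ▹ 1)) (h k)) ⟩
  ∑< n (λ k → pos (∑ (x ∷ xs) (λ z → (r z ≟ k) ▹ 1)) ℤ.* h k) ∎
  where
  open ≡-Reasoning
  collect : ∀ a b c → pos a ℤ.* c ℤ.+ pos b ℤ.* c ≡ pos (a + b) ℤ.* c
  collect a b c = trans (sym (ℤ.*-distribʳ-+ c (pos a) (pos b))) (cong (ℤ._* c) (sym (ℤ.pos-+ a b)))

length-by-rank : {A : Set} (xs : List A) (r : A → ℕ) (n : ℕ) → (∀ {z} → z ∈ xs → r z < n) →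
                 pos (length xs) ≡ ∑< n (λ k → pos (∑ xs (λ z → (r z ≟ k) ▹ 1)))
length-by-rank {A} xs r n bound = begin
  pos (length xs)                                                ≡⟨ ones xs ⟨
  foldr ℤ._+_ 0ℤ (map (λ _ → 1ℤ) xs)                             ≡⟨ sum-by-rank xs r (λ _ → 1ℤ) n bound ⟩
  ∑< n (λ k → pos (∑ xs (λ z → (r z ≟ k) ▹ 1)) ℤ.* 1ℤ)           ≡⟨ ∑<-cong n (λ k _ → ℤ.*-identityʳ _) ⟩
  ∑< n (λ k → pos (∑ xs (λ z → (r z ≟ k) ▹ 1)))                  ∎
  where
  open ≡-Reasoning
  ones : (ys : List A) → foldr ℤ._+_ 0ℤ (map (λ _ → 1ℤ) ys) ≡ pos (length ys)
  ones []       = refl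
  ones (y ∷ ys) = trans (cong (λ s → 1ℤ ℤ.+ s) (ones ys)) (sym (ℤ.pos-+ 1 (length ys)))

-- Factorial functions satisfying the Eulerian relations

double : ℕ → ℕ
double zero    = zero
double (suc m) = suc (suc (double m))

-- Index k belongs to rank k + 1, so `evens` collects the odd ranks and `odds` the even ones. The
-- Eulerian relation then needs no signs: `evens` exceeds `odds` by 1, the contribution of the
-- bottom.
evens odds : ℕ → (ℕ → ℕ) → ℕ
evens zero    g = 0
evens (suc m) g = evens m g + g (double m)
odds zero    g = 0
odds (suc m) g = odds m g + g (suc (double m))

-- d n stands for D (n + 1), c n for the number of coatoms of a Sheffer interval of rank n + 2,
-- and f n k for the number of elements of rank k + 1 in a Sheffer interval of rank n + 1.
record EulerSystem (d : ℕ → ℕ) : Set where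
  field
    d-nonZero : ∀ n → NonZero (d n)
    c         : ℕ → ℕ
    d-suc     : ∀ n → d (suc n) ≡ c n * d n
    f         : ℕ → ℕ → ℕ
    f-eq      : ∀ j k → f (j + k) k * (d k * j !) ≡ d (j + k)
    euler     : ∀ m → evens (suc m) (f (suc (double m))) ≡ suc (odds (suc m) (f (suc (double m))))

  private
    cancel : ∀ k {a b} → a * d k ≡ b * d k → a ≡ b
    cancel k {a} {b} = *-cancelʳ-≡ a b (d k) {{d-nonZero k}}

    d-2 : ∀ k → d (2 + k) ≡ c (1 + k) * c k * d k
    d-2 k = trans (d-suc (1 + k)) (trans (cong (c (1 + k) *_) (d-suc k)) (sym (*-assoc (c (1 + k)) (c k) (d k))))

    d-3 : ∀ k → d (3 + k) ≡ c (2 + k) * c (1 + k) * c k * d k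
    d-3 k = trans (d-2 (1 + k)) (trans (cong (c (2 + k) * c (1 + k) *_) (d-suc k)) (sym (*-assoc (c (2 + k) * c (1 + k)) (c k) (d k))))

    d-4 : ∀ k → d (4 + k) ≡ c (3 + k) * c (2 + k) * c (1 + k) * c k * d k
    d-4 k = trans (d-3 (1 + k)) (trans (cong (c (3 + k) * c (2 + k) * c (1 + k) *_) (d-suc k)) (sym (*-assoc (c (3 + k) * c (2 + k) * c (1 + k)) (c k) (d k))))

    d-5 : ∀ k → d (5 + k) ≡ c (4 + k) * c (3 + k) * c (2 + k) * c (1 + k) * c k * d k
    d-5 k = trans (d-4 (1 + k)) (trans (cong (c (4 + k) * c (3 + k) * c (2 + k) * c (1 + k) *_) (d-suc k)) (sym (*-assoc (c (4 + k) * c (3 + k) * c (2 + k) * c (1 + k)) (c k) (d k))))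

    f-! : ∀ j k {p} → d (j + k) ≡ p * d k → f (j + k) k * j ! ≡ p
    f-! j k {p} eq = cancel k (trans (reorder (f (j + k) k) (j !) (d k)) (trans (f-eq j k) eq))
      where
      reorder : ∀ x y z → x * y * z ≡ x * (z * y)
      reorder = ringℕ

    f-0 : ∀ k → f k k ≡ 1
    f-0 k = trans (sym (*-identityʳ _)) (f-! 0 k (sym (*-identityˡ (d k))))

    f-1 : ∀ k → f (1 + k) k ≡ c k
    f-1 k = trans (sym (*-identityʳ _)) (f-! 1 k (d-suc k))

  d-6 : ∀ k → d (6 + k) ≡ c (5 + k) * c (4 + k) * c (3 + k) * c (2 + k) * c (1 + k) * c k * d k
  d-6 k = trans (d-5 (1 + k)) (trans (cong (c (5 + k) * c (4 + k) * c (3 + k) * c (2 + k) * c (1 + k) *_) (d-suc k)) (sym (*-assoc (c (5 + k) * c (4 + k) * c (3 + k) * c (2 + k) * c (1 + k)) (c k) (d k))))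

  d₂ = d-2
  d₄ = d-4

  module _ (m : ℕ) where
    private
      N  = double m
      c₁ = c N
      c₂ = c (1 + N)
      c₃ = c (2 + N)
      c₄ = c (3 + N)
      c₅ = c (4 + N)

    -- Terms of index 2m or more become products of coatom numbers, since f (j + k) k times j! is a
    -- product of j of them; the rest is left for comparison with a model. Clearing denominators
    -- takes the factors 1!, 3! and 5! in `euler₁`, `euler₃` and `euler₅`; the visible factor 1
    -- gives the shape expected by `eliminate`.
    euler₁ : 1 * evens m (f (1 + N)) + c₁ ≡ 1 * odds m (f (1 + N)) + 2
    euler₁ = final (evens m (f (1 + N))) (odds m (f (1 + N))) (f-1 N) (f-0 (1 + N)) (euler m)
      where
      final : ∀ p q {x y} → x ≡ c₁ → y ≡ 1 → p + x ≡ suc (q + y) → 1 * p + c₁ ≡ 1 * q + 2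
      final p q refl refl eq = trans (l p c₁) (trans eq (r q))
        where
        l : ∀ p c → 1 * p + c ≡ p + c
        l = ringℕ
        r : ∀ q → suc (q + 1) ≡ 1 * q + 2
        r = ringℕ

    euler₃ : 6 * evens m (f (3 + N)) + (c₁ * c₂ * c₃ + 6 * c₃) ≡ 6 * odds m (f (3 + N)) + (3 * c₂ * c₃ + 12)
    euler₃ = final (evens m (f (3 + N))) (odds m (f (3 + N))) (f (3 + N) N) (f (3 + N) (1 + N)) (f-! 3 N (d-3 N)) (f-! 2 (1 + N) (d-2 (1 + N))) (f-1 (2 + N)) (f-0 (3 + N)) (euler (suc m))
      where
      l : ∀ p x y → 6 * p + (x * 6 + 6 * y) ≡ 6 * (p + x + y)
      l = ringℕ
      r : ∀ q x → 6 * suc (q + x + 1) ≡ 6 * q + (3 * (x * 2) + 12)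
      r = ringℕ
      final : ∀ p q x₀ x₁ {x₂ x₃} → x₀ * 6 ≡ c₃ * c₂ * c₁ → x₁ * 2 ≡ c₃ * c₂ → x₂ ≡ c₃ → x₃ ≡ 1 →
              p + x₀ + x₂ ≡ suc (q + x₁ + x₃) → 6 * p + (c₁ * c₂ * c₃ + 6 * c₃) ≡ 6 * q + (3 * c₂ * c₃ + 12)
      final p q x₀ x₁ e₀ e₁ refl refl eq = begin
        6 * p + (c₁ * c₂ * c₃ + 6 * c₃)  ≡⟨ cong (λ s → 6 * p + (s + 6 * c₃)) (trans (rev c₁ c₂ c₃) (sym e₀)) ⟩
        6 * p + (x₀ * 6 + 6 * c₃)        ≡⟨ l p x₀ c₃ ⟩
        6 * (p + x₀ + c₃)                ≡⟨ cong (6 *_) eq ⟩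
        6 * suc (q + x₁ + 1)             ≡⟨ r q x₁ ⟩
        6 * q + (3 * (x₁ * 2) + 12)      ≡⟨ cong (λ s → 6 * q + (s + 12)) (trans (cong (3 *_) e₁) (rev′ c₂ c₃)) ⟩
        6 * q + (3 * c₂ * c₃ + 12)       ∎
        where
        open ≡-Reasoning
        rev : ∀ a b c → a * b * c ≡ c * b * a
        rev = ringℕ
        rev′ : ∀ b c → 3 * (c * b) ≡ 3 * b * c
        rev′ = ringℕ

    euler₅ : 120 * evens m (f (5 + N)) + (c₁ * c₂ * c₃ * c₄ * c₅ + 20 * c₃ * c₄ * c₅ + 120 * c₅) ≡
             120 * odds m (f (5 + N)) + (5 * c₂ * c₃ * c₄ * c₅ + 60 * c₄ * c₅ + 240)
    euler₅ = final (evens m (f (5 + N))) (odds m (f (5 + N))) (f (5 + N) N) (f (5 + N) (1 + N)) (f (5 + N) (2 + N)) (f (5 + N) (3 + N)) (f-! 5 N (d-5 N)) (f-! 4 (1 + N) (d-4 (1 + N))) (f-! 3 (2 + N) (d-3 (2 + N)))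
                   (f-! 2 (3 + N) (d-2 (3 + N))) (f-1 (4 + N)) (f-0 (5 + N)) (euler (suc (suc m)))
      where
      l : ∀ p x y z → 120 * p + (x * 120 + 20 * (y * 6) + 120 * z) ≡ 120 * (p + x + y + z)
      l = ringℕ
      r : ∀ q x y → 120 * suc (q + x + y + 1) ≡ 120 * q + (5 * (x * 24) + 60 * (y * 2) + 240)
      r = ringℕ
      final : ∀ p q x₀ x₁ x₂ x₃ {x₄ x₅} → x₀ * 120 ≡ c₅ * c₄ * c₃ * c₂ * c₁ → x₁ * 24 ≡ c₅ * c₄ * c₃ * c₂ →
              x₂ * 6 ≡ c₅ * c₄ * c₃ → x₃ * 2 ≡ c₅ * c₄ → x₄ ≡ c₅ → x₅ ≡ 1 →
              p + x₀ + x₂ + x₄ ≡ suc (q + x₁ + x₃ + x₅) →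
              120 * p + (c₁ * c₂ * c₃ * c₄ * c₅ + 20 * c₃ * c₄ * c₅ + 120 * c₅) ≡
              120 * q + (5 * c₂ * c₃ * c₄ * c₅ + 60 * c₄ * c₅ + 240)
      final p q x₀ x₁ x₂ x₃ e₀ e₁ e₂ e₃ refl refl eq = begin
        120 * p + (c₁ * c₂ * c₃ * c₄ * c₅ + 20 * c₃ * c₄ * c₅ + 120 * c₅)
          ≡⟨ cong₂ (λ s t → 120 * p + (s + t + 120 * c₅)) (trans (r₅ c₁ c₂ c₃ c₄ c₅) (sym e₀)) (trans (r₃ 20 c₃ c₄ c₅) (cong (20 *_) (sym e₂))) ⟩
        120 * p + (x₀ * 120 + 20 * (x₂ * 6) + 120 * c₅)
          ≡⟨ l p x₀ x₂ c₅ ⟩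
        120 * (p + x₀ + x₂ + c₅)
          ≡⟨ cong (120 *_) eq ⟩
        120 * suc (q + x₁ + x₃ + 1)
          ≡⟨ r q x₁ x₃ ⟩
        120 * q + (5 * (x₁ * 24) + 60 * (x₃ * 2) + 240)
          ≡⟨ cong₂ (λ s t → 120 * q + (s + t + 240)) (trans (cong (5 *_) e₁) (sym (r₄ 5 c₂ c₃ c₄ c₅))) (trans (cong (60 *_) e₃) (sym (r₂ 60 c₄ c₅))) ⟩
        120 * q + (5 * c₂ * c₃ * c₄ * c₅ + 60 * c₄ * c₅ + 240) ∎
        where
        open ≡-Reasoning
        r₅ : ∀ a b c d e → a * b * c * d * e ≡ e * d * c * b * a
        r₅ = ringℕ
        r₄ : ∀ n b c d e → n * b * c * d * e ≡ n * (e * d * c * b)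
        r₄ = ringℕ
        r₃ : ∀ n c d e → n * c * d * e ≡ n * (e * d * c)
        r₃ = ringℕ
        r₂ : ∀ n d e → n * d * e ≡ n * (e * d)
        r₂ = ringℕ

module _ {d d′ : ℕ → ℕ} (S : EulerSystem d) (T : EulerSystem d′) where
  private
    module S = EulerSystem S
    module T = EulerSystem T

  -- f n k = d n / (d k · (n - k)!), so agreement at k makes the two face numbers proportional to d
  -- n and d′ n, with the same ratio for every such k.
  f-proportional : ∀ j k → d k ≡ d′ k → d′ (j + k) * S.f (j + k) k ≡ d (j + k) * T.f (j + k) k
  f-proportional j k eq = *-cancelʳ-≡ _ _ (d k * j !) {{m*n≢0 (d k) (j !) {{S.d-nonZero k}} {{j !≢0}}}} (begin
    d′ (j + k) * S.f (j + k) k * (d k * j !)    ≡⟨ *-assoc (d′ (j + k)) (S.f (j + k) k) (d k * j !) ⟩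
    d′ (j + k) * (S.f (j + k) k * (d k * j !))  ≡⟨ cong (d′ (j + k) *_) (S.f-eq j k) ⟩
    d′ (j + k) * d (j + k)                      ≡⟨ *-comm (d′ (j + k)) (d (j + k)) ⟩
    d (j + k) * d′ (j + k)                      ≡⟨ cong (d (j + k) *_) (T.f-eq j k) ⟨
    d (j + k) * (T.f (j + k) k * (d′ k * j !))  ≡⟨ cong (λ e → d (j + k) * (T.f (j + k) k * (e * j !))) eq ⟨
    d (j + k) * (T.f (j + k) k * (d k * j !))   ≡⟨ *-assoc (d (j + k)) (T.f (j + k) k) (d k * j !) ⟨
    d (j + k) * T.f (j + k) k * (d k * j !)     ∎)
    where open ≡-Reasoning

  f-proportional-≤ : ∀ {n k} → k ≤ n → d k ≡ d′ k → d′ n * S.f n k ≡ d n * T.f n k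
  f-proportional-≤ {n} {k} k≤n eq = subst (λ i → d′ i * S.f i k ≡ d i * T.f i k) (m∸n+n≡m k≤n) (f-proportional (n ∸ k) k eq)

  module _ {m : ℕ} (agree : ∀ k → k < double m → d k ≡ d′ k) {n : ℕ} (le : double m ≤ n) where

    private
      halves : ∀ i → double i ≤ double m → d′ n * evens i (S.f n) ≡ d n * evens i (T.f n) ×
                                           d′ n * odds i (S.f n) ≡ d n * odds i (T.f n)
      halves zero    _   = trans (*-zeroʳ (d′ n)) (sym (*-zeroʳ (d n))) , trans (*-zeroʳ (d′ n)) (sym (*-zeroʳ (d n)))
      halves (suc i) i<m with halves i (≤-trans (n≤1+n _) (≤-trans (n≤1+n _) i<m))
      ... | ev , od =
        add ev (f-proportional-≤ (≤-trans (n≤1+n _) (≤-trans (n≤1+n _) (≤-trans i<m le))) (agree (double i) (≤-trans (n≤1+n _) i<m))) ,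
        add od (f-proportional-≤ (≤-trans (n≤1+n _) (≤-trans i<m le)) (agree (suc (double i)) i<m))
        where
        add : ∀ {a b u v} → d′ n * a ≡ d n * b → d′ n * u ≡ d n * v → d′ n * (a + u) ≡ d n * (b + v)
        add {a} {b} {u} {v} p q = trans (*-distribˡ-+ (d′ n) a u) (trans (cong₂ _+_ p q) (sym (*-distribˡ-+ (d n) b v)))

    -- Multiply the relation of S by d′ n and that of T by d n. By proportionality the sums over the
    -- agreeing indices coincide and cancel, without having been computed.
    eliminate : ∀ a {p q p′ q′} → a * evens m (S.f n) + p ≡ a * odds m (S.f n) + q →
                a * evens m (T.f n) + p′ ≡ a * odds m (T.f n) + q′ →
                d′ n * p + d n * q′ ≡ d′ n * q + d n * p′
    eliminate a {p} {q} {p′} {q′} eqS eqT with halves m ≤-refl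
    ... | ev , od = +-cancelˡ-≡ K _ _ (begin
      K + (d′ n * p + d n * q′)
        ≡⟨ split-l a (d n) (evens m (T.f n)) (odds m (T.f n)) (d′ n * p) q′ ⟩
      a * (d n * evens m (T.f n)) + d′ n * p + d n * (a * odds m (T.f n) + q′)
        ≡⟨ cong₂ (λ s t → a * s + d′ n * p + d n * t) ev eqT ⟨
      a * (d′ n * evens m (S.f n)) + d′ n * p + d n * (a * evens m (T.f n) + p′)
        ≡⟨ cong (_+ d n * (a * evens m (T.f n) + p′)) (trans (factor a (d′ n) (evens m (S.f n)) p) (trans (cong (d′ n *_) eqS) (sym (factor a (d′ n) (odds m (S.f n)) q)))) ⟩
      a * (d′ n * odds m (S.f n)) + d′ n * q + d n * (a * evens m (T.f n) + p′)
        ≡⟨ cong (λ s → a * s + d′ n * q + d n * (a * evens m (T.f n) + p′)) od ⟩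
      a * (d n * odds m (T.f n)) + d′ n * q + d n * (a * evens m (T.f n) + p′)
        ≡⟨ split-r a (d n) (evens m (T.f n)) (odds m (T.f n)) (d′ n * q) p′ ⟩
      K + (d′ n * q + d n * p′) ∎)
      where
      open ≡-Reasoning
      K = a * (d n * evens m (T.f n)) + a * (d n * odds m (T.f n))
      split-l : ∀ a d e o u q → a * (d * e) + a * (d * o) + (u + d * q) ≡ a * (d * e) + u + d * (a * o + q)
      split-l = ringℕ
      split-r : ∀ a d e o u q → a * (d * o) + u + d * (a * e + q) ≡ a * (d * e) + a * (d * o) + (u + d * q)
      split-r = ringℕ
      factor : ∀ a d e p → a * (d * e) + d * p ≡ d * (a * e + p)
      factor = ringℕ

  -- The systems agree below 2m + 2; c₀, c₁, … and s₀, s₁, … are the coatom numbers from the first possible deviation on.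
  module Deviation (m : ℕ) (agree : ∀ k → k < double (suc m) → d k ≡ d′ k) where
    private
      N = suc (double m)
      e = d N
      instance _ = S.d-nonZero N

      -- Beyond N both d and d′ are products of coatom numbers with the common value `e` at N, so
      -- `e` divides out.
      cancel-e : ∀ {x y} p q p′ q′ → x * e * p + y * e * q ≡ x * e * p′ + y * e * q′ → x * p + y * q ≡ x * p′ + y * q′
      cancel-e {x} {y} p q p′ q′ eq = *-cancelʳ-≡ _ _ e (trans (sym (pull x y e p q)) (trans eq (pull x y e p′ q′)))
        where
        pull : ∀ x y e p q → x * e * p + y * e * q ≡ (x * p + y * q) * e
        pull = ringℕ

      rename-d : ∀ {n x y p q p′ q′} → d n ≡ y * e → d′ n ≡ x * d′ N →
                 d′ n * p + d n * q ≡ d′ n * p′ + d n * q′ → x * p + y * q ≡ x * p′ + y * q′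
      rename-d {n} {x} {y} {p} {q} {p′} {q′} eqS eqT eq = cancel-e {x} {y} p q p′ q′
        (subst₂ (λ s t → s * p + t * q ≡ s * p′ + t * q′) (trans eqT (cong (x *_) (sym (agree N ≤-refl)))) eqS eq)

    c₀ = S.c N
    c₁ = S.c (1 + N)
    c₂ = S.c (2 + N)
    c₃ = S.c (3 + N)
    c₄ = S.c (4 + N)
    c₅ = S.c (5 + N)
    s₀ = T.c N
    s₁ = T.c (1 + N)
    s₂ = T.c (2 + N)
    s₃ = T.c (3 + N)
    s₄ = T.c (4 + N)
    s₅ = T.c (5 + N)

    -- In fractions: (c₁ - 2) / (c₀ c₁) = (s₁ - 2) / (s₀ s₁). One equation for two unknowns, hence
    -- the need for the later relations.
    deviation₁ : s₁ * s₀ * c₁ + c₁ * c₀ * 2 ≡ s₁ * s₀ * 2 + c₁ * c₀ * s₁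
    deviation₁ = rename-d {x = s₁ * s₀} {y = c₁ * c₀} {p = c₁} {q = 2} {p′ = 2} {q′ = s₁} (S.d₂ N) (T.d₂ N)
      (eliminate {suc m} agree (n≤1+n _) 1 {p = c₁} {q = 2} (S.euler₁ (suc m)) (T.euler₁ (suc m)))

    deviation₃ : s₃ * s₂ * s₁ * s₀ * (c₁ * c₂ * c₃ + 6 * c₃) + c₃ * c₂ * c₁ * c₀ * (3 * s₂ * s₃ + 12) ≡
                 s₃ * s₂ * s₁ * s₀ * (3 * c₂ * c₃ + 12) + c₃ * c₂ * c₁ * c₀ * (s₁ * s₂ * s₃ + 6 * s₃)
    deviation₃ = rename-d {x = s₃ * s₂ * s₁ * s₀} {y = c₃ * c₂ * c₁ * c₀} {p = c₁ * c₂ * c₃ + 6 * c₃} {q = 3 * s₂ * s₃ + 12} {p′ = 3 * c₂ * c₃ + 12} {q′ = s₁ * s₂ * s₃ + 6 * s₃} (S.d₄ N) (T.d₄ N)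
      (eliminate {suc m} agree (m≤n+m _ 3) 6 {p = c₁ * c₂ * c₃ + 6 * c₃} {q = 3 * c₂ * c₃ + 12} (S.euler₃ (suc m)) (T.euler₃ (suc m)))

    deviation₅ : s₅ * s₄ * s₃ * s₂ * s₁ * s₀ * (c₁ * c₂ * c₃ * c₄ * c₅ + 20 * c₃ * c₄ * c₅ + 120 * c₅) +
                 c₅ * c₄ * c₃ * c₂ * c₁ * c₀ * (5 * s₂ * s₃ * s₄ * s₅ + 60 * s₄ * s₅ + 240) ≡
                 s₅ * s₄ * s₃ * s₂ * s₁ * s₀ * (5 * c₂ * c₃ * c₄ * c₅ + 60 * c₄ * c₅ + 240) +
                 c₅ * c₄ * c₃ * c₂ * c₁ * c₀ * (s₁ * s₂ * s₃ * s₄ * s₅ + 20 * s₃ * s₄ * s₅ + 120 * s₅)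
    deviation₅ = rename-d {x = s₅ * s₄ * s₃ * s₂ * s₁ * s₀} {y = c₅ * c₄ * c₃ * c₂ * c₁ * c₀} {p = c₁ * c₂ * c₃ * c₄ * c₅ + 20 * c₃ * c₄ * c₅ + 120 * c₅} {q = 5 * s₂ * s₃ * s₄ * s₅ + 60 * s₄ * s₅ + 240}
                          {p′ = 5 * c₂ * c₃ * c₄ * c₅ + 60 * c₄ * c₅ + 240} {q′ = s₁ * s₂ * s₃ * s₄ * s₅ + 20 * s₃ * s₄ * s₅ + 120 * s₅}
                          (S.d-6 N) (T.d-6 N)
      (eliminate {suc m} agree (m≤n+m _ 5) 120 {p = c₁ * c₂ * c₃ * c₄ * c₅ + 20 * c₃ * c₄ * c₅ + 120 * c₅}
                 {q = 5 * c₂ * c₃ * c₄ * c₅ + 60 * c₄ * c₅ + 240} (S.euler₅ (suc m)) (T.euler₅ (suc m)))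

sum-choose : ∀ n → binomialSum n (λ k → -1ℤ ℤ.^ k) ≡ (-1ℤ ℤ.+ 1ℤ) ℤ.^ n
sum-choose n = trans
  (binomialSum-cong n (λ k _ → sym (trans (cong (-1ℤ ℤ.^ k ℤ.*_) (ℤ.^-zeroˡ (n ∸ k))) (ℤ.*-identityʳ _))))
  (binomialTheorem -1ℤ 1ℤ n)

alternating-split : ∀ m (g : ℕ → ℕ) → ∑< (double m) (λ k → pos (g k) ℤ.* -1ℤ ℤ.^ k) ℤ.+ pos (odds m g) ≡ pos (evens m g)
alternating-split zero    g = refl
alternating-split (suc m) g = begin
  A ℤ.+ a ℤ.* s ℤ.+ b ℤ.* (-1ℤ ℤ.* s) ℤ.+ pos (odds m g + g (suc (double m)))
    ≡⟨ cong₂ (λ t o → A ℤ.+ a ℤ.* t ℤ.+ b ℤ.* (-1ℤ ℤ.* t) ℤ.+ o) (even-sign m) (ℤ.pos-+ (odds m g) _) ⟩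
  A ℤ.+ a ℤ.* 1ℤ ℤ.+ b ℤ.* (-1ℤ ℤ.* 1ℤ) ℤ.+ (pos (odds m g) ℤ.+ b)
    ≡⟨ regroup A a b (pos (odds m g)) ⟩
  (A ℤ.+ pos (odds m g)) ℤ.+ a
    ≡⟨ cong (ℤ._+ a) (alternating-split m g) ⟩
  pos (evens m g) ℤ.+ a
    ≡⟨ ℤ.pos-+ (evens m g) _ ⟨
  pos (evens m g + g (double m)) ∎
  where
  open ≡-Reasoning
  A = ∑< (double m) (λ k → pos (g k) ℤ.* -1ℤ ℤ.^ k)
  a = pos (g (double m))
  b = pos (g (suc (double m)))
  s = -1ℤ ℤ.^ double m
  even-sign : ∀ m → -1ℤ ℤ.^ double m ≡ 1ℤ
  even-sign zero    = refl
  even-sign (suc m) = cong (λ s → -1ℤ ℤ.* (-1ℤ ℤ.* s)) (even-sign m)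
  regroup : ∀ A a b o → A ℤ.+ a ℤ.* 1ℤ ℤ.+ b ℤ.* (-1ℤ ℤ.* 1ℤ) ℤ.+ (o ℤ.+ b) ≡ (A ℤ.+ o) ℤ.+ a
  regroup = ringℤ

alternating⇒euler : ∀ m g → ∑< (double m) (λ k → pos (g k) ℤ.* -1ℤ ℤ.^ k) ≡ 1ℤ → evens m g ≡ suc (odds m g)
alternating⇒euler m g eq = ℤ.+-injective (trans (sym (alternating-split m g))
  (trans (cong (ℤ._+ pos (odds m g)) eq) (sym (ℤ.pos-+ 1 (odds m g)))))

-- The three model sequences

d-suspension d-boolean d-cubical : ℕ → ℕ
d-suspension zero    = 1
d-suspension (suc n) = 2 * suc n !
d-boolean n = suc n !
d-cubical n = 2 ^ n * n !

-- The face numbers count the subsets of size k + 1 of an (n + 1)-set, and the Eulerian relation is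
-- the expansion of (-1 + 1)^(n + 1).
booleanSystem : EulerSystem d-boolean
booleanSystem = record
  { d-nonZero = λ n → suc n !≢0
  ; c     = λ n → 2 + n
  ; d-suc = λ n → refl
  ; f     = λ n k → suc n C suc k
  ; f-eq  = λ j k → trans (cong (λ n → (suc n C suc k) * (suc k ! * j !)) (+-comm j k))
                          (trans (C-! (suc k) j) (cong (λ n → suc n !) (+-comm k j)))
  ; euler = λ m → alternating⇒euler (suc m) _ (alternating (suc (double m)))
  }
  where
  alternating : ∀ n → ∑< (suc n) (λ k → pos (suc n C suc k) ℤ.* -1ℤ ℤ.^ k) ≡ 1ℤ
  alternating n = move (begin
    1ℤ ℤ.+ -1ℤ ℤ.* ∑< (suc n) (λ k → pos (suc n C suc k) ℤ.* -1ℤ ℤ.^ k)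
      ≡⟨ cong (λ s → 1ℤ ℤ.+ s) (trans (sym (∑<-*ˡ (suc n) -1ℤ _)) (∑<-cong (suc n) (λ k _ → swap (pos (suc n C suc k)) (-1ℤ ℤ.^ k)))) ⟩
    1ℤ ℤ.+ ∑< (suc n) (λ k → pos (suc n C suc k) ℤ.* -1ℤ ℤ.^ suc k)
      ≡⟨ ∑<-split (suc n) (λ k → pos (suc n C k) ℤ.* -1ℤ ℤ.^ k) ⟨
    binomialSum (suc n) (λ k → -1ℤ ℤ.^ k)
      ≡⟨ sum-choose (suc n) ⟩
    0ℤ ∎)
    where
    open ≡-Reasoning
    swap : ∀ a b → -1ℤ ℤ.* (a ℤ.* b) ≡ a ℤ.* (-1ℤ ℤ.* b)
    swap = ringℤ
    move : ∀ {x} → 1ℤ ℤ.+ -1ℤ ℤ.* x ≡ 0ℤ → x ≡ 1ℤ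
    move {x} eq = trans (aux x) (trans (cong (λ s → 1ℤ ℤ.+ -1ℤ ℤ.* s) eq) refl)
      where
      aux : ∀ x → x ≡ 1ℤ ℤ.+ -1ℤ ℤ.* (1ℤ ℤ.+ -1ℤ ℤ.* x)
      aux = ringℤ

-- A k-face of the n-cube has k free coordinates and n - k fixed ones, each with two values. The
-- Eulerian relation is the expansion of (-1 + 2)^n.
cubicalSystem : EulerSystem d-cubical
cubicalSystem = record
  { d-nonZero = λ n → m*n≢0 (2 ^ n) (n !) {{m^n≢0 2 n}} {{n !≢0}}
  ; c     = λ n → 2 * suc n
  ; d-suc = λ n → reorder 2 (2 ^ n) (suc n) (n !)
  ; f     = λ n k → (n C k) * 2 ^ (n ∸ k)
  ; f-eq  = f-eq
  ; euler = λ m → alternating⇒euler (suc m) _ (alternating (suc (double m)))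
  }
  where
  reorder : ∀ a b c d → a * b * (c * d) ≡ a * c * (b * d)
  reorder = ringℕ
  f-eq : ∀ j k → ((j + k) C k) * 2 ^ (j + k ∸ k) * (2 ^ k * k ! * j !) ≡ 2 ^ (j + k) * (j + k) !
  f-eq j k = begin
    ((j + k) C k) * 2 ^ (j + k ∸ k) * (2 ^ k * k ! * j !)  ≡⟨ cong (λ i → ((j + k) C k) * 2 ^ i * (2 ^ k * k ! * j !)) (m+n∸n≡m j k) ⟩
    ((j + k) C k) * 2 ^ j * (2 ^ k * k ! * j !)            ≡⟨ pull ((j + k) C k) (2 ^ j) (2 ^ k) (k !) (j !) ⟩
    2 ^ j * 2 ^ k * (((j + k) C k) * (k ! * j !))          ≡⟨ cong₂ _*_ (sym (^-distribˡ-+-* 2 j k)) (subst (λ n → (n C k) * (k ! * j !) ≡ n !) (+-comm k j) (C-! k j)) ⟩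
    2 ^ (j + k) * (j + k) !                                ∎
    where
    open ≡-Reasoning
    pull : ∀ c a b x y → c * a * (b * x * y) ≡ a * b * (c * (x * y))
    pull = ringℕ
  alternating : ∀ n → ∑< (suc n) (λ k → pos ((n C k) * 2 ^ (n ∸ k)) ℤ.* -1ℤ ℤ.^ k) ≡ 1ℤ
  alternating n = trans
    (∑<-cong (suc n) (λ k _ → trans (cong (ℤ._* -1ℤ ℤ.^ k) (trans (ℤ.pos-* (n C k) (2 ^ (n ∸ k))) (cong (pos (n C k) ℤ.*_) (pos-^ 2 (n ∸ k)))))
                                    (swap (pos (n C k)) (pos 2 ℤ.^ (n ∸ k)) (-1ℤ ℤ.^ k))))
    (trans (binomialTheorem -1ℤ (pos 2) n) (ℤ.^-zeroˡ n))
    where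
    swap : ∀ a b c → a ℤ.* b ℤ.* c ≡ a ℤ.* (c ℤ.* b)
    swap = ringℤ

-- Above the atoms, ranks in the dual suspension of the Boolean algebra on n points are shifted by
-- one, so index k counts the subsets of size k; index 0 has the two new atoms in place of the
-- single empty set. The alternating sum therefore rises from 0 to 1.
suspensionSystem : EulerSystem d-suspension
suspensionSystem = record
  { d-nonZero = λ { zero → _ ; (suc n) → m*n≢0 2 (suc n !) {{_}} {{suc n !≢0}} }
  ; c     = λ { zero → 2 ; (suc n) → 2 + n }
  ; d-suc = λ { zero → refl ; (suc n) → swap 2 (2 + n) (suc n !) }
  ; f     = f
  ; f-eq  = f-eq
  ; euler = λ m → alternating⇒euler (suc m) _ (alternating (double m))
  }
  where
  swap : ∀ a b c → a * (b * c) ≡ b * (a * c)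
  swap = ringℕ
  f : ℕ → ℕ → ℕ
  f zero    zero    = 1
  f (suc n) zero    = 2
  f n       (suc k) = n C suc k
  f-sucʳ : ∀ n k → f n (suc k) ≡ n C suc k
  f-sucʳ zero    k = refl
  f-sucʳ (suc n) k = refl
  f-eq : ∀ j k → f (j + k) k * (d-suspension k * j !) ≡ d-suspension (j + k)
  f-eq zero    zero    = refl
  f-eq (suc j) zero    = subst (λ n → f (suc n) 0 * (1 * suc j !) ≡ 2 * suc n !) (sym (+-identityʳ j)) (cong (2 *_) (*-identityˡ (suc j !)))
  f-eq j       (suc k) = begin
    f (j + suc k) (suc k) * (2 * suc k ! * j !)    ≡⟨ cong (_* (2 * suc k ! * j !)) (f-sucʳ (j + suc k) k) ⟩
    ((j + suc k) C suc k) * (2 * suc k ! * j !)    ≡⟨ pull ((j + suc k) C suc k) 2 (suc k !) (j !) ⟩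
    2 * (((j + suc k) C suc k) * (suc k ! * j !))  ≡⟨ cong (2 *_) (subst (λ n → (n C suc k) * (suc k ! * j !) ≡ n !) (+-comm (suc k) j) (C-! (suc k) j)) ⟩
    2 * (j + suc k) !                              ≡⟨ cong (λ n → 2 * n !) (+-suc j k) ⟩
    2 * suc (j + k) !                              ≡⟨ cong d-suspension (+-suc j k) ⟨
    d-suspension (j + suc k)                       ∎
    where
    open ≡-Reasoning
    pull : ∀ c a x y → c * (a * x * y) ≡ a * (c * (x * y))
    pull = ringℕ
  alternating : ∀ n → ∑< (suc (suc n)) (λ k → pos (f (suc n) k) ℤ.* -1ℤ ℤ.^ k) ≡ 1ℤ
  alternating n = trans (∑<-split (suc n) _) (trans (cong (λ s → pos 2 ℤ.+ s) (back (∑< (suc n) (λ k → pos (suc n C suc k) ℤ.* -1ℤ ℤ.^ suc k)) (begin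
    pos 1 ℤ.+ ∑< (suc n) (λ k → pos (suc n C suc k) ℤ.* -1ℤ ℤ.^ suc k)  ≡⟨ ∑<-split (suc n) (λ k → pos (suc n C k) ℤ.* -1ℤ ℤ.^ k) ⟨
    binomialSum (suc n) (λ k → -1ℤ ℤ.^ k)                               ≡⟨ sum-choose (suc n) ⟩
    0ℤ                                                                  ∎))) refl)
    where
    open ≡-Reasoning
    back : ∀ x → pos 1 ℤ.+ x ≡ 0ℤ → x ≡ -1ℤ
    back x eq = trans (aux x) (cong (λ s → -1ℤ ℤ.+ s) eq)
      where
      aux : ∀ x → x ≡ -1ℤ ℤ.+ (pos 1 ℤ.+ x)
      aux = ringℤ

-- Reduction of the deviation relations

absurd-≡ : ∀ {x y} s → x ≡ y → x ≡ y + suc s → ⊥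
absurd-≡ {x} {y} s eq eq′ = m≢1+m+n y (trans (sym eq) (trans eq′ (+-suc y s)))

absurd-≤ : ∀ {x y} s → x ≤ y → x ≡ y + suc s → ⊥
absurd-≤ {x} {y} s le eq = m+1+n≰m y (subst (_≤ y) eq le)

-- Estimates are proved by certificates: each bound n ≥ m is substituted as n = i + m, after which a
-- ring identity shows one side to exceed the other by a polynomial with natural coefficients and a
-- positive constant term. These are the identities called `slack`.
≤⇒offset : ∀ {m n} → m ≤ n → ∃ λ i → n ≡ i + m
≤⇒offset {m} {n} m≤n = n ∸ m , sym (m∸n+n≡m m≤n)

-- The relations of the module Deviation; below, e stands for 2m − 2 and is even in all applications.
Deviation₁ : (s₀ s₁ c₀ c₁ : ℕ) → Set
Deviation₁ s₀ s₁ c₀ c₁ = s₁ * s₀ * c₁ + c₁ * c₀ * 2 ≡ s₁ * s₀ * 2 + c₁ * c₀ * s₁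

Deviation₃ : (s₀ s₁ s₂ s₃ c₀ c₁ c₂ c₃ : ℕ) → Set
Deviation₃ s₀ s₁ s₂ s₃ c₀ c₁ c₂ c₃ =
  s₃ * s₂ * s₁ * s₀ * (c₁ * c₂ * c₃ + 6 * c₃) + c₃ * c₂ * c₁ * c₀ * (3 * s₂ * s₃ + 12) ≡
  s₃ * s₂ * s₁ * s₀ * (3 * c₂ * c₃ + 12) + c₃ * c₂ * c₁ * c₀ * (s₁ * s₂ * s₃ + 6 * s₃)

Deviation₅ : (s₀ s₁ s₂ s₃ s₄ s₅ c₀ c₁ c₂ c₃ c₄ c₅ : ℕ) → Set
Deviation₅ s₀ s₁ s₂ s₃ s₄ s₅ c₀ c₁ c₂ c₃ c₄ c₅ =
  s₅ * s₄ * s₃ * s₂ * s₁ * s₀ * (c₁ * c₂ * c₃ * c₄ * c₅ + 20 * c₃ * c₄ * c₅ + 120 * c₅) +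
  c₅ * c₄ * c₃ * c₂ * c₁ * c₀ * (5 * s₂ * s₃ * s₄ * s₅ + 60 * s₄ * s₅ + 240) ≡
  s₅ * s₄ * s₃ * s₂ * s₁ * s₀ * (5 * c₂ * c₃ * c₄ * c₅ + 60 * c₄ * c₅ + 240) +
  c₅ * c₄ * c₃ * c₂ * c₁ * c₀ * (s₁ * s₂ * s₃ * s₄ * s₅ + 20 * s₃ * s₄ * s₅ + 120 * s₅)

-- In this form t c₀ c₁ = s₀ s₁ (c₁ - 2), so c₀ < s₀ s₁ / t, and a lower bound on c₁ gives one on
-- c₀. The `window` lemmas are these two bounds.
reduce₁ : ∀ t s₀ c₀ c₁ → Deviation₁ s₀ (2 + t) c₀ c₁ → t * c₁ * c₀ + 2 * ((2 + t) * s₀) ≡ (2 + t) * s₀ * c₁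
reduce₁ t s₀ c₀ c₁ eq = +-cancelˡ-≡ (c₁ * c₀ * 2) _ _ (trans (l t s₀ c₀ c₁) (trans (sym eq) (r t s₀ c₀ c₁)))
  where
  l : ∀ t s₀ c₀ c₁ → c₁ * c₀ * 2 + (t * c₁ * c₀ + 2 * ((2 + t) * s₀)) ≡ (2 + t) * s₀ * 2 + c₁ * c₀ * (2 + t)
  l = ringℕ
  r : ∀ t s₀ c₀ c₁ → (2 + t) * s₀ * c₁ + c₁ * c₀ * 2 ≡ c₁ * c₀ * 2 + (2 + t) * s₀ * c₁
  r = ringℕ

no-deviation₁ : ∀ t s₀ c₁ .{{_ : NonZero s₀}} → t * c₁ * s₀ + 2 * ((2 + t) * s₀) ≡ (2 + t) * s₀ * c₁ → c₁ ≡ 2 + t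
no-deviation₁ t s₀ c₁ eq = sym (*-cancelˡ-≡ (2 + t) c₁ 2 (*-cancelʳ-≡ (2 * (2 + t)) (2 * c₁) s₀
  (+-cancelˡ-≡ (t * c₁ * s₀) _ _ (trans (l t s₀ c₁) (trans eq (r t s₀ c₁))))))
  where
  l : ∀ t s₀ c₁ → t * c₁ * s₀ + 2 * (2 + t) * s₀ ≡ t * c₁ * s₀ + 2 * ((2 + t) * s₀)
  l = ringℕ
  r : ∀ t s₀ c₁ → (2 + t) * s₀ * c₁ ≡ t * c₁ * s₀ + 2 * c₁ * s₀
  r = ringℕ

-- P is s₀ s₁ s₂ s₃ and E is s₁ s₂ s₃ − 3 s₂ s₃ + 6 s₃ − 12, moved around so that no subtraction occurs.
Reduced₃ : (P E c₀ c₁ c₂ c₃ : ℕ) → Set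
Reduced₃ P E c₀ c₁ c₂ c₃ = 12 * P + c₂ * c₃ * (c₁ * c₀ * E + 3 * P) ≡ 6 * P * c₃ + c₂ * c₃ * (c₁ * P)

reduce₃ : ∀ s₀ s₁ s₂ s₃ c₀ c₁ c₂ c₃ E → E + (3 * s₂ * s₃ + 12) ≡ s₁ * s₂ * s₃ + 6 * s₃ →
          Deviation₃ s₀ s₁ s₂ s₃ c₀ c₁ c₂ c₃ → Reduced₃ (s₃ * s₂ * s₁ * s₀) E c₀ c₁ c₂ c₃
reduce₃ s₀ s₁ s₂ s₃ c₀ c₁ c₂ c₃ E E-eq eq = sym (+-cancelʳ-≡ (W * B) _ _
  (trans (l P B c₀ c₁ c₂ c₃) (trans eq (trans (cong (λ s → P * (3 * c₂ * c₃ + 12) + W * s) (sym E-eq)) (r P B E c₀ c₁ c₂ c₃)))))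
  where
  P = s₃ * s₂ * s₁ * s₀
  W = c₃ * c₂ * c₁ * c₀
  B = 3 * s₂ * s₃ + 12
  l : ∀ P B c₀ c₁ c₂ c₃ → 6 * P * c₃ + c₂ * c₃ * (c₁ * P) + c₃ * c₂ * c₁ * c₀ * B ≡
                          P * (c₁ * c₂ * c₃ + 6 * c₃) + c₃ * c₂ * c₁ * c₀ * B
  l = ringℕ
  r : ∀ P B E c₀ c₁ c₂ c₃ → P * (3 * c₂ * c₃ + 12) + c₃ * c₂ * c₁ * c₀ * (E + B) ≡
                            12 * P + c₂ * c₃ * (c₁ * c₀ * E + 3 * P) + c₃ * c₂ * c₁ * c₀ * B
  r = ringℕ

-- `U` and `V` stand for c₀ c₁ E + 3P and c₁ P, and `y` for c₂ c₃. If V ≥ U, the relation leaves 12P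
-- ≥ 6P c₃, which c₃ ≥ 3 forbids.
collapse : ∀ P .{{_ : NonZero P}} {U V} y c₃ s → 3 ≤ c₃ → V ≡ U + s → 12 * P + y * U ≡ 6 * P * c₃ + y * V → ⊥
collapse (suc p) {U} y c₃ s 3≤c₃ refl eq with ≤⇒offset 3≤c₃
... | l , refl = absurd-≡ _ (sym eq) (slack p U y l s)
  where
  slack : ∀ p U y l s → 6 * suc p * (l + 3) + y * (U + s) ≡ 12 * suc p + y * U + suc (5 + 6 * p + 6 * suc p * l + y * s)
  slack = ringℕ

-- The opposite sign to `collapse`: the difference R = U - V stays on the left as a coefficient of
-- c₂ c₃.
positive-part : ∀ P {U V R} y c₃ → U ≡ R + V → 12 * P + y * U ≡ 6 * P * c₃ + y * V → 12 * P + y * R ≡ 6 * P * c₃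
positive-part P {V = V} {R} y c₃ refl eq = +-cancelʳ-≡ (y * V) _ _ (trans (l P y V R) eq)
  where
  l : ∀ P y V R → 12 * P + y * R + y * V ≡ 12 * P + y * (R + V)
  l = ringℕ

-- The relation makes c₂ R smaller than 6P, so it fails once the lower bound t on c₂ satisfies t R ≥
-- 6P.
explode : ∀ P .{{_ : NonZero P}} {R} t s c₂ c₃ → t ≤ c₂ → t * R ≡ 6 * P + s → 12 * P + c₂ * c₃ * R ≡ 6 * P * c₃ → ⊥
explode (suc p) {R} t s c₂ c₃ t≤c₂ tR eq with ≤⇒offset t≤c₂
... | i , refl = absurd-≡ (11 + 12 * p + c₃ * s + i * c₃ * R) eq (begin
  12 * suc p + (i + t) * c₃ * R                           ≡⟨ l p i t c₃ R ⟩
  12 * suc p + i * c₃ * R + c₃ * (t * R)                  ≡⟨ cong (λ x → 12 * suc p + i * c₃ * R + c₃ * x) tR ⟩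
  12 * suc p + i * c₃ * R + c₃ * (6 * suc p + s)          ≡⟨ r p i c₃ R s ⟩
  6 * suc p * c₃ + suc (11 + 12 * p + c₃ * s + i * c₃ * R) ∎)
  where
  open ≡-Reasoning
  l : ∀ p i t c₃ R → 12 * suc p + (i + t) * c₃ * R ≡ 12 * suc p + i * c₃ * R + c₃ * (t * R)
  l = ringℕ
  r : ∀ p i c₃ R s → 12 * suc p + i * c₃ * R + c₃ * (6 * suc p + s) ≡ 6 * suc p * c₃ + suc (11 + 12 * p + c₃ * s + i * c₃ * R)
  r = ringℕ

-- At the upper end of the Boolean and suspension windows c₀ equals s₂, and `Deviation₁` then forces
-- c₁ = s₀ s₁. Division by s₀ s₁ s₂ reduces V ≥ U to the hypothesis with margin `δ`.
collapse-product : ∀ s₀ s₁ s₂ s₃ c₂ c₃ E δ .{{_ : NonZero (s₃ * s₂ * s₁ * s₀)}} →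
                   E + (3 * s₂ * s₃ + 12) ≡ s₁ * s₂ * s₃ + 6 * s₃ → s₃ * s₁ * s₀ ≡ E + 3 * s₃ + δ →
                   3 ≤ c₃ → Deviation₃ s₀ s₁ s₂ s₃ s₂ (s₁ * s₀) c₂ c₃ → ⊥
collapse-product s₀ s₁ s₂ s₃ c₂ c₃ E δ E-eq core 3≤c₃ dev =
  collapse (s₃ * s₂ * s₁ * s₀) (c₂ * c₃) c₃ (s₂ * s₁ * s₀ * δ) 3≤c₃
    (trans (l s₀ s₁ s₂ s₃) (trans (cong (s₂ * s₁ * s₀ *_) core) (r s₀ s₁ s₂ s₃ E δ)))
    (reduce₃ s₀ s₁ s₂ s₃ s₂ (s₁ * s₀) c₂ c₃ E E-eq dev)
  where
  l : ∀ s₀ s₁ s₂ s₃ → s₁ * s₀ * (s₃ * s₂ * s₁ * s₀) ≡ s₂ * s₁ * s₀ * (s₃ * s₁ * s₀)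
  l = ringℕ
  r : ∀ s₀ s₁ s₂ s₃ E δ → s₂ * s₁ * s₀ * (E + 3 * s₃ + δ) ≡ s₁ * s₀ * s₂ * E + 3 * (s₃ * s₂ * s₁ * s₀) + s₂ * s₁ * s₀ * δ
  r = ringℕ

-- For the middle of the Boolean window, where c₀ = s₁ and c₁ = 2 s₀. Here s₀ s₁ divides out of V ≥
-- U.
collapse-double : ∀ s₀ s₁ s₂ s₃ c₂ c₃ E δ .{{_ : NonZero (s₃ * s₂ * s₁ * s₀)}} →
                  E + (3 * s₂ * s₃ + 12) ≡ s₁ * s₂ * s₃ + 6 * s₃ → 2 * (s₃ * s₂ * s₀) ≡ 2 * E + 3 * (s₃ * s₂) + δ →
                  3 ≤ c₃ → Deviation₃ s₀ s₁ s₂ s₃ s₁ (2 * s₀) c₂ c₃ → ⊥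
collapse-double s₀ s₁ s₂ s₃ c₂ c₃ E δ E-eq core 3≤c₃ dev =
  collapse (s₃ * s₂ * s₁ * s₀) (c₂ * c₃) c₃ (s₁ * s₀ * δ) 3≤c₃
    (trans (l s₀ s₁ s₂ s₃) (trans (cong (s₁ * s₀ *_) core) (r s₀ s₁ s₂ s₃ E δ)))
    (reduce₃ s₀ s₁ s₂ s₃ s₁ (2 * s₀) c₂ c₃ E E-eq dev)
  where
  l : ∀ s₀ s₁ s₂ s₃ → 2 * s₀ * (s₃ * s₂ * s₁ * s₀) ≡ s₁ * s₀ * (2 * (s₃ * s₂ * s₀))
  l = ringℕ
  r : ∀ s₀ s₁ s₂ s₃ E δ → s₁ * s₀ * (2 * E + 3 * (s₃ * s₂) + δ) ≡ 2 * s₀ * s₁ * E + 3 * (s₃ * s₂ * s₁ * s₀) + s₁ * s₀ * δ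
  r = ringℕ

-- Removes a common numerical factor, so that the small Diophantine equations can be solved by
-- inspection.
divide₃ : ∀ g .{{_ : NonZero g}} x y z P R c₂ c₃ → 12 * P ≡ g * x → R ≡ g * y → 6 * P ≡ g * z →
          12 * P + c₂ * c₃ * R ≡ 6 * P * c₃ → x + c₂ * c₃ * y ≡ z * c₃
divide₃ g x y z P R c₂ c₃ ex ey ez eq = *-cancelˡ-≡ _ _ g (begin
  g * (x + c₂ * c₃ * y)      ≡⟨ l g x y c₂ c₃ ⟩
  g * x + c₂ * c₃ * (g * y)  ≡⟨ cong₂ (λ s t → s + c₂ * c₃ * t) ex ey ⟨
  12 * P + c₂ * c₃ * R       ≡⟨ eq ⟩
  6 * P * c₃                 ≡⟨ cong (_* c₃) ez ⟩
  g * z * c₃                 ≡⟨ *-assoc g z c₃ ⟩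
  g * (z * c₃)               ∎)
  where
  open ≡-Reasoning
  l : ∀ g x y c₂ c₃ → g * (x + c₂ * c₃ * y) ≡ g * x + c₂ * c₃ * (g * y)
  l = ringℕ

-- Eliminating the monomial c₂ c₃ c₄ c₅ between the relations in ranks 2m + 4 and 2m + 6.
reduce₅ : ∀ a b β R s₀ s₁ s₂ s₃ s₄ s₅ c₀ c₁ c₂ c₃ c₄ c₅ →
          .{{_ : NonZero (s₅ * s₄ * s₃ * s₂ * s₁ * s₀)}} →
          let Π = s₅ * s₄ * s₃ * s₂ * s₁ * s₀
              P = s₃ * s₂ * s₁ * s₀ in
          a * (5 * Π + c₁ * c₀ * (s₁ * s₂ * s₃ * s₄ * s₅ + 20 * s₃ * s₄ * s₅ + 120 * s₅)) ≡
          a * (Π * c₁ + c₁ * c₀ * (5 * s₂ * s₃ * s₄ * s₅ + 60 * s₄ * s₅ + 240)) + β * R →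
          β * (6 * P) ≡ b * Π →
          12 * P + c₂ * c₃ * R ≡ 6 * P * c₃ →
          Deviation₅ s₀ s₁ s₂ s₃ s₄ s₅ c₀ c₁ c₂ c₃ c₄ c₅ →
          (c₃ * (c₄ * c₅) * 20 + c₅ * 120) * a + c₄ * c₅ * (b * 2) ≡ c₃ * (c₄ * c₅) * b + (c₄ * c₅ * 60 + 240) * a
reduce₅ a b β R s₀ s₁ s₂ s₃ s₄ s₅ c₀ c₁ c₂ c₃ c₄ c₅ num₁ num₂ eq₃ eq₅ =
  *-cancelˡ-≡ _ _ Π (+-cancelˡ-≡ K _ _ (begin
    K + Π * ((c₃ * w * 20 + c₅ * 120) * a + w * (b * 2))
      ≡⟨ step₁ a Π c₀ c₁ c₂ c₃ c₄ c₅ A b ⟩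
    a * (Π * (c₁ * c₂ * c₃ * c₄ * c₅ + 20 * c₃ * c₄ * c₅ + 120 * c₅) + c₅ * c₄ * c₃ * c₂ * c₁ * c₀ * A) + 2 * (b * Π) * w
      ≡⟨ cong₂ (λ x y → a * x + 2 * y * w) eq₅ (sym num₂) ⟩
    a * (Π * (5 * c₂ * c₃ * c₄ * c₅ + 60 * c₄ * c₅ + 240) + c₅ * c₄ * c₃ * c₂ * c₁ * c₀ * B) + 2 * (β * (6 * P)) * w
      ≡⟨ step₂ a Π c₀ c₁ c₂ c₃ c₄ c₅ B β P ⟩
    a * (5 * Π + c₁ * c₀ * B) * (c₂ * c₃ * w) + β * w * (12 * P) + Π * (a * (60 * w + 240))
      ≡⟨ cong (λ x → x * (c₂ * c₃ * w) + β * w * (12 * P) + Π * (a * (60 * w + 240))) num₁ ⟩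
    (a * (Π * c₁ + c₁ * c₀ * A) + β * R) * (c₂ * c₃ * w) + β * w * (12 * P) + Π * (a * (60 * w + 240))
      ≡⟨ step₃ (a * (Π * c₁ + c₁ * c₀ * A)) β R c₂ c₃ w P (Π * (a * (60 * w + 240))) ⟩
    K + β * w * (12 * P + c₂ * c₃ * R) + Π * (a * (60 * w + 240))
      ≡⟨ cong (λ x → K + β * w * x + Π * (a * (60 * w + 240))) eq₃ ⟩
    K + β * w * (6 * P * c₃) + Π * (a * (60 * w + 240))
      ≡⟨ step₄ K β w P c₃ (Π * (a * (60 * w + 240))) ⟩
    K + β * (6 * P) * (c₃ * w) + Π * (a * (60 * w + 240))
      ≡⟨ cong (λ x → K + x * (c₃ * w) + Π * (a * (60 * w + 240))) num₂ ⟩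
    K + b * Π * (c₃ * w) + Π * (a * (60 * w + 240))
      ≡⟨ step₅ K a b Π c₃ w ⟩
    K + Π * (c₃ * w * b + (w * 60 + 240) * a) ∎))
  where
  open ≡-Reasoning
  Π = s₅ * s₄ * s₃ * s₂ * s₁ * s₀
  P = s₃ * s₂ * s₁ * s₀
  A = 5 * s₂ * s₃ * s₄ * s₅ + 60 * s₄ * s₅ + 240
  B = s₁ * s₂ * s₃ * s₄ * s₅ + 20 * s₃ * s₄ * s₅ + 120 * s₅
  w = c₄ * c₅
  K = a * (Π * c₁ + c₁ * c₀ * A) * (c₂ * c₃ * w)
  step₁ : ∀ a Π c₀ c₁ c₂ c₃ c₄ c₅ A b →
    a * (Π * c₁ + c₁ * c₀ * A) * (c₂ * c₃ * (c₄ * c₅)) + Π * ((c₃ * (c₄ * c₅) * 20 + c₅ * 120) * a + c₄ * c₅ * (b * 2)) ≡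
    a * (Π * (c₁ * c₂ * c₃ * c₄ * c₅ + 20 * c₃ * c₄ * c₅ + 120 * c₅) + c₅ * c₄ * c₃ * c₂ * c₁ * c₀ * A) + 2 * (b * Π) * (c₄ * c₅)
  step₁ = ringℕ
  step₂ : ∀ a Π c₀ c₁ c₂ c₃ c₄ c₅ B β P →
    a * (Π * (5 * c₂ * c₃ * c₄ * c₅ + 60 * c₄ * c₅ + 240) + c₅ * c₄ * c₃ * c₂ * c₁ * c₀ * B) + 2 * (β * (6 * P)) * (c₄ * c₅) ≡
    a * (5 * Π + c₁ * c₀ * B) * (c₂ * c₃ * (c₄ * c₅)) + β * (c₄ * c₅) * (12 * P) + Π * (a * (60 * (c₄ * c₅) + 240))
  step₂ = ringℕ
  step₃ : ∀ l β R c₂ c₃ w P r →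
    (l + β * R) * (c₂ * c₃ * w) + β * w * (12 * P) + r ≡ l * (c₂ * c₃ * w) + β * w * (12 * P + c₂ * c₃ * R) + r
  step₃ = ringℕ
  step₄ : ∀ K β w P c₃ r → K + β * w * (6 * P * c₃) + r ≡ K + β * (6 * P) * (c₃ * w) + r
  step₄ = ringℕ
  step₅ : ∀ K a b Π c₃ w → K + b * Π * (c₃ * w) + Π * (a * (60 * w + 240)) ≡ K + Π * (c₃ * w * b + (w * 60 + 240) * a)
  step₅ = ringℕ

-- Deviations from the Boolean sequence

module BooleanArithmetic where

  -- The upper bound on c₀ is 7 + e + 2 / (4 + e), not attained. As c₀ increases with c₁, putting c₁
  -- = 5 + e gives the lower bound 5 + e - 2 / (4 + e).
  window : ∀ e c₀ c₁ → 5 + e ≤ c₁ → (4 + e) * c₁ * c₀ + 2 * ((6 + e) * (5 + e)) ≡ (6 + e) * (5 + e) * c₁ →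
           c₀ ≡ 5 + e ⊎ c₀ ≡ 6 + e ⊎ c₀ ≡ 7 + e
  window e c₀ c₁ c₁≥ eq with ≤⇒offset c₁≥ | 5 + e ≤? c₀
  ... | j , refl | no c₀≱ = ⊥-elim (absurd-≤ _
    (≤-trans (≤-reflexive (sym eq)) (+-monoˡ-≤ _ (*-monoʳ-≤ ((4 + e) * (j + (5 + e))) (≤-pred (≰⇒> c₀≱))))) (slack e j))
    where
    slack : ∀ e j → (6 + e) * (5 + e) * (j + (5 + e)) ≡
            (4 + e) * (j + (5 + e)) * (4 + e) + 2 * ((6 + e) * (5 + e)) + suc (9 + 7 * e + e * e + j * (14 + 3 * e))
    slack = ringℕ
  ... | j , refl | yes c₀≥ with ≤⇒offset c₀≥
  ...   | 0 , c₀≡ = inj₁ c₀≡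
  ...   | 1 , c₀≡ = inj₂ (inj₁ c₀≡)
  ...   | 2 , c₀≡ = inj₂ (inj₂ c₀≡)
  ...   | suc (suc (suc i)) , refl = ⊥-elim (absurd-≡ _ eq (slack e i c₁))
    where
    slack : ∀ e i c₁ → (4 + e) * c₁ * (3 + i + (5 + e)) + 2 * ((6 + e) * (5 + e)) ≡
            (6 + e) * (5 + e) * c₁ + suc (59 + 22 * e + 2 * e * e + c₁ * (2 + e) + (4 + e) * c₁ * i)
    slack = ringℕ

  private
    E : ℕ → ℕ
    E e = e * e * e + e * e * 18 + e * 107 + 204

    E-eq : ∀ e → E e + (3 * (7 + e) * (8 + e) + 12) ≡ (6 + e) * (7 + e) * (8 + e) + 6 * (8 + e)
    E-eq = go
      where
      go : ∀ e → e * e * e + e * e * 18 + e * 107 + 204 + (3 * (7 + e) * (8 + e) + 12) ≡ (6 + e) * (7 + e) * (8 + e) + 6 * (8 + e)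
      go = ringℕ

  -- Since (6 + e)(5 + e) exceeds (4 + e)(7 + e) by exactly 2, the first relation gives c₁ = (6 +
  -- e)(5 + e).
  no-7+e : ∀ e c₁ c₂ c₃ → 3 ≤ c₃ → (4 + e) * c₁ * (7 + e) + 2 * ((6 + e) * (5 + e)) ≡ (6 + e) * (5 + e) * c₁ →
           Deviation₃ (5 + e) (6 + e) (7 + e) (8 + e) (7 + e) c₁ c₂ c₃ → ⊥
  no-7+e e c₁ c₂ c₃ 3≤c₃ eq₁ dev = collapse-product (5 + e) (6 + e) (7 + e) (8 + e) c₂ c₃
    (E e) (12 + 8 * e + e * e) (E-eq e) (core e) 3≤c₃
    (subst (λ c → Deviation₃ (5 + e) (6 + e) (7 + e) (8 + e) (7 + e) c c₂ c₃) c₁≡ dev)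
    where
    c₁≡ : c₁ ≡ (6 + e) * (5 + e)
    c₁≡ = sym (*-cancelˡ-≡ _ c₁ 2 (+-cancelˡ-≡ ((4 + e) * c₁ * (7 + e)) _ _ (trans eq₁ (expand e c₁))))
      where
      expand : ∀ e c → (6 + e) * (5 + e) * c ≡ (4 + e) * c * (7 + e) + 2 * c
      expand = ringℕ
    core : ∀ e → (8 + e) * (6 + e) * (5 + e) ≡ e * e * e + e * e * 18 + e * 107 + 204 + 3 * (8 + e) + (12 + 8 * e + e * e)
    core = ringℕ

  c₁-6+e : ∀ e c₁ → (4 + e) * c₁ * (6 + e) + 2 * ((6 + e) * (5 + e)) ≡ (6 + e) * (5 + e) * c₁ → c₁ ≡ 2 * (5 + e)
  c₁-6+e e c₁ eq = sym (*-cancelˡ-≡ _ c₁ (6 + e) (+-cancelˡ-≡ ((4 + e) * c₁ * (6 + e)) _ _ (trans (l e c₁) (trans eq (r e c₁)))))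
    where
    l : ∀ e c → (4 + e) * c * (6 + e) + (6 + e) * (2 * (5 + e)) ≡ (4 + e) * c * (6 + e) + 2 * ((6 + e) * (5 + e))
    l = ringℕ
    r : ∀ e c → (6 + e) * (5 + e) * c ≡ (4 + e) * c * (6 + e) + (6 + e) * c
    r = ringℕ

  -- The case c₀ = 6 + e with e replaced by e + 4. Before the shift the margin is e² + 3e - 16,
  -- which is negative for e = 0 and e = 2; these two values are left to `no-6` and `no-8`.
  no-10+e : ∀ e c₂ c₃ → 3 ≤ c₃ → Deviation₃ (9 + e) (10 + e) (11 + e) (12 + e) (10 + e) (2 * (9 + e)) c₂ c₃ → ⊥
  no-10+e e c₂ c₃ = collapse-double (9 + e) (10 + e) (11 + e) (12 + e) c₂ c₃ (E (4 + e)) (e * e + e * 11 + 12) (E-eq (4 + e))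
    (core e (4 + e) (9 + e) (11 + e) (12 + e) (+-comm 4 e) (+-comm 9 e) (+-comm 11 e) (+-comm 12 e))
    where
    go : ∀ e → 2 * ((e + 12) * (e + 11) * (e + 9)) ≡
         2 * ((e + 4) * (e + 4) * (e + 4) + (e + 4) * (e + 4) * 18 + (e + 4) * 107 + 204) + 3 * ((e + 12) * (e + 11)) + (e * e + e * 11 + 12)
    go = ringℕ
    core : ∀ e e′ s₀ s₂ s₃ → e′ ≡ e + 4 → s₀ ≡ e + 9 → s₂ ≡ e + 11 → s₃ ≡ e + 12 →
           2 * (s₃ * s₂ * s₀) ≡ 2 * E e′ + 3 * (s₃ * s₂) + (e * e + e * 11 + 12)
    core e _ _ _ _ refl refl refl refl = go e

  private
    -- The terms with c₃ happen to cancel, leaving 120 c₅ = 20 c₄ c₅ + 240, which would need c₄ < 6.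
    no-6-linear : ∀ c₃ c₄ c₅ → 8 ≤ c₄ → (c₃ * (c₄ * c₅) * 20 + c₅ * 120) * 1 + c₄ * c₅ * 40 ≡
                                        c₃ * (c₄ * c₅) * 20 + (c₄ * c₅ * 60 + 240) * 1 → ⊥
    no-6-linear c₃ c₄ c₅ c₄≥ eq with ≤⇒offset c₄≥
    ... | i , refl = absurd-≡ _ (sym eq) (slack c₃ i c₅)
      where
      slack : ∀ c₃ i c₅ → c₃ * ((i + 8) * c₅) * 20 + ((i + 8) * c₅ * 60 + 240) * 1 ≡
              (c₃ * ((i + 8) * c₅) * 20 + c₅ * 120) * 1 + (i + 8) * c₅ * 40 + suc (i * c₅ * 20 + c₅ * 40 + 239)
      slack = ringℕ

    no-8-linear : ∀ c₃ c₄ c₅ → 9 ≤ c₃ → 10 ≤ c₄ → (c₃ * (c₄ * c₅) * 20 + c₅ * 120) * 11 + c₄ * c₅ * 620 ≡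
                                                  c₃ * (c₄ * c₅) * 310 + (c₄ * c₅ * 60 + 240) * 11 → ⊥
    no-8-linear c₃ c₄ c₅ c₃≥ c₄≥ eq with ≤⇒offset c₃≥ | ≤⇒offset c₄≥
    ... | l , refl | i , refl = absurd-≡ _ (sym eq) (slack l i c₅)
      where
      slack : ∀ l i c₅ → (l + 9) * ((i + 10) * c₅) * 310 + ((i + 10) * c₅ * 60 + 240) * 11 ≡
              ((l + 9) * ((i + 10) * c₅) * 20 + c₅ * 120) * 11 + (i + 10) * c₅ * 620 +
              suc (c₅ * 7180 + i * c₅ * 850 + l * ((i + 10) * c₅) * 90 + 2639)
      slack = ringℕ

  no-6 : ∀ c₂ c₃ c₄ c₅ → 8 ≤ c₄ → Deviation₃ 5 6 7 8 6 10 c₂ c₃ → Deviation₅ 5 6 7 8 9 10 6 10 c₂ c₃ c₄ c₅ → ⊥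
  no-6 c₂ c₃ c₄ c₅ c₄≥ dev₃ dev₅ = no-6-linear c₃ c₄ c₅ c₄≥
    -- R = 480 is the excess U - V computed just below. The ratio b / a = 20 / 1 is the one that
    -- cancels c₂ c₃ c₄ c₅, and β = b s₄ s₅ / 6 = 300. The constants of the other four uses of
    -- `reduce₅` arise in the same way.
    (reduce₅ 1 20 300 480 5 6 7 8 9 10 6 10 c₂ c₃ c₄ c₅ refl refl
      (positive-part (8 * 7 * 6 * 5) {10 * 6 * 204 + 3 * (8 * 7 * 6 * 5)} {10 * (8 * 7 * 6 * 5)} {480} (c₂ * c₃) c₃ refl
        (reduce₃ 5 6 7 8 6 10 c₂ c₃ 204 refl dev₃)) dev₅)

  no-8 : ∀ c₂ c₃ c₄ c₅ → 9 ≤ c₃ → 10 ≤ c₄ → Deviation₃ 7 8 9 10 8 14 c₂ c₃ → Deviation₅ 7 8 9 10 11 12 8 14 c₂ c₃ c₄ c₅ → ⊥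
  no-8 c₂ c₃ c₄ c₅ c₃≥ c₄≥ dev₃ dev₅ = no-8-linear c₃ c₄ c₅ c₃≥ c₄≥
    (reduce₅ 11 310 6820 336 7 8 9 10 11 12 8 14 c₂ c₃ c₄ c₅ refl refl
      (positive-part (10 * 9 * 8 * 7) {14 * 8 * 498 + 3 * (10 * 9 * 8 * 7)} {14 * (10 * 9 * 8 * 7)} {336} (c₂ * c₃) c₃ refl
        (reduce₃ 7 8 9 10 8 14 c₂ c₃ 498 refl dev₃)) dev₅)

-- Deviations from the suspension sequence

module SuspensionArithmetic where

  -- The general coatom bound is already the model value here, so only the upper bound 6 + e + 2 /
  -- (3 + e) has to be read off.
  window : ∀ e c₀ c₁ → 4 + e ≤ c₀ → (3 + e) * c₁ * c₀ + 2 * ((5 + e) * (4 + e)) ≡ (5 + e) * (4 + e) * c₁ →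
           c₀ ≡ 4 + e ⊎ c₀ ≡ 5 + e ⊎ c₀ ≡ 6 + e
  window e c₀ c₁ c₀≥ eq with ≤⇒offset c₀≥
  ... | 0 , c₀≡ = inj₁ c₀≡
  ... | 1 , c₀≡ = inj₂ (inj₁ c₀≡)
  ... | 2 , c₀≡ = inj₂ (inj₂ c₀≡)
  ... | suc (suc (suc i)) , refl = ⊥-elim (absurd-≡ _ eq (slack e i c₁))
    where
    slack : ∀ e i c₁ → (3 + e) * c₁ * (3 + i + (4 + e)) + 2 * ((5 + e) * (4 + e)) ≡
            (5 + e) * (4 + e) * c₁ + suc (39 + 18 * e + 2 * e * e + c₁ * (1 + e) + (3 + e) * c₁ * i)
    slack = ringℕ

  -- 2 (5 + e) lies strictly between 2 (4 + e) and 3 (4 + e). Divisibility would not exclude c₀ = 6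
  -- + e when e = 0, as 12 = 3 · 4; that value is refuted by `collapse-product`.
  no-5+e : ∀ e A → 2 * (5 + e) ≡ A * (4 + e) → ⊥
  no-5+e e 0 ()
  no-5+e e 1 eq = absurd-≡ _ eq (slack e)
    where
    slack : ∀ e → 2 * (5 + e) ≡ 1 * (4 + e) + suc (5 + e)
    slack = ringℕ
  no-5+e e 2 eq = absurd-≡ _ eq (slack e)
    where
    slack : ∀ e → 2 * (5 + e) ≡ 2 * (4 + e) + suc 1
    slack = ringℕ
  no-5+e e (suc (suc (suc A))) eq = absurd-≡ _ (sym eq) (slack e A)
    where
    slack : ∀ e A → (3 + A) * (4 + e) ≡ 2 * (5 + e) + suc (1 + e + A * (4 + e))
    slack = ringℕ

  no-6+e : ∀ e c₁ c₂ c₃ → 3 ≤ c₃ → (3 + e) * c₁ * (6 + e) + 2 * ((5 + e) * (4 + e)) ≡ (5 + e) * (4 + e) * c₁ →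
           Deviation₃ (4 + e) (5 + e) (6 + e) (7 + e) (6 + e) c₁ c₂ c₃ → ⊥
  no-6+e e c₁ c₂ c₃ 3≤c₃ eq₁ dev = collapse-product (4 + e) (5 + e) (6 + e) (7 + e) c₂ c₃
    (e * e * e + e * e * 15 + e * 74 + 114) (5 + 6 * e + e * e) (E-eq e) (core e) 3≤c₃
    (subst (λ c → Deviation₃ (4 + e) (5 + e) (6 + e) (7 + e) (6 + e) c c₂ c₃) c₁≡ dev)
    where
    c₁≡ : c₁ ≡ (5 + e) * (4 + e)
    c₁≡ = sym (*-cancelˡ-≡ _ c₁ 2 (+-cancelˡ-≡ ((3 + e) * c₁ * (6 + e)) _ _ (trans eq₁ (expand e c₁))))
      where
      expand : ∀ e c → (5 + e) * (4 + e) * c ≡ (3 + e) * c * (6 + e) + 2 * c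
      expand = ringℕ
    E-eq : ∀ e → e * e * e + e * e * 15 + e * 74 + 114 + (3 * (6 + e) * (7 + e) + 12) ≡ (5 + e) * (6 + e) * (7 + e) + 6 * (7 + e)
    E-eq = ringℕ
    core : ∀ e → (7 + e) * (5 + e) * (4 + e) ≡ e * e * e + e * e * 15 + e * 74 + 114 + 3 * (7 + e) + (5 + 6 * e + e * e)
    core = ringℕ

-- Deviations from the cubical sequence

module CubicalArithmetic where

  private
    E : ℕ → ℕ
    E e = e * e * e * 8 + e * e * 132 + e * 712 + 1248

    double-comm : ∀ k e → 2 * (k + e) ≡ e * 2 + k * 2
    double-comm = ringℕ

    E-eq : ∀ e → E e + (3 * (2 * (6 + e)) * (2 * (7 + e)) + 12) ≡
                 2 * (5 + e) * (2 * (6 + e)) * (2 * (7 + e)) + 6 * (2 * (7 + e))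
    E-eq e = core (2 * (5 + e)) (2 * (6 + e)) (2 * (7 + e)) (double-comm 5 e) (double-comm 6 e) (double-comm 7 e)
      where
      go : ∀ e → e * e * e * 8 + e * e * 132 + e * 712 + 1248 + (3 * (e * 2 + 12) * (e * 2 + 14) + 12) ≡
                 (e * 2 + 10) * (e * 2 + 12) * (e * 2 + 14) + 6 * (e * 2 + 14)
      go = ringℕ
      core : ∀ s₁ s₂ s₃ → s₁ ≡ e * 2 + 10 → s₂ ≡ e * 2 + 12 → s₃ ≡ e * 2 + 14 →
             E e + (3 * s₂ * s₃ + 12) ≡ s₁ * s₂ * s₃ + 6 * s₃
      core _ _ _ refl refl refl = go e

  -- Here s₁ - 2 = s₀, so the relation factors as c₁ (s₁ - c₀) = 2 s₁. The bound c₁ ≥ s₁ / 2 leaves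
  -- s₁ - c₀ among 1, 2, 3, 4, with 2 for the model, and c₁ is 2 s₁ divided by that number.
  window : ∀ e c₀ c₁ → 5 + e ≤ c₁ →
           (8 + 2 * e) * c₁ * c₀ + 2 * ((10 + 2 * e) * (2 * (4 + e))) ≡ (10 + 2 * e) * (2 * (4 + e)) * c₁ →
           c₀ ≡ 6 + 2 * e ⊎ c₀ ≡ 7 + 2 * e ⊎ c₀ ≡ 8 + 2 * e ⊎ c₀ ≡ 9 + 2 * e
  window e c₀ c₁ c₁≥ eq with ≤⇒offset c₁≥ | 6 + 2 * e ≤? c₀
  ... | j , refl | no c₀≱ = ⊥-elim (absurd-≤ _
    (≤-trans (≤-reflexive (sym eq)) (+-monoˡ-≤ _ (*-monoʳ-≤ ((8 + 2 * e) * (j + (5 + e))) (≤-pred (≰⇒> c₀≱))))) (slack e j))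
    where
    slack : ∀ e j → (10 + 2 * e) * (2 * (4 + e)) * (j + (5 + e)) ≡
            (8 + 2 * e) * (j + (5 + e)) * (5 + 2 * e) + 2 * ((10 + 2 * e) * (2 * (4 + e))) +
            suc (39 + 18 * e + 2 * (e * e) + j * (40 + 10 * e))
    slack = ringℕ
  ... | j , refl | yes c₀≥ with ≤⇒offset c₀≥
  ...   | 0 , c₀≡ = inj₁ c₀≡
  ...   | 1 , c₀≡ = inj₂ (inj₁ c₀≡)
  ...   | 2 , c₀≡ = inj₂ (inj₂ (inj₁ c₀≡))
  ...   | 3 , c₀≡ = inj₂ (inj₂ (inj₂ c₀≡))
  ...   | suc (suc (suc (suc i))) , refl = ⊥-elim (absurd-≡ _ eq (slack e i c₁))
    where
    slack : ∀ e i c₁ → (8 + 2 * e) * c₁ * (4 + i + (6 + 2 * e)) + 2 * ((10 + 2 * e) * (2 * (4 + e))) ≡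
            (10 + 2 * e) * (2 * (4 + e)) * c₁ + suc (159 + 72 * e + 8 * (e * e) + (8 + 2 * e) * c₁ * i)
    slack = ringℕ

  c₁-6+2e : ∀ e c₁ → (8 + 2 * e) * c₁ * (6 + 2 * e) + 2 * ((10 + 2 * e) * (2 * (4 + e))) ≡ (10 + 2 * e) * (2 * (4 + e)) * c₁ →
            c₁ ≡ 5 + e
  c₁-6+2e e c₁ eq = sym (*-cancelˡ-≡ (5 + e) c₁ (32 + 8 * e)
    (+-cancelˡ-≡ ((8 + 2 * e) * c₁ * (6 + 2 * e)) _ _ (trans (l e c₁) (trans eq (r e c₁)))))
    where
    l : ∀ e c → (8 + 2 * e) * c * (6 + 2 * e) + (32 + 8 * e) * (5 + e) ≡
                (8 + 2 * e) * c * (6 + 2 * e) + 2 * ((10 + 2 * e) * (2 * (4 + e)))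
    l = ringℕ
    r : ∀ e c → (10 + 2 * e) * (2 * (4 + e)) * c ≡ (8 + 2 * e) * c * (6 + 2 * e) + (32 + 8 * e) * c
    r = ringℕ

  c₁-7+2e : ∀ e c₁ → (8 + 2 * e) * c₁ * (7 + 2 * e) + 2 * ((10 + 2 * e) * (2 * (4 + e))) ≡ (10 + 2 * e) * (2 * (4 + e)) * c₁ →
            3 * c₁ ≡ 4 * (5 + e)
  c₁-7+2e e c₁ eq = sym (*-cancelˡ-≡ (4 * (5 + e)) (3 * c₁) (8 + 2 * e)
    (+-cancelˡ-≡ ((8 + 2 * e) * c₁ * (7 + 2 * e)) _ _ (trans (l e c₁) (trans eq (r e c₁)))))
    where
    l : ∀ e c → (8 + 2 * e) * c * (7 + 2 * e) + (8 + 2 * e) * (4 * (5 + e)) ≡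
                (8 + 2 * e) * c * (7 + 2 * e) + 2 * ((10 + 2 * e) * (2 * (4 + e)))
    l = ringℕ
    r : ∀ e c → (10 + 2 * e) * (2 * (4 + e)) * c ≡ (8 + 2 * e) * c * (7 + 2 * e) + (8 + 2 * e) * (3 * c)
    r = ringℕ

  c₁-9+2e : ∀ e c₁ → (8 + 2 * e) * c₁ * (9 + 2 * e) + 2 * ((10 + 2 * e) * (2 * (4 + e))) ≡ (10 + 2 * e) * (2 * (4 + e)) * c₁ →
            c₁ ≡ 4 * (5 + e)
  c₁-9+2e e c₁ eq = sym (*-cancelˡ-≡ (4 * (5 + e)) c₁ (8 + 2 * e)
    (+-cancelˡ-≡ ((8 + 2 * e) * c₁ * (9 + 2 * e)) _ _ (trans (l e c₁) (trans eq (r e c₁)))))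
    where
    l : ∀ e c → (8 + 2 * e) * c * (9 + 2 * e) + (8 + 2 * e) * (4 * (5 + e)) ≡
                (8 + 2 * e) * c * (9 + 2 * e) + 2 * ((10 + 2 * e) * (2 * (4 + e)))
    l = ringℕ
    r : ∀ e c → (10 + 2 * e) * (2 * (4 + e)) * c ≡ (8 + 2 * e) * c * (9 + 2 * e) + (8 + 2 * e) * c
    r = ringℕ

  -- With c₀ = s₁ - 1 and c₁ = 2 s₁ the surplus V - U is s₁ times the cubic `δ`, so `collapse`
  -- applies for all e.
  no-9+2e : ∀ e c₂ c₃ → 3 ≤ c₃ →
            Deviation₃ (2 * (4 + e)) (2 * (5 + e)) (2 * (6 + e)) (2 * (7 + e)) (9 + 2 * e) (4 * (5 + e)) c₂ c₃ → ⊥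
  no-9+2e e c₂ c₃ 3≤c₃ dev = collapse (s₃ * s₂ * s₁ * s₀) (c₂ * c₃) c₃ (s₁ * δ) 3≤c₃
    (trans (l (5 + e) s₀ s₂ s₃) (trans (cong (s₁ *_) (core s₀ s₁ s₂ s₃ (9 + 2 * e) (double-comm 4 e) (double-comm 5 e) (double-comm 6 e) (double-comm 7 e) (offset e))) (r (5 + e) s₀ s₂ s₃ (9 + 2 * e) (E e) δ)))
    (reduce₃ s₀ s₁ s₂ s₃ (9 + 2 * e) (4 * (5 + e)) c₂ c₃ (E e) (E-eq e) dev)
    where
    s₀ = 2 * (4 + e)
    s₁ = 2 * (5 + e)
    s₂ = 2 * (6 + e)
    s₃ = 2 * (7 + e)
    δ = e * e * e * 8 + e * e * 96 + e * 352 + 384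
    l : ∀ a s₀ s₂ s₃ → 4 * a * (s₃ * s₂ * (2 * a) * s₀) ≡ 2 * a * (2 * (2 * a) * (s₃ * s₂ * s₀))
    l = ringℕ
    r : ∀ a s₀ s₂ s₃ c₀ E δ → 2 * a * (2 * c₀ * E + 3 * (s₃ * s₂ * s₀) + δ) ≡
                              4 * a * c₀ * E + 3 * (s₃ * s₂ * (2 * a) * s₀) + 2 * a * δ
    r = ringℕ
    offset : ∀ e → 9 + 2 * e ≡ e * 2 + 9
    offset = ringℕ
    go : ∀ e → 2 * (e * 2 + 10) * ((e * 2 + 14) * (e * 2 + 12) * (e * 2 + 8)) ≡
         2 * (e * 2 + 9) * (e * e * e * 8 + e * e * 132 + e * 712 + 1248) +
         3 * ((e * 2 + 14) * (e * 2 + 12) * (e * 2 + 8)) + (e * e * e * 8 + e * e * 96 + e * 352 + 384)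
    go = ringℕ
    core : ∀ s₀ s₁ s₂ s₃ c₀ → s₀ ≡ e * 2 + 8 → s₁ ≡ e * 2 + 10 → s₂ ≡ e * 2 + 12 → s₃ ≡ e * 2 + 14 → c₀ ≡ e * 2 + 9 →
           2 * s₁ * (s₃ * s₂ * s₀) ≡ 2 * c₀ * E e + 3 * (s₃ * s₂ * s₀) + δ
    core _ _ _ _ _ refl refl refl refl refl = go e

  -- The case c₀ = s₁ - 4, c₁ = s₁ / 2, with e replaced by e + 4: now U exceeds V, and the bound on
  -- c₂ suffices for `explode` only from e = 4 on. The values e = 0 and e = 2 are treated in
  -- `CubicalExceptions`.
  no-14+2e : ∀ e c₂ c₃ → 10 + e ≤ c₂ →
             Deviation₃ (2 * (8 + e)) (2 * (9 + e)) (2 * (10 + e)) (2 * (11 + e)) (6 + 2 * (4 + e)) (9 + e) c₂ c₃ → ⊥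
  no-14+2e e c₂ c₃ c₂≥ dev = explode (s₃ * s₂ * s₁ * s₀) {(9 + e) * R} (10 + e) ((9 + e) * σ) c₂ c₃ c₂≥
    (trans (l (10 + e) (9 + e) R) (trans (cong ((9 + e) *_) (core (10 + e) s₀ s₂ s₃ (+-comm 10 e) (double-comm 8 e) (double-comm 10 e) (double-comm 11 e))) (r (9 + e) s₀ s₂ s₃ σ)))
    (positive-part (s₃ * s₂ * s₁ * s₀) (c₂ * c₃) c₃
      (trans (u (9 + e) s₀ s₂ s₃ (6 + 2 * (4 + e)) (E (4 + e))) (trans (cong ((9 + e) *_) (core′ (4 + e) s₀ s₁ s₂ s₃ (6 + 2 * (4 + e)) (+-comm 4 e) (double-comm 8 e) (double-comm 9 e) (double-comm 10 e) (double-comm 11 e) (offset e))) (v (9 + e) s₀ s₂ s₃ R)))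
      (reduce₃ s₀ s₁ s₂ s₃ (6 + 2 * (4 + e)) (9 + e) c₂ c₃ (E (4 + e)) (E-eq (4 + e)) dev))
    where
    s₀ = 2 * (8 + e)
    s₁ = 2 * (9 + e)
    s₂ = 2 * (10 + e)
    s₃ = 2 * (11 + e)
    R = e * e * e * 8 + e * e * 264 + e * 2800 + 9600
    σ = e * e * e * e * 8 + e * e * e * 248 + e * e * 2656 + e * 10912 + 11520
    l : ∀ t a R → t * (a * R) ≡ a * (t * R)
    l = ringℕ
    r : ∀ a s₀ s₂ s₃ σ → a * (12 * (s₃ * s₂ * s₀) + σ) ≡ 6 * (s₃ * s₂ * (2 * a) * s₀) + a * σ
    r = ringℕ
    u : ∀ a s₀ s₂ s₃ c₀ E → a * c₀ * E + 3 * (s₃ * s₂ * (2 * a) * s₀) ≡ a * (c₀ * E + 6 * (s₃ * s₂ * s₀))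
    u = ringℕ
    v : ∀ a s₀ s₂ s₃ R → a * (R + 2 * a * (s₃ * s₂ * s₀)) ≡ a * R + a * (s₃ * s₂ * (2 * a) * s₀)
    v = ringℕ
    offset : ∀ e → 6 + 2 * (4 + e) ≡ e * 2 + 14
    offset = ringℕ
    go : ∀ e → (e + 10) * (e * e * e * 8 + e * e * 264 + e * 2800 + 9600) ≡
         12 * ((e * 2 + 22) * (e * 2 + 20) * (e * 2 + 16)) + (e * e * e * e * 8 + e * e * e * 248 + e * e * 2656 + e * 10912 + 11520)
    go = ringℕ
    core : ∀ t s₀ s₂ s₃ → t ≡ e + 10 → s₀ ≡ e * 2 + 16 → s₂ ≡ e * 2 + 20 → s₃ ≡ e * 2 + 22 → t * R ≡ 12 * (s₃ * s₂ * s₀) + σ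
    core _ _ _ _ refl refl refl refl = go e
    go′ : ∀ e → (e * 2 + 14) * ((e + 4) * (e + 4) * (e + 4) * 8 + (e + 4) * (e + 4) * 132 + (e + 4) * 712 + 1248) +
          6 * ((e * 2 + 22) * (e * 2 + 20) * (e * 2 + 16)) ≡
          e * e * e * 8 + e * e * 264 + e * 2800 + 9600 + (e * 2 + 18) * ((e * 2 + 22) * (e * 2 + 20) * (e * 2 + 16))
    go′ = ringℕ
    core′ : ∀ e′ s₀ s₁ s₂ s₃ c₀ → e′ ≡ e + 4 → s₀ ≡ e * 2 + 16 → s₁ ≡ e * 2 + 18 → s₂ ≡ e * 2 + 20 → s₃ ≡ e * 2 + 22 → c₀ ≡ e * 2 + 14 →
            c₀ * E e′ + 6 * (s₃ * s₂ * s₀) ≡ R + s₁ * (s₃ * s₂ * s₀)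
    core′ _ _ _ _ _ _ refl refl refl refl refl refl = go′ e

  -- Here 3 c₁ = 4 (15 + e), so the relation is scaled by 3.
  no-27+2e : ∀ e c₁ c₂ c₃ → 3 * c₁ ≡ 4 * (15 + e) → 16 + e ≤ c₂ →
             Deviation₃ (2 * (14 + e)) (2 * (15 + e)) (2 * (16 + e)) (2 * (17 + e)) (7 + 2 * (10 + e)) c₁ c₂ c₃ → ⊥
  no-27+2e e c₁ c₂ c₃ c₁≡ c₂≥ dev = explode (3 * P) {s₁ * R} (16 + e) (s₁ * σ) c₂ c₃ c₂≥
    (trans (l (16 + e) s₁ R) (trans (cong (s₁ *_) (core (16 + e) s₀ s₂ s₃ (+-comm 16 e) (double-comm 14 e) (double-comm 16 e) (double-comm 17 e))) (r s₀ s₁ s₂ s₃ σ)))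
    (positive-part (3 * P) {4 * (15 + e) * c₀ * E (10 + e) + 9 * P} {4 * (15 + e) * P} {s₁ * R} (c₂ * c₃) c₃
      (trans (u (15 + e) s₀ s₂ s₃ c₀ (E (10 + e))) (trans (cong (s₁ *_) (core′ (10 + e) (15 + e) s₀ s₂ s₃ c₀ (+-comm 10 e) (+-comm 15 e) (double-comm 14 e) (double-comm 16 e) (double-comm 17 e) (offset e))) (v (15 + e) s₀ s₂ s₃ R)))
      (subst (λ x → 12 * (3 * P) + c₂ * c₃ * (x * c₀ * E (10 + e) + 9 * P) ≡ 6 * (3 * P) * c₃ + c₂ * c₃ * (x * P)) c₁≡
        (trans (m P (c₂ * c₃) c₁ c₀ (E (10 + e)))
          (trans (cong (3 *_) (reduce₃ s₀ s₁ s₂ s₃ c₀ c₁ c₂ c₃ (E (10 + e)) (E-eq (10 + e)) dev)) (n P (c₂ * c₃) c₁ c₃)))))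
    where
    s₀ = 2 * (14 + e)
    s₁ = 2 * (15 + e)
    s₂ = 2 * (16 + e)
    s₃ = 2 * (17 + e)
    c₀ = 7 + 2 * (10 + e)
    P = s₃ * s₂ * s₁ * s₀
    R = e * e * e * 8 + e * e * 432 + e * 7552 + 43008
    σ = e * e * e * e * 8 + e * e * e * 416 + e * e * 7696 + e * 58144 + 139776
    l : ∀ t a R → t * (a * R) ≡ a * (t * R)
    l = ringℕ
    r : ∀ s₀ s₁ s₂ s₃ σ → s₁ * (18 * (s₃ * s₂ * s₀) + σ) ≡ 6 * (3 * (s₃ * s₂ * s₁ * s₀)) + s₁ * σ
    r = ringℕ
    u : ∀ a s₀ s₂ s₃ c₀ E → 4 * a * c₀ * E + 9 * (s₃ * s₂ * (2 * a) * s₀) ≡ 2 * a * (2 * c₀ * E + 9 * (s₃ * s₂ * s₀))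
    u = ringℕ
    v : ∀ a s₀ s₂ s₃ R → 2 * a * (R + 4 * a * (s₃ * s₂ * s₀)) ≡ 2 * a * R + 4 * a * (s₃ * s₂ * (2 * a) * s₀)
    v = ringℕ
    m : ∀ P y c₁ c₀ E → 12 * (3 * P) + y * (3 * c₁ * c₀ * E + 9 * P) ≡ 3 * (12 * P + y * (c₁ * c₀ * E + 3 * P))
    m = ringℕ
    n : ∀ P y c₁ c₃ → 3 * (6 * P * c₃ + y * (c₁ * P)) ≡ 6 * (3 * P) * c₃ + y * (3 * c₁ * P)
    n = ringℕ
    offset : ∀ e → 7 + 2 * (10 + e) ≡ e * 2 + 27
    offset = ringℕ
    go : ∀ e → (e + 16) * (e * e * e * 8 + e * e * 432 + e * 7552 + 43008) ≡
         18 * ((e * 2 + 34) * (e * 2 + 32) * (e * 2 + 28)) + (e * e * e * e * 8 + e * e * e * 416 + e * e * 7696 + e * 58144 + 139776)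
    go = ringℕ
    core : ∀ t s₀ s₂ s₃ → t ≡ e + 16 → s₀ ≡ e * 2 + 28 → s₂ ≡ e * 2 + 32 → s₃ ≡ e * 2 + 34 → t * R ≡ 18 * (s₃ * s₂ * s₀) + σ
    core _ _ _ _ refl refl refl refl = go e
    go′ : ∀ e → 2 * (e * 2 + 27) * ((e + 10) * (e + 10) * (e + 10) * 8 + (e + 10) * (e + 10) * 132 + (e + 10) * 712 + 1248) +
          9 * ((e * 2 + 34) * (e * 2 + 32) * (e * 2 + 28)) ≡
          e * e * e * 8 + e * e * 432 + e * 7552 + 43008 + 4 * (e + 15) * ((e * 2 + 34) * (e * 2 + 32) * (e * 2 + 28))
    go′ = ringℕ
    core′ : ∀ e′ a s₀ s₂ s₃ c₀ → e′ ≡ e + 10 → a ≡ e + 15 → s₀ ≡ e * 2 + 28 → s₂ ≡ e * 2 + 32 → s₃ ≡ e * 2 + 34 → c₀ ≡ e * 2 + 27 →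
            2 * c₀ * E e′ + 9 * (s₃ * s₂ * s₀) ≡ R + 4 * a * (s₃ * s₂ * s₀)
    core′ _ _ _ _ _ _ refl refl refl refl refl refl = go′ e

-- Three small cubical cases settled two even ranks further up

module CubicalExceptions where

  -- Since 11 c₂ < 84, only c₂ = 6 and c₂ = 7 remain. The first would need 18 c₃ = 168, which has
  -- its root strictly between 9 and 10; the second gives 7 c₃ = 168.
  solve-0 : ∀ c₂ c₃ → 6 ≤ c₂ → 168 + c₂ * c₃ * 11 ≡ 84 * c₃ → c₃ ≡ 24
  solve-0 c₂ c₃ c₂≥ eq with ≤⇒offset c₂≥
  ... | 0 , refl with 10 ≤? c₃
  ...   | yes c₃≥ with ≤⇒offset c₃≥
  ...     | j , refl = ⊥-elim (absurd-≡ _ (sym eq) (slack j))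
    where
    slack : ∀ j → 84 * (j + 10) ≡ 168 + 6 * (j + 10) * 11 + suc (j * 18 + 11)
    slack = ringℕ
  solve-0 c₂ c₃ c₂≥ eq | 0 , refl | no c₃≱ with ≤⇒offset (≤-pred (≰⇒> c₃≱))
  ...     | i , 9≡ = ⊥-elim (absurd-≡ _ (*-cancelʳ-≡ _ _ 6 (trans (+-cancelʳ-≡ (c₃ * 66) _ _ (trans (m c₃) (trans eq (n c₃)))) (o c₃))) (slack i c₃ 9≡))
    where
    m : ∀ c → 168 + c * 66 ≡ 168 + 6 * c * 11
    m = ringℕ
    n : ∀ c → 84 * c ≡ c * 18 + c * 66
    n = ringℕ
    o : ∀ c → c * 18 ≡ c * 3 * 6
    o = ringℕ
    slack : ∀ i c → 9 ≡ i + c → 28 ≡ c * 3 + suc (i * 3)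
    slack i c eq = trans (cong (λ x → suc (x * 3)) eq) (p i c)
      where
      p : ∀ i c → suc ((i + c) * 3) ≡ c * 3 + suc (i * 3)
      p = ringℕ
  solve-0 c₂ c₃ c₂≥ eq | 1 , refl = sym (*-cancelʳ-≡ 24 c₃ 7 (+-cancelʳ-≡ (c₃ * 77) _ _ (trans (l c₃) (trans eq (r c₃)))))
    where
    l : ∀ c → 24 * 7 + c * 77 ≡ 168 + 7 * c * 11
    l = ringℕ
    r : ∀ c → 84 * c ≡ c * 7 + c * 77
    r = ringℕ
  solve-0 c₂ c₃ c₂≥ eq | suc (suc i) , refl = ⊥-elim (absurd-≡ _ eq (slack i c₃))
    where
    slack : ∀ i c → 168 + (2 + i + 6) * c * 11 ≡ 84 * c + suc (i * c * 11 + c * 4 + 167)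
    slack = ringℕ

  solve-2 : ∀ c₂ c₃ → 8 ≤ c₂ → 216 + c₂ * c₃ * 13 ≡ 108 * c₃ → c₃ ≡ 54
  solve-2 c₂ c₃ c₂≥ eq with ≤⇒offset c₂≥
  ... | 0 , refl = sym (*-cancelʳ-≡ 54 c₃ 4 (+-cancelʳ-≡ (c₃ * 104) _ _ (trans (l c₃) (trans eq (r c₃)))))
    where
    l : ∀ c → 54 * 4 + c * 104 ≡ 216 + 8 * c * 13
    l = ringℕ
    r : ∀ c → 108 * c ≡ c * 4 + c * 104
    r = ringℕ
  ... | suc i , refl = ⊥-elim (absurd-≡ _ eq (slack i c₃))
    where
    slack : ∀ i c → 216 + (1 + i + 8) * c * 13 ≡ 108 * c + suc (i * c * 13 + c * 9 + 215)
    slack = ringℕ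

  solve-4 : ∀ c₂ c₃ → 10 ≤ c₂ → 22 + c₂ * c₃ * 1 ≡ 11 * c₃ → c₃ ≡ 22
  solve-4 c₂ c₃ c₂≥ eq with ≤⇒offset c₂≥
  ... | 0 , refl = sym (+-cancelʳ-≡ (c₃ * 10) _ _ (trans (l c₃) (trans eq (r c₃))))
    where
    l : ∀ c → 22 + c * 10 ≡ 22 + 10 * c * 1
    l = ringℕ
    r : ∀ c → 11 * c ≡ c + c * 10
    r = ringℕ
  ... | suc i , refl = ⊥-elim (absurd-≡ _ eq (slack i c₃))
    where
    slack : ∀ i c → 22 + (1 + i + 10) * c * 1 ≡ 11 * c + suc (i * c + 21)
    slack = ringℕ

  -- At c₃ = 24 everything shrinks to 220 w + 1320 c₅ = 2640, so that c₅ ≤ 2.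
  linear-0 : ∀ c₃ w c₅ → c₃ ≡ 24 → 3 ≤ c₅ → (c₃ * w * 20 + c₅ * 120) * 11 + w * 400 ≡ c₃ * w * 200 + (w * 60 + 240) * 11 → ⊥
  linear-0 _ w c₅ refl c₅≥ eq with ≤⇒offset c₅≥
  ... | j , refl = absurd-≡ _ eq (slack w j)
    where
    slack : ∀ w j → (24 * w * 20 + (j + 3) * 120) * 11 + w * 400 ≡ 24 * w * 200 + (w * 60 + 240) * 11 + suc (w * 220 + j * 1320 + 1319)
    slack = ringℕ

  linear-2 : ∀ c₃ w c₅ → c₃ ≡ 54 → 3 ≤ c₅ → (c₃ * w * 20 + c₅ * 120) * 143 + w * 5208 ≡ c₃ * w * 2604 + (w * 60 + 240) * 143 → ⊥
  linear-2 _ w c₅ refl c₅≥ eq with ≤⇒offset c₅≥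
  ... | j , refl = absurd-≡ _ eq (slack w j)
    where
    slack : ∀ w j → (54 * w * 20 + (j + 3) * 120) * 143 + w * 5208 ≡ 54 * w * 2604 + (w * 60 + 240) * 143 + suc (w * 10452 + j * 17160 + 17159)
    slack = ringℕ

  linear-4 : ∀ c₃ w c₅ → c₃ ≡ 22 → 3 ≤ c₅ → (c₃ * w * 20 + c₅ * 120) * 13 + w * 478 ≡ c₃ * w * 239 + (w * 60 + 240) * 13 → ⊥
  linear-4 _ w c₅ refl c₅≥ eq with ≤⇒offset c₅≥
  ... | j , refl = absurd-≡ _ eq (slack w j)
    where
    slack : ∀ w j → (22 * w * 20 + (j + 3) * 120) * 13 + w * 478 ≡ 22 * w * 239 + (w * 60 + 240) * 13 + suc (w * 160 + j * 1560 + 1559)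
    slack = ringℕ

  no-6 : ∀ c₂ c₃ c₄ c₅ → 6 ≤ c₂ → 3 ≤ c₅ → Deviation₃ 8 10 12 14 6 5 c₂ c₃ →
         Deviation₅ 8 10 12 14 16 18 6 5 c₂ c₃ c₄ c₅ → ⊥
  no-6 c₂ c₃ c₄ c₅ c₂≥ c₅≥ dev₃ dev₅ = linear-0 c₃ (c₄ * c₅) c₅
    -- 960 is a common factor of 12P = 161280, R = 10560 and 6P = 80640.
    (solve-0 c₂ c₃ c₂≥ (divide₃ 960 168 11 84 (14 * 12 * 10 * 8) 10560 c₂ c₃ refl refl refl reduced)) c₅≥
    (reduce₅ 11 200 9600 10560 8 10 12 14 16 18 6 5 c₂ c₃ c₄ c₅ refl refl reduced dev₅)
    where
    reduced : 12 * (14 * 12 * 10 * 8) + c₂ * c₃ * 10560 ≡ 6 * (14 * 12 * 10 * 8) * c₃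
    reduced = positive-part (14 * 12 * 10 * 8) {5 * 6 * 1248 + 3 * (14 * 12 * 10 * 8)} {5 * (14 * 12 * 10 * 8)} {10560} (c₂ * c₃) c₃ refl
      (reduce₃ 8 10 12 14 6 5 c₂ c₃ 1248 refl dev₃)

  no-10 : ∀ c₂ c₃ c₄ c₅ → 8 ≤ c₂ → 3 ≤ c₅ → Deviation₃ 12 14 16 18 10 7 c₂ c₃ →
          Deviation₅ 12 14 16 18 20 22 10 7 c₂ c₃ c₄ c₅ → ⊥
  no-10 c₂ c₃ c₄ c₅ c₂≥ c₅≥ dev₃ dev₅ = linear-2 c₃ (c₄ * c₅) c₅
    (solve-2 c₂ c₃ c₂≥ (divide₃ 2688 216 13 108 (18 * 16 * 14 * 12) 34944 c₂ c₃ refl refl refl reduced)) c₅≥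
    (reduce₅ 143 2604 190960 34944 12 14 16 18 20 22 10 7 c₂ c₃ c₄ c₅ refl refl reduced dev₅)
    where
    reduced : 12 * (18 * 16 * 14 * 12) + c₂ * c₃ * 34944 ≡ 6 * (18 * 16 * 14 * 12) * c₃
    reduced = positive-part (18 * 16 * 14 * 12) {7 * 10 * 3264 + 3 * (18 * 16 * 14 * 12)} {7 * (18 * 16 * 14 * 12)} {34944} (c₂ * c₃) c₃ refl
      (reduce₃ 12 14 16 18 10 7 c₂ c₃ 3264 refl dev₃)

  no-15 : ∀ c₂ c₃ c₄ c₅ → 10 ≤ c₂ → 3 ≤ c₅ → Deviation₃ 16 18 20 22 15 12 c₂ c₃ →
          Deviation₅ 16 18 20 22 24 26 15 12 c₂ c₃ c₄ c₅ → ⊥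
  no-15 c₂ c₃ c₄ c₅ c₂≥ c₅≥ dev₃ dev₅ = linear-4 c₃ (c₄ * c₅) c₅
    (solve-4 c₂ c₃ c₂≥ (divide₃ 69120 22 1 11 (22 * 20 * 18 * 16) 69120 c₂ c₃ refl refl refl reduced)) c₅≥
    (reduce₅ 13 239 24856 69120 16 18 20 22 24 26 15 12 c₂ c₃ c₄ c₅ refl refl reduced dev₅)
    where
    reduced : 12 * (22 * 20 * 18 * 16) + c₂ * c₃ * 69120 ≡ 6 * (22 * 20 * 18 * 16) * c₃
    reduced = positive-part (22 * 20 * 18 * 16) {12 * 15 * 6720 + 3 * (22 * 20 * 18 * 16)} {12 * (22 * 20 * 18 * 16)} {69120} (c₂ * c₃) c₃ refl
      (reduce₃ 16 18 20 22 15 12 c₂ c₃ 6720 refl dev₃)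

-- Exclusion of all deviations, model by model

module _ where

  private
    3≤ : ∀ {m n} → 3 + m ≤ n → 3 ≤ n
    3≤ = ≤-trans (s≤s (s≤s (s≤s z≤n)))

    BooleanDeviation₃ CubicalDeviation₃ : (e c₀ c₁ c₂ c₃ : ℕ) → Set
    BooleanDeviation₃ e = Deviation₃ (5 + e) (6 + e) (7 + e) (8 + e)
    CubicalDeviation₃ e = Deviation₃ (2 * (4 + e)) (2 * (5 + e)) (2 * (6 + e)) (2 * (7 + e))

    BooleanDeviation₅ CubicalDeviation₅ : (e c₀ c₁ c₂ c₃ c₄ c₅ : ℕ) → Set
    BooleanDeviation₅ e = Deviation₅ (5 + e) (6 + e) (7 + e) (8 + e) (9 + e) (10 + e)
    CubicalDeviation₅ e = Deviation₅ (2 * (4 + e)) (2 * (5 + e)) (2 * (6 + e)) (2 * (7 + e)) (2 * (8 + e)) (2 * (9 + e))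

    -- Writing e as `double k` leaves just two values below the range of the uniform estimate.
    boolean-deviant : ∀ k c₁ c₂ c₃ c₄ c₅ → let e = double k in
      c₁ ≡ 2 * (5 + e) → 7 + e ≤ c₃ → 8 + e ≤ c₄ →
      BooleanDeviation₃ e (6 + e) c₁ c₂ c₃ →
      BooleanDeviation₅ e (6 + e) c₁ c₂ c₃ c₄ c₅ → ⊥
    boolean-deviant 0 _ c₂ c₃ c₄ c₅ refl c₃≥ c₄≥ dev₃ dev₅ = BooleanArithmetic.no-6 c₂ c₃ c₄ c₅ c₄≥ dev₃ dev₅
    boolean-deviant 1 _ c₂ c₃ c₄ c₅ refl c₃≥ c₄≥ dev₃ dev₅ = BooleanArithmetic.no-8 c₂ c₃ c₄ c₅ c₃≥ c₄≥ dev₃ dev₅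
    boolean-deviant (suc (suc k)) _ c₂ c₃ c₄ c₅ refl c₃≥ c₄≥ dev₃ dev₅ =
      BooleanArithmetic.no-10+e (double k) c₂ c₃ (3≤ c₃≥) dev₃

  boolean-step : ∀ k c₀ c₁ c₂ c₃ c₄ c₅ → let e = double k in
    5 + e ≤ c₁ → 7 + e ≤ c₃ → 8 + e ≤ c₄ → Deviation₁ (5 + e) (6 + e) c₀ c₁ →
    BooleanDeviation₃ e c₀ c₁ c₂ c₃ →
    BooleanDeviation₅ e c₀ c₁ c₂ c₃ c₄ c₅ → c₀ ≡ 5 + e × c₁ ≡ 6 + e
  boolean-step k c₀ c₁ c₂ c₃ c₄ c₅ c₁≥ c₃≥ c₄≥ dev₁ dev₃ dev₅ =
    cases c₀ eq₁ dev₃ dev₅ (BooleanArithmetic.window e c₀ c₁ c₁≥ eq₁)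
    where
    e = double k
    eq₁ = reduce₁ (4 + e) (5 + e) c₀ c₁ dev₁
    cases : ∀ c₀ → (4 + e) * c₁ * c₀ + 2 * ((6 + e) * (5 + e)) ≡ (6 + e) * (5 + e) * c₁ →
            BooleanDeviation₃ e c₀ c₁ c₂ c₃ →
            BooleanDeviation₅ e c₀ c₁ c₂ c₃ c₄ c₅ →
            c₀ ≡ 5 + e ⊎ c₀ ≡ 6 + e ⊎ c₀ ≡ 7 + e → c₀ ≡ 5 + e × c₁ ≡ 6 + e
    cases _ eq₁ dev₃ dev₅ (inj₁ refl)        = refl , no-deviation₁ (4 + e) (5 + e) c₁ eq₁
    cases _ eq₁ dev₃ dev₅ (inj₂ (inj₁ refl)) = ⊥-elim (boolean-deviant k c₁ c₂ c₃ c₄ c₅ (BooleanArithmetic.c₁-6+e e c₁ eq₁) c₃≥ c₄≥ dev₃ dev₅)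
    cases _ eq₁ dev₃ dev₅ (inj₂ (inj₂ refl)) = ⊥-elim (BooleanArithmetic.no-7+e e c₁ c₂ c₃ (3≤ c₃≥) eq₁ dev₃)

  suspension-step : ∀ e c₀ c₁ c₂ c₃ A → 4 + e ≤ c₀ → 7 + e ≤ c₃ → c₀ * 2 ≡ A * (4 + e) → Deviation₁ (4 + e) (5 + e) c₀ c₁ →
    Deviation₃ (4 + e) (5 + e) (6 + e) (7 + e) c₀ c₁ c₂ c₃ → c₀ ≡ 4 + e × c₁ ≡ 5 + e
  suspension-step e c₀ c₁ c₂ c₃ A c₀≥ c₃≥ atoms dev₁ dev₃ = cases c₀ eq₁ atoms dev₃ (SuspensionArithmetic.window e c₀ c₁ c₀≥ eq₁)
    where
    eq₁ = reduce₁ (3 + e) (4 + e) c₀ c₁ dev₁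
    cases : ∀ c₀ → (3 + e) * c₁ * c₀ + 2 * ((5 + e) * (4 + e)) ≡ (5 + e) * (4 + e) * c₁ → c₀ * 2 ≡ A * (4 + e) →
            Deviation₃ (4 + e) (5 + e) (6 + e) (7 + e) c₀ c₁ c₂ c₃ →
            c₀ ≡ 4 + e ⊎ c₀ ≡ 5 + e ⊎ c₀ ≡ 6 + e → c₀ ≡ 4 + e × c₁ ≡ 5 + e
    cases _ eq₁ atoms dev₃ (inj₁ refl)        = refl , no-deviation₁ (3 + e) (4 + e) c₁ eq₁
    cases _ eq₁ atoms dev₃ (inj₂ (inj₁ refl)) = ⊥-elim (SuspensionArithmetic.no-5+e e A (trans (*-comm 2 (5 + e)) atoms))
    cases _ eq₁ atoms dev₃ (inj₂ (inj₂ refl)) = ⊥-elim (SuspensionArithmetic.no-6+e e c₁ c₂ c₃ (3≤ c₃≥) eq₁ dev₃)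

  private
    cubical-deviant-6 : ∀ k c₁ c₂ c₃ c₄ c₅ → let e = double k in
      c₁ ≡ 5 + e → 6 + e ≤ c₂ → 9 + e ≤ c₅ →
      CubicalDeviation₃ e (6 + 2 * e) c₁ c₂ c₃ →
      CubicalDeviation₅ e (6 + 2 * e) c₁ c₂ c₃ c₄ c₅ → ⊥
    cubical-deviant-6 0 _ c₂ c₃ c₄ c₅ refl c₂≥ c₅≥ dev₃ dev₅ =
      CubicalExceptions.no-6 c₂ c₃ c₄ c₅ c₂≥ (3≤ c₅≥) dev₃ dev₅
    cubical-deviant-6 1 _ c₂ c₃ c₄ c₅ refl c₂≥ c₅≥ dev₃ dev₅ =
      CubicalExceptions.no-10 c₂ c₃ c₄ c₅ c₂≥ (3≤ c₅≥) dev₃ dev₅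
    cubical-deviant-6 (suc (suc k)) _ c₂ c₃ c₄ c₅ refl c₂≥ c₅≥ dev₃ dev₅ =
      CubicalArithmetic.no-14+2e (double k) c₂ c₃ c₂≥ dev₃

    remainder-3 : ∀ {c n} → 3 * c ≡ n → n % 3 ≡ 0
    remainder-3 {c} refl = trans (cong (_% 3) (*-comm 3 c)) (m*n%n≡0 c 3)

    -- 3 must divide 5 + e, which for even e happens at 4, 10, 16 and so on. Only e = 4 needs the
    -- extra relation; from e = 10 on the bound on c₂ is strong enough.
    cubical-deviant-7 : ∀ k c₁ c₂ c₃ c₄ c₅ → let e = double k in
      3 * c₁ ≡ 4 * (5 + e) → 6 + e ≤ c₂ → 9 + e ≤ c₅ →
      CubicalDeviation₃ e (7 + 2 * e) c₁ c₂ c₃ →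
      CubicalDeviation₅ e (7 + 2 * e) c₁ c₂ c₃ c₄ c₅ → ⊥
    cubical-deviant-7 0 c₁ c₂ c₃ c₄ c₅ c₁≡ c₂≥ c₅≥ dev₃ dev₅ = 1+n≢0 (remainder-3 {c₁} c₁≡)
    cubical-deviant-7 1 c₁ c₂ c₃ c₄ c₅ c₁≡ c₂≥ c₅≥ dev₃ dev₅ = 1+n≢0 (remainder-3 {c₁} c₁≡)
    cubical-deviant-7 2 c₁ c₂ c₃ c₄ c₅ c₁≡ c₂≥ c₅≥ dev₃ dev₅ = twelve c₁ (*-cancelˡ-≡ c₁ 12 3 c₁≡) dev₃ dev₅
      where
      twelve : ∀ c₁ → c₁ ≡ 12 → Deviation₃ 16 18 20 22 15 c₁ c₂ c₃ → Deviation₅ 16 18 20 22 24 26 15 c₁ c₂ c₃ c₄ c₅ → ⊥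
      twelve _ refl dev₃ dev₅ = CubicalExceptions.no-15 c₂ c₃ c₄ c₅ c₂≥ (3≤ c₅≥) dev₃ dev₅
    cubical-deviant-7 3 c₁ c₂ c₃ c₄ c₅ c₁≡ c₂≥ c₅≥ dev₃ dev₅ = 1+n≢0 (remainder-3 {c₁} c₁≡)
    cubical-deviant-7 4 c₁ c₂ c₃ c₄ c₅ c₁≡ c₂≥ c₅≥ dev₃ dev₅ = 1+n≢0 (remainder-3 {c₁} c₁≡)
    cubical-deviant-7 (suc (suc (suc (suc (suc k))))) c₁ c₂ c₃ c₄ c₅ c₁≡ c₂≥ c₅≥ dev₃ dev₅ =
      CubicalArithmetic.no-27+2e (double k) c₁ c₂ c₃ c₁≡ c₂≥ dev₃

  cubical-step : ∀ k c₀ c₁ c₂ c₃ c₄ c₅ → let e = double k in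
    5 + e ≤ c₁ → 6 + e ≤ c₂ → 7 + e ≤ c₃ → 9 + e ≤ c₅ → Deviation₁ (2 * (4 + e)) (2 * (5 + e)) c₀ c₁ →
    CubicalDeviation₃ e c₀ c₁ c₂ c₃ →
    CubicalDeviation₅ e c₀ c₁ c₂ c₃ c₄ c₅ →
    c₀ ≡ 2 * (4 + e) × c₁ ≡ 2 * (5 + e)
  cubical-step k c₀ c₁ c₂ c₃ c₄ c₅ c₁≥ c₂≥ c₃≥ c₅≥ dev₁ dev₃ dev₅ =
    cases c₀ eq₁ dev₃ dev₅ (CubicalArithmetic.window e c₀ c₁ c₁≥ eq₁)
    where
    e = double k
    8+2e : ∀ e → 2 * (4 + e) ≡ 8 + 2 * e
    8+2e = ringℕ
    10+2e : ∀ e → 2 * (5 + e) ≡ 10 + 2 * e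
    10+2e = ringℕ
    eq₁ : (8 + 2 * e) * c₁ * c₀ + 2 * ((10 + 2 * e) * (2 * (4 + e))) ≡ (10 + 2 * e) * (2 * (4 + e)) * c₁
    eq₁ = reduce₁ (8 + 2 * e) (2 * (4 + e)) c₀ c₁ (subst (λ s → Deviation₁ (2 * (4 + e)) s c₀ c₁) (10+2e e) dev₁)
    cases : ∀ c₀ → (8 + 2 * e) * c₁ * c₀ + 2 * ((10 + 2 * e) * (2 * (4 + e))) ≡ (10 + 2 * e) * (2 * (4 + e)) * c₁ →
            CubicalDeviation₃ e c₀ c₁ c₂ c₃ →
            CubicalDeviation₅ e c₀ c₁ c₂ c₃ c₄ c₅ →
            c₀ ≡ 6 + 2 * e ⊎ c₀ ≡ 7 + 2 * e ⊎ c₀ ≡ 8 + 2 * e ⊎ c₀ ≡ 9 + 2 * e → c₀ ≡ 2 * (4 + e) × c₁ ≡ 2 * (5 + e)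
    cases _ eq₁ dev₃ dev₅ (inj₁ refl) =
      ⊥-elim (cubical-deviant-6 k c₁ c₂ c₃ c₄ c₅ (CubicalArithmetic.c₁-6+2e e c₁ eq₁) c₂≥ c₅≥ dev₃ dev₅)
    cases _ eq₁ dev₃ dev₅ (inj₂ (inj₁ refl)) =
      ⊥-elim (cubical-deviant-7 k c₁ c₂ c₃ c₄ c₅ (CubicalArithmetic.c₁-7+2e e c₁ eq₁) c₂≥ c₅≥ dev₃ dev₅)
    cases _ eq₁ dev₃ dev₅ (inj₂ (inj₂ (inj₁ refl))) =
      sym (8+2e e) , trans (no-deviation₁ (8 + 2 * e) (2 * (4 + e)) c₁
        (subst (λ c → (8 + 2 * e) * c₁ * c + 2 * ((10 + 2 * e) * (2 * (4 + e))) ≡ (10 + 2 * e) * (2 * (4 + e)) * c₁) (sym (8+2e e)) eq₁)) (sym (10+2e e))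
    cases _ eq₁ dev₃ dev₅ (inj₂ (inj₂ (inj₂ refl))) = ⊥-elim (CubicalArithmetic.no-9+2e e c₂ c₃ (3≤ c₃≥)
      (subst (λ c → CubicalDeviation₃ e (9 + 2 * e) c c₂ c₃) (CubicalArithmetic.c₁-9+2e e c₁ eq₁) dev₃))

-- Classification of the factorial functions

record ShefferNumbers (d : ℕ → ℕ) : Set where
  field
    system  : EulerSystem d
    d-0     : d 0 ≡ 1
    c-lower : ∀ n → suc n ≤ EulerSystem.c system n
    atoms   : ∀ n → ∃ λ A → d n ≡ A * n !

module Classification {d : ℕ → ℕ} (S : ShefferNumbers d) where
  open ShefferNumbers S
  open EulerSystem system using (c; d-suc; euler₁; euler₃; euler₅)

  private
    AgreeBelow : (ℕ → ℕ) → ℕ → Set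
    AgreeBelow d′ n = ∀ k → k < n → d k ≡ d′ k

    extend : ∀ {d′ n} → AgreeBelow d′ n → d n ≡ d′ n → AgreeBelow d′ (suc n)
    extend agree eq k k<1+n with m<1+n⇒m<n∨m≡n k<1+n
    ... | inj₁ k<n  = agree k k<n
    ... | inj₂ refl = eq

    -- The induction advances two ranks at a time, because c₀ and c₁ are only determined jointly.
    -- The base has to reach D(4), where the three sequences have separated.
    propagate : ∀ {d′} (T : EulerSystem d′) → AgreeBelow d′ 4 →
                (∀ k → AgreeBelow d′ (double (2 + k)) → c (3 + double k) ≡ EulerSystem.c T (3 + double k) ×
                                                        c (4 + double k) ≡ EulerSystem.c T (4 + double k)) →
                ∀ n → d n ≡ d′ n
    propagate {d′} T base step n = below n n (m≤double n)
      where
      module T = EulerSystem T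
      m≤double : ∀ n → n < double (2 + n)
      m≤double zero    = s≤s z≤n
      m≤double (suc n) = s≤s (≤-trans (m≤double n) (n≤1+n _))
      next : ∀ {n} → c n ≡ T.c n → d n ≡ d′ n → d (suc n) ≡ d′ (suc n)
      next {n} ceq deq = trans (d-suc n) (trans (cong₂ _*_ ceq deq) (sym (T.d-suc n)))
      below : ∀ k → AgreeBelow d′ (double (2 + k))
      below zero    = base
      below (suc k) with below k
      ... | agree with step k agree
      ...   | c₀≡ , c₁≡ = extend agree′ (next c₁≡ (agree′ (4 + double k) ≤-refl))
        where
        agree′ : AgreeBelow d′ (5 + double k)
        agree′ = extend agree (next c₀≡ (agree (3 + double k) ≤-refl))

    lower : ∀ {m} n → m ≤ suc n → m ≤ c n
    lower n m≤ = ≤-trans m≤ (c-lower n)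

    boolean-case : AgreeBelow d-boolean 4 → ∀ n → d n ≡ d-boolean n
    boolean-case base = propagate booleanSystem base λ k agree →
      let open Deviation system booleanSystem (suc k) agree
          e = double k
      in boolean-step k c₀ c₁ c₂ c₃ c₄ c₅ (lower (4 + e) ≤-refl) (lower (6 + e) ≤-refl) (lower (7 + e) ≤-refl)
           deviation₁ deviation₃ deviation₅

    cubical-case : AgreeBelow d-cubical 4 → ∀ n → d n ≡ d-cubical n
    cubical-case base = propagate cubicalSystem base λ k agree →
      let open Deviation system cubicalSystem (suc k) agree
          e = double k
      in cubical-step k c₀ c₁ c₂ c₃ c₄ c₅ (lower (4 + e) ≤-refl) (lower (5 + e) ≤-refl) (lower (6 + e) ≤-refl)
           (lower (8 + e) ≤-refl) deviation₁ deviation₃ deviation₅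

    suspension-case : AgreeBelow d-suspension 4 → ∀ n → d n ≡ d-suspension n
    suspension-case base = propagate suspensionSystem base λ k agree →
      let open Deviation system suspensionSystem (suc k) agree
          e = double k
          A , d≡ = atoms (4 + e)
      in suspension-step e c₀ c₁ c₂ c₃ A (lower (3 + e) ≤-refl) (lower (6 + e) ≤-refl)
           -- d (4 + e) equals both c₀ · 2 (3 + e)! and A · (4 + e)!; cancelling (3 + e)! gives 2 c₀
           -- = A (4 + e).
           (*-cancelʳ-≡ (c₀ * 2) (A * (4 + e)) ((3 + e) !) {{(3 + e) !≢0}}
             (trans (*-assoc c₀ 2 ((3 + e) !)) (trans (cong (c₀ *_) (sym (agree (3 + e) ≤-refl)))
               (trans (sym (d-suc (3 + e))) (trans d≡ (sym (*-assoc A (4 + e) ((3 + e) !))))))))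
           deviation₁ deviation₃

    -- Numerically, a rank 4 interval is a map on the sphere with s faces, all r-gons, three at each
    -- vertex, and Euler's formula reads s (6 - r) = 12. The solutions have the numbers of a map
    -- with three digons, the tetrahedron, the cube and the dodecahedron.
    relation₃ : ∀ r s → r * s + 12 ≡ 6 * s → 2 ≤ r → (r ≡ 2 × s ≡ 3) ⊎ (r ≡ 3 × s ≡ 4) ⊎ (r ≡ 4 × s ≡ 6) ⊎ (r ≡ 5 × s ≡ 12)
    relation₃ r s eq r≥ with ≤⇒offset r≥
    ... | 0 , refl = inj₁ (refl , *-cancelˡ-≡ s 3 4 (+-cancelˡ-≡ (2 * s) (4 * s) 12 (trans (split s) (sym eq))))
      where
      split : ∀ s → 2 * s + 4 * s ≡ 6 * s
      split = ringℕ
    ... | 1 , refl = inj₂ (inj₁ (refl , *-cancelˡ-≡ s 4 3 (+-cancelˡ-≡ (3 * s) (3 * s) 12 (trans (split s) (sym eq)))))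
      where
      split : ∀ s → 3 * s + 3 * s ≡ 6 * s
      split = ringℕ
    ... | 2 , refl = inj₂ (inj₂ (inj₁ (refl , *-cancelˡ-≡ s 6 2 (+-cancelˡ-≡ (4 * s) (2 * s) 12 (trans (split s) (sym eq))))))
      where
      split : ∀ s → 4 * s + 2 * s ≡ 6 * s
      split = ringℕ
    ... | 3 , refl = inj₂ (inj₂ (inj₂ (refl , +-cancelˡ-≡ (5 * s) s 12 (trans (split s) (sym eq)))))
      where
      split : ∀ s → 5 * s + s ≡ 6 * s
      split = ringℕ
    ... | suc (suc (suc (suc i))) , refl = ⊥-elim (absurd-≡ _ eq (slack i s))
      where
      slack : ∀ i s → (4 + i + 2) * s + 12 ≡ 6 * s + suc (i * s + 11)
      slack = ringℕ

    c-0 : c 0 ≡ 2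
    c-0 = euler₁ 0

    c-1-2 : c 1 * c 2 + 12 ≡ 6 * c 2
    c-1-2 = core (c 0) (c 1) (c 2) c-0 (euler₃ 0)
      where
      core : ∀ x y z → x ≡ 2 → x * y * z + 6 * z ≡ 3 * y * z + 12 → y * z + 12 ≡ 6 * z
      core _ y z refl eq = sym (+-cancelˡ-≡ (2 * y * z) (6 * z) (y * z + 12) (trans eq (split y z)))
        where
        split : ∀ y z → 3 * y * z + 12 ≡ 2 * y * z + (y * z + 12)
        split = ringℕ

    -- The pentagonal case D 3 = 10, D 4 = 120 forces D 6 = 2 D 5.
    no-dodecahedron : c 1 ≡ 5 → c 2 ≡ 12 → ⊥
    no-dodecahedron c₁≡ c₂≡ = core (c 0) (c 1) (c 2) (c 3) (c 4) c-0 c₁≡ c₂≡ (c-lower 4) (euler₅ 0)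
      where
      core : ∀ x y z u v → x ≡ 2 → y ≡ 5 → z ≡ 12 → 5 ≤ v →
             x * y * z * u * v + 20 * z * u * v + 120 * v ≡ 5 * y * z * u * v + 60 * u * v + 240 → ⊥
      core _ _ _ u v refl refl refl v≥ eq with ≤⇒offset v≥
      ... | j , refl = absurd-≡ _ eq (slack u j)
        where
        slack : ∀ u j → 2 * 5 * 12 * u * (j + 5) + 20 * 12 * u * (j + 5) + 120 * (j + 5) ≡
                        5 * 5 * 12 * u * (j + 5) + 60 * u * (j + 5) + 240 + suc (j * 120 + 359)
        slack = ringℕ

    base : ∀ d′ → d′ 0 ≡ 1 → d′ 1 ≡ 2 → c 1 * 2 ≡ d′ 2 → c 2 * (c 1 * 2) ≡ d′ 3 → AgreeBelow d′ 4
    base d′ e₀ e₁ e₂ e₃ = cases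
      where
      d-1 : d 1 ≡ 2
      d-1 = trans (d-suc 0) (cong₂ _*_ c-0 d-0)
      d-2 : d 2 ≡ c 1 * 2
      d-2 = trans (d-suc 1) (cong (c 1 *_) d-1)
      cases : AgreeBelow d′ 4
      cases 0 _ = trans d-0 (sym e₀)
      cases 1 _ = trans d-1 (sym e₁)
      cases 2 _ = trans d-2 e₂
      cases 3 _ = trans (trans (d-suc 2) (cong (c 2 *_) d-2)) e₃
      cases (suc (suc (suc (suc _)))) (s≤s (s≤s (s≤s (s≤s ()))))

  classification : (∀ n → d n ≡ d-suspension n) ⊎ (∀ n → d n ≡ d-boolean n) ⊎ (∀ n → d n ≡ d-cubical n)
  classification with relation₃ (c 1) (c 2) c-1-2 (c-lower 1)
  ... | inj₁ (c₁≡ , c₂≡) = inj₁ (suspension-case (base d-suspension refl refl (cong (_* 2) c₁≡) (cong₂ (λ x y → x * (y * 2)) c₂≡ c₁≡)))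
  ... | inj₂ (inj₁ (c₁≡ , c₂≡)) = inj₂ (inj₁ (boolean-case (base d-boolean refl refl (cong (_* 2) c₁≡) (cong₂ (λ x y → x * (y * 2)) c₂≡ c₁≡))))
  ... | inj₂ (inj₂ (inj₁ (c₁≡ , c₂≡))) = inj₂ (inj₂ (cubical-case (base d-cubical refl refl (cong (_* 2) c₁≡) (cong₂ (λ x y → x * (y * 2)) c₂≡ c₁≡))))
  ... | inj₂ (inj₂ (inj₂ (c₁≡ , c₂≡))) = ⊥-elim (no-dodecahedron c₁≡ c₂≡)

-- Maximal chains of graded posets

length-⊆ : {A : Set} {xs ys : List A} → Unique xs → (∀ {z} → z ∈ xs → z ∈ ys) → length xs ≤ length ys
length-⊆ {xs = []}     u sub = z≤n
length-⊆ {xs = x ∷ xs} (x∉ ∷ u) sub with ∈-∃++ (sub (here refl))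
... | us , vs , refl = ≤-trans (s≤s (length-⊆ u sub′)) (≤-reflexive (begin
  suc (length (us ++ vs))        ≡⟨ cong suc (length-++ us) ⟩
  suc (length us + length vs)    ≡⟨ +-suc (length us) (length vs) ⟨
  length us + suc (length vs)    ≡⟨ length-++ us ⟨
  length (us ++ x ∷ vs)          ∎))
  where
  open ≡-Reasoning
  sub′ : ∀ {z} → z ∈ xs → z ∈ us ++ vs
  sub′ z∈ with ∈-++⁻ us (sub (there z∈))
  ... | inj₁ z∈us         = ∈-++⁺ˡ z∈us
  ... | inj₂ (here refl)  = contradiction refl (All.lookup x∉ z∈)
  ... | inj₂ (there z∈vs) = ∈-++⁺ʳ us z∈vs

same-length : {A : Set} {xs ys : List A} → Unique xs → Unique ys →
              (∀ {z} → z ∈ xs → z ∈ ys) → (∀ {z} → z ∈ ys → z ∈ xs) → length xs ≡ length ys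
same-length ux uy sub sup = ≤-antisym (length-⊆ ux sub) (length-⊆ uy sup)

length-concatMap-filter : {A B : Set} {R : A → Set} (R? : ∀ z → Dec (R z)) (f : A → List B) (xs : List A) →
                          length (concatMap f (filter R? xs)) ≡ ∑ xs (λ z → R? z ▹ length (f z))
length-concatMap-filter R? f []       = refl
length-concatMap-filter R? f (x ∷ xs) with R? x
... | no  _ = length-concatMap-filter R? f xs
... | yes _ = trans (length-++ (f x)) (cong (length (f x) +_) (length-concatMap-filter R? f xs))

minimal-element : {A : Set} (_≺_ : Rel A 0ℓ) → (∀ {a b c} → a ≺ b → b ≺ c → a ≺ c) → (∀ {a} → ¬ a ≺ a) → (∀ a b → Dec (a ≺ b)) →
                  ∀ x xs → ∃ λ m → m ∈ x ∷ xs × (∀ {w} → w ∈ x ∷ xs → ¬ w ≺ m)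
minimal-element _≺_ ≺-trans ≺-irrefl _≺?_ x [] = x , here refl , λ { (here refl) → ≺-irrefl }
minimal-element _≺_ ≺-trans ≺-irrefl _≺?_ x (y ∷ ys) with minimal-element _≺_ ≺-trans ≺-irrefl _≺?_ y ys
... | m , m∈ , min with x ≺? m
...   | yes x≺m = x , here refl , λ { (here refl) → ≺-irrefl ; (there w∈) w≺x → min w∈ (≺-trans w≺x x≺m) }
...   | no  x⊀m = m , there m∈ , λ { (here refl) → x⊀m ; (there w∈) → min w∈ }

module GradedPosetTheory (P : GradedPoset) where
  open GradedPoset P public using (Carrier; isPartialOrder; 𝟘; 𝟘-min; interval; interval-unique; interval-complete; ρ; ρ-𝟘; ρ-⋖; chain; chain-strict)
    renaming (_≤_ to _⊑_; _<_ to _⊏_; _⋖_ to _⋖_)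
  open IsPartialOrder isPartialOrder public using ()
    renaming (refl to ⊑-refl; trans to ⊑-trans; antisym to ⊑-antisym)

  interval⁺ : ∀ {x y z} → x ⊑ z → z ⊑ y → z ∈ interval x y
  interval⁺ x⊑z z⊑y = Equivalence.from (interval-complete _ _ _) (x⊑z , z⊑y)

  interval⁻ : ∀ {x y z} → z ∈ interval x y → x ⊑ z × z ⊑ y
  interval⁻ = Equivalence.to (interval-complete _ _ _)

  -- The finite interval lists decide the order: a nonempty `interval x y` yields x ≤ y by
  -- transitivity, and if x ≤ y then it contains x.
  _⊑?_ : ∀ x y → Dec (x ⊑ y)
  x ⊑? y with interval x y in eq
  ... | []    = no λ x⊑y → ¬∈[] (subst (x ∈_) eq (interval⁺ ⊑-refl x⊑y))
    where
    ¬∈[] : {z : Carrier} → ¬ z ∈ []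
    ¬∈[] ()
  ... | z ∷ _ with interval⁻ (subst (z ∈_) (sym eq) (here refl))
  ...   | x⊑z , z⊑y = yes (⊑-trans x⊑z z⊑y)

  _≟ᶜ_ : (x y : Carrier) → Dec (x ≡ y)
  x ≟ᶜ y = map′ (λ (p , q) → ⊑-antisym p q) (λ { refl → ⊑-refl , ⊑-refl }) ((x ⊑? y) ×-dec (y ⊑? x))

  ⊏-trans : ∀ {x y z} → x ⊏ y → y ⊏ z → x ⊏ z
  ⊏-trans (x⊑y , x≢y) (y⊑z , _) = ⊑-trans x⊑y y⊑z , λ { refl → x≢y (⊑-antisym x⊑y y⊑z) }

  _⊏?_ : ∀ x y → Dec (x ⊏ y)
  x ⊏? y = (x ⊑? y) ×-dec ¬? (x ≟ᶜ y)

  cover-above : ∀ {x y} → x ⊑ y → x ≢ y → ∃ λ z → x ⊑ z × ρ z ≡ suc (ρ x) × z ⊑ y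
  cover-above {x} {y} x⊑y x≢y with filter (x ⊏?_) (interval x y) in eq
  ... | [] = contradiction (subst (y ∈_) eq (∈-filter⁺ (x ⊏?_) (interval⁺ x⊑y ⊑-refl) (x⊑y , x≢y))) λ ()
  ... | z ∷ zs with minimal-element _⊏_ ⊏-trans (λ (_ , a≢a) → a≢a refl) _⊏?_ z zs
  ...   | m , m∈ , min with ∈-filter⁻ (x ⊏?_) {xs = interval x y} (subst (m ∈_) (sym eq) m∈)
  ...     | m∈I , x⊏m = m , proj₁ x⊏m , ρ-⋖ x m (x⊏m , nothing-between) , proj₂ (interval⁻ m∈I)
    where
    nothing-between : ∀ w → ¬ (x ⊏ w × w ⊏ m)
    nothing-between w (x⊏w , w⊏m) = min
      (subst (w ∈_) eq (∈-filter⁺ (x ⊏?_) (interval⁺ (proj₁ x⊏w) (⊑-trans (proj₁ w⊏m) (proj₂ (interval⁻ m∈I)))) x⊏w)) w⊏m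

  cover-below : ∀ {x y} → x ⊑ y → x ≢ y → ∃ λ z → x ⊑ z × z ⊑ y × ρ y ≡ suc (ρ z)
  cover-below {x} {y} x⊑y x≢y with filter (_⊏? y) (interval x y) in eq
  ... | [] = contradiction (subst (x ∈_) eq (∈-filter⁺ (_⊏? y) (interval⁺ ⊑-refl x⊑y) (x⊑y , x≢y))) λ ()
  ... | z ∷ zs with minimal-element (λ a b → b ⊏ a) (λ p q → ⊏-trans q p) (λ (_ , a≢a) → a≢a refl) (λ a b → b ⊏? a) z zs
  ...   | m , m∈ , max with ∈-filter⁻ (_⊏? y) {xs = interval x y} (subst (m ∈_) (sym eq) m∈)
  ...     | m∈I , m⊏y = m , proj₁ (interval⁻ m∈I) , proj₁ m⊏y , ρ-⋖ m y (m⊏y , nothing-between)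
    where
    nothing-between : ∀ w → ¬ (m ⊏ w × w ⊏ y)
    nothing-between w (m⊏w , w⊏y) = max
      (subst (w ∈_) eq (∈-filter⁺ (_⊏? y) (interval⁺ (⊑-trans (proj₁ (interval⁻ m∈I)) (proj₁ m⊏w)) (proj₁ w⊏y)) w⊏y)) m⊏w

  -- `ρ-⋖` speaks of covers only. Descending from y through covers stays above x and must end there,
  -- since the rank drops each time.
  ρ-strict : ∀ {x y} → x ⊑ y → x ≢ y → ρ x < ρ y
  ρ-strict x⊑y x≢y = below _ refl x⊑y x≢y
    where
    below : ∀ n {x y} → ρ y ≡ n → x ⊑ y → x ≢ y → ρ x < ρ y
    below n {x} {y} ρy x⊑y x≢y with cover-below x⊑y x≢y
    below zero    ρy x⊑y x≢y | z , x⊑z , z⊑y , ρ≡ = contradiction (trans (sym ρ≡) ρy) 1+n≢0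
    below (suc n) {x} ρy x⊑y x≢y | z , x⊑z , z⊑y , ρ≡ with x ≟ᶜ z
    ... | yes refl = ≤-reflexive (sym ρ≡)
    ... | no  x≢z  = <-trans (below n (suc-injective (trans (sym ρ≡) ρy)) x⊑z x≢z) (≤-reflexive (sym ρ≡))

  ρ-eq : ∀ {x y} → x ⊑ y → ρ y ≤ ρ x → x ≡ y
  ρ-eq {x} {y} x⊑y ge with x ≟ᶜ y
  ... | yes x≡y = x≡y
  ... | no  x≢y = contradiction (ρ-strict x⊑y x≢y) (≤⇒≯ ge)

  -- The infinite chain enters here: its n-th element has rank at least n, and stepping down through
  -- coatoms reaches rank n exactly. Thus each value D(n) with n ≥ 1 is realised by an interval.
  of-rank : ∀ n → ∃ λ y → ρ y ≡ n
  of-rank n = descend (ρ (chain n) ∸ n) (chain n) (sym (m∸n+n≡m (chain-rank n)))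
    where
    chain-rank : ∀ n → n ≤ ρ (chain n)
    chain-rank zero    = z≤n
    chain-rank (suc n) = ≤-<-trans (chain-rank n) (ρ-strict (proj₁ (chain-strict n)) (proj₂ (chain-strict n)))
    descend : ∀ j y → ρ y ≡ j + n → ∃ λ z → ρ z ≡ n
    descend zero    y ρy = y , ρy
    descend (suc j) y ρy with cover-below (𝟘-min y) (λ { refl → contradiction (trans (sym ρy) ρ-𝟘) 1+n≢0 })
    ... | z , _ , _ , ρ≡ = descend j z (suc-injective (trans (sym ρ≡) ρy))

  _◃_ : Rel Carrier 0ℓ
  x ◃ y = x ⊑ y × ρ y ≡ suc (ρ x)

  up? : ∀ x y z → Dec (x ◃ z × z ⊑ y)
  up? x y z = ((x ⊑? z) ×-dec (ρ z ≟ suc (ρ x))) ×-dec (z ⊑? y)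

  module MaximalChains (t : Carrier) where

    covers : Carrier → Carrier → List Carrier
    covers x y = filter (up? x y) (interval 𝟘 t)

    -- An explicit enumeration of saturated chains, the link between the maximal lists of
    -- `IsMaxChain` and a recursion over covers. All covers are sought in the one list
    -- `interval 𝟘 t`.
    chainLists : ℕ → Carrier → Carrier → List (List Carrier)
    chainLists zero    x y = (x ∷ []) ∷ []
    chainLists (suc k) x y = concatMap (λ z → map (x ∷_) (chainLists k z y)) (covers x y)

    chainCount : ℕ → Carrier → Carrier → ℕ
    chainCount zero    x y = 1
    chainCount (suc k) x y = ∑ (interval 𝟘 t) (λ z → up? x y z ▹ chainCount k z y)

    length-chainLists : ∀ k x y → length (chainLists k x y) ≡ chainCount k x y
    length-chainLists zero    x y = refl
    length-chainLists (suc k) x y = trans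
      (length-concatMap-filter (up? x y) (λ z → map (x ∷_) (chainLists k z y)) (interval 𝟘 t))
      (∑-cong (interval 𝟘 t) (λ {z} _ → ▹-congʳ (up? x y z) (λ _ → trans (length-map (x ∷_) (chainLists k z y)) (length-chainLists k z y))))

    concat⁻ : ∀ k x y zs {l} → l ∈ concatMap (λ z → map (x ∷_) (chainLists k z y)) zs →
              ∃ λ z → ∃ λ l′ → z ∈ zs × l′ ∈ chainLists k z y × l ≡ x ∷ l′
    concat⁻ k x y (z ∷ zs) l∈ with ∈-++⁻ (map (x ∷_) (chainLists k z y)) l∈
    ... | inj₁ l∈z with ∈-map⁻ (x ∷_) l∈z
    ...   | l′ , l′∈ , refl = z , l′ , here refl , l′∈ , refl
    concat⁻ k x y (z ∷ zs) l∈ | inj₂ l∈zs with concat⁻ k x y zs l∈zs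
    ... | z′ , l′ , z′∈ , l′∈ , eq = z′ , l′ , there z′∈ , l′∈ , eq

    concat⁺ : ∀ k x y zs {z l} → z ∈ zs → l ∈ chainLists k z y → x ∷ l ∈ concatMap (λ z → map (x ∷_) (chainLists k z y)) zs
    concat⁺ k x y (z ∷ zs) (here refl) l∈ = ∈-++⁺ˡ (∈-map⁺ (x ∷_) l∈)
    concat⁺ k x y (z ∷ zs) (there z∈)  l∈ = ∈-++⁺ʳ (map (x ∷_) (chainLists k z y)) (concat⁺ k x y zs z∈ l∈)

    starts : ∀ k {x y l} → l ∈ chainLists k x y → ∃ λ l′ → l ≡ x ∷ l′
    starts zero    (here refl) = [] , refl
    starts (suc k) {x} {y} l∈ with concat⁻ k x y (covers x y) l∈
    ... | _ , l′ , _ , _ , eq = l′ , eq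

    chainLists-unique : ∀ k x y → Unique (chainLists k x y)
    chainLists-unique zero    x y = [] ∷ []
    chainLists-unique (suc k) x y = go (Unique.filter⁺ (up? x y) (interval-unique 𝟘 t))
      where
      go : ∀ {zs} → Unique zs → Unique (concatMap (λ z → map (x ∷_) (chainLists k z y)) zs)
      go []        = []
      go {z ∷ zs} (z∉ ∷ u) = Unique.++⁺ (Unique.map⁺ (λ { refl → refl }) (chainLists-unique k z y)) (go u) disjoint
        where
        disjoint : ∀ {l} → ¬ (l ∈ map (x ∷_) (chainLists k z y) × l ∈ concatMap (λ z → map (x ∷_) (chainLists k z y)) zs)
        disjoint (p , q) with ∈-map⁻ (x ∷_) p | concat⁻ k x y zs q
        ... | l′ , l′∈ , refl | z′ , _ , z′∈ , l″∈ , refl with starts k l′∈ | starts k l″∈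
        ...   | _ , refl | _ , refl = All.lookup z∉ z′∈ refl

    sound : ∀ k {x y l} → x ⊑ y → ρ y ≡ k + ρ x → l ∈ chainLists k x y → IsMaxChain P x y l
    sound zero {x} {y} x⊑y ρy (here refl) with ρ-eq x⊑y (≤-reflexive ρy)
    ... | refl = [-] , (⊑-refl , ⊑-refl) ∷ [] , λ w x⊑w w⊑x _ → here (⊑-antisym w⊑x x⊑w)
    sound (suc k) {x} {y} x⊑y ρy l∈ with concat⁻ k x y (covers x y) l∈
    ... | z , l′ , z∈ , l′∈ , refl with ∈-filter⁻ (up? x y) {xs = interval 𝟘 t} z∈
    ...   | _ , (x⊑z , ρz) , z⊑y with sound k z⊑y (trans ρy (trans (sym (+-suc k (ρ x))) (cong (k +_) (sym ρz)))) l′∈ | starts k l′∈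
    ...     | linked , within , maximal | l″ , refl =
      ((x⊑z , λ { refl → 1+n≢n (sym ρz) }) ∷ linked) ,
      ((⊑-refl , x⊑y) ∷ All.map (λ (z⊑u , u⊑y) → ⊑-trans x⊑z z⊑u , u⊑y) within) ,
      maximal′
      where
      maximal′ : ∀ w → x ⊑ w → w ⊑ y → All (λ u → u ⊑ w ⊎ w ⊑ u) (x ∷ z ∷ l″) → w ∈ x ∷ z ∷ l″
      maximal′ w x⊑w w⊑y (_ ∷ comparable) with x ≟ᶜ w | comparable
      ... | yes refl | _ = here refl
      ... | no  x≢w  | inj₁ z⊑w ∷ _ = there (maximal w z⊑w w⊑y comparable)
      ... | no  x≢w  | inj₂ w⊑z ∷ _ = there (here (ρ-eq w⊑z (≤-trans (≤-reflexive ρz) (ρ-strict x⊑w x≢w))))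

    -- Maximality forces saturation. The element x is comparable with all entries, hence is an
    -- entry, and so is the head. A cover m of x below the second entry b is likewise comparable
    -- with all entries, so it occurs in the list and equals b.
    complete : ∀ k {x y l} → x ⊑ y → y ⊑ t → ρ y ≡ k + ρ x → IsMaxChain P x y l → l ∈ chainLists k x y
    complete k {x} {l = []} x⊑y y⊑t ρy (_ , _ , maximal) with maximal x ⊑-refl x⊑y []
    ... | ()
    complete k {x} {y} {a ∷ l} x⊑y y⊑t ρy (linked , ((x⊑a , a⊑y) ∷ within) , maximal) = rest k l ρy linked within maximal
      where
      sorted : ∀ {a l} → Linked _⊏_ (a ∷ l) → All (a ⊏_) l
      sorted linked with Linked⇒AllPairs ⊏-trans linked
      ... | a⊏ ∷ _ = a⊏

      x≡a : x ≡ a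
      x≡a with maximal x ⊑-refl x⊑y (inj₂ x⊑a ∷ All.map (λ (x⊑u , _) → inj₂ x⊑u) within)
      ... | here eq  = eq
      ... | there x∈ = contradiction (⊑-antisym x⊑a (proj₁ a⊏x)) (λ { refl → proj₂ a⊏x refl })
        where
        a⊏x : a ⊏ x
        a⊏x = All.lookup (sorted linked) x∈

      rest : ∀ k l → ρ y ≡ k + ρ x → Linked _⊏_ (a ∷ l) → All (λ u → x ⊑ u × u ⊑ y) l →
             (∀ w → x ⊑ w → w ⊑ y → All (λ u → u ⊑ w ⊎ w ⊑ u) (a ∷ l) → w ∈ a ∷ l) → a ∷ l ∈ chainLists k x y
      rest zero [] ρy linked within maximal = here (cong (_∷ []) (sym x≡a))
      rest zero (b ∷ l) ρy linked ((x⊑b , b⊑y) ∷ _) maximal with sorted linked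
      ... | (a⊑b , a≢b) ∷ _ = contradiction (trans (sym x≡a) (trans (ρ-eq x⊑y (≤-reflexive ρy)) (sym (ρ-eq b⊑y ρy≤ρb)))) a≢b
        where
        ρy≤ρb : ρ y ≤ ρ b
        ρy≤ρb = ≤-trans (≤-reflexive ρy) (<⇒≤ (≤-<-trans (≤-reflexive (cong ρ x≡a)) (ρ-strict a⊑b a≢b)))
      rest (suc k) [] ρy linked within maximal with maximal y x⊑y ⊑-refl (inj₁ a⊑y ∷ [])
      ... | here refl = contradiction (trans (sym ρy) (cong ρ (sym x≡a))) (m≢1+n+m (ρ x) ∘ sym)
      rest (suc k) (b ∷ l) ρy linked@(a⊏b ∷ linked′) ((x⊑b , b⊑y) ∷ within) maximal
        with cover-above x⊑b (λ x≡b → proj₂ a⊏b (trans (sym x≡a) x≡b))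
      ... | m , x⊑m , ρm , m⊑b with maximal m x⊑m (⊑-trans m⊑b b⊑y)
                (inj₁ (subst (_⊑ m) x≡a x⊑m) ∷ inj₂ m⊑b ∷ All.map (λ b⊏u → inj₂ (⊑-trans m⊑b (proj₁ b⊏u))) (sorted linked′))
      ...   | here m≡a = contradiction (trans (sym ρm) (cong ρ (trans m≡a (sym x≡a)))) 1+n≢n
      ...   | there m∈ = subst (λ c → c ∷ b ∷ l ∈ chainLists (suc k) x y) x≡a
        (concat⁺ k x y (covers x y) (∈-filter⁺ (up? x y) (interval⁺ (𝟘-min b) (⊑-trans b⊑y y⊑t)) ((x⊑b , ρb) , b⊑y))
          (complete k b⊑y y⊑t (trans ρy (trans (sym (+-suc k (ρ x))) (cong (k +_) (sym ρb))))
            (linked′ , ((⊑-refl , b⊑y) ∷ All.zipWith (λ ((_ , u⊑y) , b⊏u) → proj₁ b⊏u , u⊑y) (within , sorted linked′)) , maximal′)))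
        where
        first : m ∈ b ∷ l → m ≡ b
        first (here eq)   = eq
        first (there m∈l) = ⊑-antisym m⊑b (proj₁ (All.lookup (sorted linked′) m∈l))
        m≡b = first m∈
        ρb : ρ b ≡ suc (ρ x)
        ρb = trans (cong ρ (sym m≡b)) ρm
        maximal′ : ∀ w → b ⊑ w → w ⊑ y → All (λ u → u ⊑ w ⊎ w ⊑ u) (b ∷ l) → w ∈ b ∷ l
        maximal′ w b⊑w w⊑y comparable with maximal w (⊑-trans x⊑b b⊑w) w⊑y (inj₁ (⊑-trans (proj₁ a⊏b) b⊑w) ∷ comparable)
        ... | here refl = contradiction (⊑-antisym (proj₁ a⊏b) b⊑w) (proj₂ a⊏b)
        ... | there w∈  = w∈

    chainCount-correct : ∀ k {x y n} → x ⊑ y → y ⊑ t → ρ y ≡ k + ρ x → NumMaxChains P x y n → chainCount k x y ≡ n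
    chainCount-correct k {x} {y} {n} x⊑y y⊑t ρy (f , f-inj , f-sound , f-complete) = begin
      chainCount k x y           ≡⟨ length-chainLists k x y ⟨
      length (chainLists k x y)  ≡⟨ same-length (chainLists-unique k x y) (Unique.tabulate⁺ f-inj) to from ⟩
      length (tabulate f)        ≡⟨ length-tabulate f ⟩
      n                          ∎
      where
      open ≡-Reasoning
      to : ∀ {l} → l ∈ chainLists k x y → l ∈ tabulate f
      to l∈ with f-complete _ (sound k x⊑y ρy l∈)
      ... | i , refl = ∈-tabulate⁺ i
      from : ∀ {l} → l ∈ tabulate f → l ∈ chainLists k x y
      from l∈ with ∈-tabulate⁻ l∈
      ... | i , refl = complete k x⊑y y⊑t ρy (f-sound i)

-- Counting in Sheffer intervals

record IsShefferFin (Q : FinPoset) (D : ℕ → ℕ) : Set where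
  open FinPosetTheory Q
  field
    upper : ∀ k {x y} → x ≢ bot → x ⊑ y → ρ y ≡ k + ρ x → chains k x y ≡ k !
    lower : ∀ k {y} → y ≢ bot → ρ y ≡ k → chains k bot y ≡ D k
    euler : top ≢ bot → foldr ℤ._+_ 0ℤ (map (λ z → -1ℤ ℤ.^ ρ z) elems) ≡ 0ℤ

module ShefferInterval (Q : FinPoset) (D : ℕ → ℕ) (sheffer : IsShefferFin Q D) where
  open FinPosetTheory Q
  open IsShefferFin sheffer

  upper-IsBoolean : ∀ {x y} → x ≢ bot → IsBoolean x y
  upper-IsBoolean x≢bot = factorials⇒IsBoolean λ k x⊑u u⊑w w⊑y ρw → upper k (above-≢bot x≢bot x⊑u) u⊑w ρw

  bot-gap : ∀ {y k} → ρ y ≡ k → ρ y ≡ k + ρ bot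
  bot-gap {k = k} ρy = trans ρy (trans (sym (+-identityʳ k)) (cong (k +_) (sym ρ-bot)))

  D-up : ∀ k {y} → ρ y ≡ suc k → D (suc k) ≡ up bot y * k !
  D-up k {y} ρy = trans (sym (lower (suc k) (ρ-suc⇒≢bot ρy) ρy))
    (∑-▹-const elems (up? bot y) _ λ { z ((_ , ρz) , z⊑y) →
      upper k (ρ-suc⇒≢bot ρz) z⊑y (trans ρy (trans (+-comm 1 k) (cong (k +_) (sym (trans ρz (cong suc ρ-bot)))))) })

  D-down : ∀ k {y} → ρ y ≡ 2 + k → D (2 + k) ≡ down bot y * D (suc k)
  D-down k {y} ρy = trans (sym (lower (2 + k) (ρ-suc⇒≢bot ρy) ρy))
    (trans (chains-below (suc k) (bot-min y) (bot-gap ρy))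
      (∑-▹-const elems (down? bot y) _ λ { c (_ , _ , ρc) →
        let ρc≡ = suc-injective (trans (sym ρc) ρy) in lower (suc k) (ρ-suc⇒≢bot ρc≡) ρc≡ }))

  D-1 : ∀ {y} → ρ y ≡ 1 → D 1 ≡ 1
  D-1 {y} ρy = trans (D-up 0 ρy) (trans (*-identityʳ (up bot y))
    (#≡1 (up? bot y) ((bot-min y , trans ρy (cong suc (sym ρ-bot))) , ⊑-refl) (λ _ → up-reaches (trans ρy (cong suc (sym ρ-bot))))))

  -- Fix an atom v below y: the interval [v, y] has rank k + 1 and Boolean cover numbers, so k + 1
  -- coatoms of y lie above v already.
  down-lower : ∀ k {y} → ρ y ≡ 2 + k → suc k ≤ down bot y
  down-lower k {y} ρy with ∃-up (bot-min y) (λ { refl → ρ-suc⇒≢bot ρy refl })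
  ... | v , (_ , ρv) , v⊑y = ≤-trans
    (≤-reflexive (sym (proj₂ (upper-IsBoolean (ρ-suc⇒≢bot ρv) (suc k) ⊑-refl v⊑y ⊑-refl
      (trans ρy (trans (sym (+-comm (suc k) 1)) (cong (suc k +_) (sym (trans ρv (cong suc ρ-bot))))))))))
    (#-mono (down? v y) (down? bot y) (λ { c (_ , c◃y) → bot-min c , c◃y }))

  -- Count the covers between ranks k + 1 and k + 2: from below each element has j + 1 of them, from
  -- above D(k + 2) / D(k + 1). So the product with D and the factorial does not change when k grows
  -- and j shrinks, and it starts with the atoms.
  level-D : ∀ k j {y} → ρ y ≡ suc (j + k) → level (suc k) bot y * (D (suc k) * j !) ≡ D (suc (j + k))
  level-D zero j {y} ρy = begin
    level 1 bot y * (D 1 * j !)  ≡⟨ cong₂ (λ l d → l * (d * j !)) level≡up D1≡1 ⟩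
    up bot y * (1 * j !)         ≡⟨ cong (up bot y *_) (*-identityˡ (j !)) ⟩
    up bot y * j !               ≡⟨ D-up j (trans ρy (cong suc (+-identityʳ j))) ⟨
    D (suc j)                    ≡⟨ cong (D ∘ suc) (+-identityʳ j) ⟨
    D (suc (j + 0))              ∎
    where
    open ≡-Reasoning
    level≡up : level 1 bot y ≡ up bot y
    level≡up = #-cong (within? 1 bot y) (up? bot y)
      (λ { z ((b⊑z , z⊑y) , ρz) → (b⊑z , trans ρz (cong suc (sym ρ-bot))) , z⊑y })
      (λ { z ((b⊑z , ρz) , z⊑y) → (b⊑z , z⊑y) , trans ρz (cong suc ρ-bot) })
    D1≡1 : D 1 ≡ 1
    D1≡1 with ∃-up (bot-min y) (λ { refl → ρ-suc⇒≢bot ρy refl })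
    ... | v , (_ , ρv) , _ = D-1 (trans ρv (cong suc ρ-bot))
  level-D (suc k) j {y} ρy = begin
    level (2 + k) bot y * (D (2 + k) * j !)           ≡⟨ *-assoc (level (2 + k) bot y) (D (2 + k)) (j !) ⟨
    level (2 + k) bot y * D (2 + k) * j !             ≡⟨ cong (_* j !) step ⟩
    level (suc k) bot y * suc j * D (suc k) * j !     ≡⟨ regroup (level (suc k) bot y) (suc j) (D (suc k)) (j !) ⟩
    level (suc k) bot y * (D (suc k) * suc j !)       ≡⟨ level-D k (suc j) (trans ρy (cong suc (+-suc j k))) ⟩
    D (suc (suc j + k))                               ≡⟨ cong (D ∘ suc) (+-suc j k) ⟨
    D (suc (j + suc k))                               ∎
    where
    open ≡-Reasoning
    regroup : ∀ a b c d → a * b * c * d ≡ a * (c * (b * d))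
    regroup = ringℕ
    step : level (2 + k) bot y * D (2 + k) ≡ level (suc k) bot y * suc j * D (suc k)
    step = begin
      level (2 + k) bot y * D (2 + k)
        ≡⟨ ∑-▹-const elems (within? (2 + k) bot y) _ (λ _ _ → refl) ⟨
      ∑ elems (λ w → within? (2 + k) bot y w ▹ D (2 + k))
        ≡⟨ ∑-▹-cong elems (within? (2 + k) bot y) (within? (2 + k) bot y) (λ _ p → p) (λ _ p → p) (λ { w (_ , ρw) → D-down k ρw }) ⟩
      ∑ elems (λ w → within? (2 + k) bot y w ▹ (down bot w * D (suc k)))
        ≡⟨ ∑-cong elems (λ {w} _ → trans (▹-* (within? (2 + k) bot y w) _) (trans (sym (*-assoc (within? (2 + k) bot y w ▹ 1) (down bot w) (D (suc k)))) (cong (_* D (suc k)) (sym (▹-* (within? (2 + k) bot y w) _))))) ⟩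
      ∑ elems (λ w → within? (2 + k) bot y w ▹ down bot w * D (suc k))
        ≡⟨ ∑-*ʳ elems _ (D (suc k)) ⟩
      ∑ elems (λ w → within? (2 + k) bot y w ▹ down bot w) * D (suc k)
        ≡⟨ cong (_* D (suc k)) (level-pairs (suc k) bot y) ⟨
      ∑ elems (λ z → within? (suc k) bot y z ▹ up z y) * D (suc k)
        ≡⟨ cong (_* D (suc k)) (∑-▹-const elems (within? (suc k) bot y) _ λ { z ((_ , z⊑y) , ρz) →
             proj₁ (upper-IsBoolean (ρ-suc⇒≢bot ρz) (suc j) ⊑-refl z⊑y ⊑-refl (trans ρy (cong (suc j +_) (sym ρz)))) }) ⟩
      level (suc k) bot y * suc j * D (suc k) ∎

  level-euler : ∀ n → ρ top ≡ suc n → ∑< (suc n) (λ k → pos (level (suc k) bot top) ℤ.* -1ℤ ℤ.^ k) ≡ 1ℤ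
  level-euler n ρt = move (begin
    1ℤ ℤ.+ -1ℤ ℤ.* ∑< (suc n) (λ k → pos (level (suc k) bot top) ℤ.* -1ℤ ℤ.^ k)
      ≡⟨ cong (λ s → 1ℤ ℤ.+ s) (trans (sym (∑<-*ˡ (suc n) -1ℤ _)) (∑<-cong (suc n) (λ k _ → swap (pos (level (suc k) bot top)) (-1ℤ ℤ.^ k)))) ⟩
    1ℤ ℤ.+ ∑< (suc n) (λ k → pos (level (suc k) bot top) ℤ.* -1ℤ ℤ.^ suc k)
      ≡⟨ cong (λ l → pos l ℤ.* 1ℤ ℤ.+ ∑< (suc n) (λ k → pos (level (suc k) bot top) ℤ.* -1ℤ ℤ.^ suc k))
              (sym (trans (cong (λ r → level r bot top) (sym ρ-bot)) (level-bottom (bot-min top)))) ⟩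
    pos (level 0 bot top) ℤ.* 1ℤ ℤ.+ ∑< (suc n) (λ k → pos (level (suc k) bot top) ℤ.* -1ℤ ℤ.^ suc k)
      ≡⟨ ∑<-split (suc n) (λ k → pos (level k bot top) ℤ.* -1ℤ ℤ.^ k) ⟨
    ∑< (2 + n) (λ k → pos (level k bot top) ℤ.* -1ℤ ℤ.^ k)
      ≡⟨ ∑<-cong (2 + n) (λ k _ → cong (λ l → pos l ℤ.* -1ℤ ℤ.^ k)
           (#-cong (within? k bot top) (λ z → ρ z ≟ k) (λ _ (_ , ρz) → ρz) (λ z ρz → (bot-min z , top-max z) , ρz))) ⟩
    ∑< (2 + n) (λ k → pos (∑ elems (λ z → (ρ z ≟ k) ▹ 1)) ℤ.* -1ℤ ℤ.^ k)
      ≡⟨ sum-by-rank elems ρ (λ k → -1ℤ ℤ.^ k) (2 + n) (λ {z} _ → s≤s (≤-trans (ρ-mono (top-max z)) (≤-reflexive ρt))) ⟨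
    foldr ℤ._+_ 0ℤ (map (λ z → -1ℤ ℤ.^ ρ z) elems)
      ≡⟨ euler (ρ-suc⇒≢bot ρt) ⟩
    0ℤ ∎)
    where
    open ≡-Reasoning
    swap : ∀ a b → -1ℤ ℤ.* (a ℤ.* b) ≡ a ℤ.* (-1ℤ ℤ.* b)
    swap = ringℤ
    move : ∀ {x} → 1ℤ ℤ.+ -1ℤ ℤ.* x ≡ 0ℤ → x ≡ 1ℤ
    move {x} eq = trans (aux x) (cong (λ s → 1ℤ ℤ.+ -1ℤ ℤ.* s) eq)
      where
      aux : ∀ x → x ≡ 1ℤ ℤ.+ -1ℤ ℤ.* (1ℤ ℤ.+ -1ℤ ℤ.* x)
      aux = ringℤ

-- Lower intervals as finite posets

∑-map : {A B : Set} (g : A → B) (xs : List A) (f : B → ℕ) → ∑ (map g xs) f ≡ ∑ xs (f ∘ g)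
∑-map g []       f = refl
∑-map g (x ∷ xs) f = cong (f (g x) +_) (∑-map g xs f)

module LowerInterval (P : GradedPoset) (t : GradedPoset.Carrier P) where
  open GradedPosetTheory P
  open MaximalChains t

  -- The irrelevant bound makes equality of elements equality in P.
  record Element : Set where
    constructor ⟨_,_⟩
    field
      el     : Carrier
      .bound : el ⊑ t

  open Element public using (el)

  bound′ : (z : Element) → el z ⊑ t
  bound′ ⟨ z , z⊑t ⟩ = recompute (z ⊑? t) z⊑t

  private
    collect : (xs : List Carrier) → All (_⊑ t) xs → List Element
    collect []       []       = []
    collect (x ∷ xs) (p ∷ ps) = ⟨ x , p ⟩ ∷ collect xs ps

    map-collect : ∀ xs ps → map el (collect xs ps) ≡ xs
    map-collect []       []       = refl
    map-collect (x ∷ xs) (p ∷ ps) = cong (x ∷_) (map-collect xs ps)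

  elements : List Element
  elements = collect (interval 𝟘 t) (All.tabulate (proj₂ ∘ interval⁻))

  map-el-elements : map el elements ≡ interval 𝟘 t
  map-el-elements = map-collect (interval 𝟘 t) _

  elements-unique : Unique elements
  elements-unique = Unique.map⁻ (subst Unique (sym map-el-elements) (interval-unique 𝟘 t))

  elements-complete : ∀ z → z ∈ elements
  elements-complete ⟨ z , z⊑t ⟩
    with ∈-map⁻ el (subst (z ∈_) (sym map-el-elements) (interval⁺ (𝟘-min z) (recompute (z ⊑? t) z⊑t)))
  ... | ⟨ _ , _ ⟩ , z∈ , refl = z∈

  finPoset : FinPoset
  finPoset = record
    { Carrier        = Element
    ; _⊑_            = λ x y → el x ⊑ el y
    ; isPartialOrder = record
      { isPreorder = record
        { isEquivalence = isEquivalence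
        ; reflexive     = λ { refl → ⊑-refl }
        ; trans         = ⊑-trans
        }
      ; antisym = λ { {⟨ x , _ ⟩} {⟨ y , _ ⟩} x⊑y y⊑x → el-injective (⊑-antisym x⊑y y⊑x) }
      }
    ; _⊑?_           = λ x y → el x ⊑? el y
    ; elems          = elements
    ; elems-unique   = elements-unique
    ; elems-complete = elements-complete
    ; bot            = ⟨ 𝟘 , 𝟘-min t ⟩
    ; top            = ⟨ t , ⊑-refl ⟩
    ; bot-min        = λ z → 𝟘-min (el z)
    ; top-max        = bound′
    ; ρ              = λ z → ρ (el z)
    ; ρ-bot          = ρ-𝟘
    ; ρ-strict       = λ x⊑y x≢y → ρ-strict x⊑y (x≢y ∘ el-injective)
    ; cover-above    = λ {x} {y} x⊑y x≢y → let z , x⊑z , ρz , z⊑y = cover-above x⊑y (x≢y ∘ el-injective) in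
                         ⟨ z , ⊑-trans z⊑y (bound′ y) ⟩ , x⊑z , ρz , z⊑y
    ; cover-below    = λ {x} {y} x⊑y x≢y → let z , x⊑z , z⊑y , ρy = cover-below x⊑y (x≢y ∘ el-injective) in
                         ⟨ z , ⊑-trans z⊑y (bound′ y) ⟩ , x⊑z , z⊑y , ρy
    }
    where
    el-injective : ∀ {x y : Element} → el x ≡ el y → x ≡ y
    el-injective {⟨ _ , _ ⟩} {⟨ _ , _ ⟩} refl = refl

  private
    module Q = FinPosetTheory finPoset

  chains-el : ∀ k x y → Q.chains k x y ≡ chainCount k (el x) (el y)
  chains-el zero    x y = refl
  chains-el (suc k) x y = begin
    ∑ elements (λ z → Q.up? x y z ▹ Q.chains k z y)
      ≡⟨ ∑-▹-cong elements (Q.up? x y) (λ z → up? (el x) (el y) (el z)) (λ _ p → p) (λ _ p → p) (λ z _ → chains-el k z y) ⟩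
    ∑ elements (λ z → up? (el x) (el y) (el z) ▹ chainCount k (el z) (el y))
      ≡⟨ ∑-map el elements _ ⟨
    ∑ (map el elements) (λ z → up? (el x) (el y) z ▹ chainCount k z (el y))
      ≡⟨ cong (λ xs → ∑ xs (λ z → up? (el x) (el y) z ▹ chainCount k z (el y))) map-el-elements ⟩
    ∑ (interval 𝟘 t) (λ z → up? (el x) (el y) z ▹ chainCount k z (el y)) ∎
    where open ≡-Reasoning

  isSheffer : ∀ {D} → IsEulerian P → IsSheffer P D _! → IsShefferFin finPoset D
  isSheffer {D} eulerian (lower , upper) = record
    { upper = λ k {x} {y} x≢bot x⊑y ρy → trans (chains-el k x y)
        (chainCount-correct k x⊑y (bound′ y) ρy (subst (λ n → NumMaxChains P (el x) (el y) (n !))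
          (trans (cong (_∸ ρ (el x)) ρy) (m+n∸n≡m k (ρ (el x)))) (upper (el x) (el y) (λ { refl → x≢bot refl }) x⊑y)))
    ; lower = λ k {y} y≢bot ρy → trans (chains-el k Q.bot y)
        (chainCount-correct k (𝟘-min (el y)) (bound′ y) (trans ρy (trans (sym (+-identityʳ k)) (cong (k +_) (sym ρ-𝟘))))
          (subst (λ n → NumMaxChains P 𝟘 (el y) (D n)) ρy (lower (el y) (λ { refl → y≢bot refl }))))
    ; euler = λ t≢bot → begin
        foldr ℤ._+_ 0ℤ (map (λ z → -1ℤ ℤ.^ ρ (el z)) elements)
          ≡⟨ cong (foldr ℤ._+_ 0ℤ) (map-∘ elements) ⟩
        foldr ℤ._+_ 0ℤ (map (λ z → -1ℤ ℤ.^ ρ z) (map el elements))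
          ≡⟨ cong (λ xs → foldr ℤ._+_ 0ℤ (map (λ z → -1ℤ ℤ.^ ρ z) xs)) map-el-elements ⟩
        foldr ℤ._+_ 0ℤ (map (λ z → -1ℤ ℤ.^ ρ z) (interval 𝟘 t))
          ≡⟨ cong (foldr ℤ._+_ 0ℤ) (map-cong (λ z → cong (λ r → -1ℤ ℤ.^ (ρ z ∸ r)) (sym ρ-𝟘)) (interval 𝟘 t)) ⟩
        foldr ℤ._+_ 0ℤ (map (λ z → -1ℤ ℤ.^ (ρ z ∸ ρ 𝟘)) (interval 𝟘 t))
          ≡⟨ proj₂ eulerian 𝟘 t (𝟘-min t , λ { refl → t≢bot refl }) ⟩
        0ℤ ∎
    }
    where open ≡-Reasoning

module ShefferNumbersOf (P : GradedPoset) (D : ℕ → ℕ) (eulerian : IsEulerian P) (sheffer : IsSheffer P D _!) where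
  open GradedPosetTheory P using (of-rank; ρ)

  module Interval (t : GradedPoset.Carrier P) where
    open FinPosetTheory (LowerInterval.finPoset P t) public
    open ShefferInterval (LowerInterval.finPoset P t) D (LowerInterval.isSheffer P t eulerian sheffer) public
    open IsShefferFin {D = D} (LowerInterval.isSheffer P t {D} eulerian sheffer) public using (upper; lower)

  private
    -- One representative of each positive rank is enough: the numbers required are determined by
    -- the factorial function, and so do not depend on the choice.
    t : ℕ → GradedPoset.Carrier P
    t n = proj₁ (of-rank (suc n))

    ρ-t : ∀ n → ρ (t n) ≡ suc n
    ρ-t n = proj₂ (of-rank (suc n))

    module I n = Interval (t n)

    c : ℕ → ℕ
    c n = I.down (suc n) (I.bot (suc n)) (I.top (suc n))

    d-suc : ∀ n → D (2 + n) ≡ c n * D (suc n)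
    d-suc n = I.D-down (suc n) n {I.top (suc n)} (ρ-t (suc n))

    D-1 : D 1 ≡ 1
    D-1 = I.D-1 0 {I.top 0} (ρ-t 0)

    d-nonZero : ∀ n → NonZero (D (suc n))
    d-nonZero zero    = subst NonZero (sym D-1) _
    d-nonZero (suc n) = subst NonZero (sym (d-suc n))
      (m*n≢0 (c n) (D (suc n)) {{>-nonZero (≤-trans (s≤s z≤n) (I.down-lower (suc n) n {I.top (suc n)} (ρ-t (suc n))))}} {{d-nonZero n}})

  shefferNumbers : ShefferNumbers (D ∘ suc)
  shefferNumbers = record
    { system = record
      { d-nonZero = d-nonZero
      ; c         = c
      ; d-suc     = d-suc
      ; f         = λ n k → I.level n (suc k) (I.bot n) (I.top n)
      ; f-eq      = λ j k → I.level-D (j + k) k j {I.top (j + k)} (ρ-t (j + k))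
      ; euler     = λ m → alternating⇒euler (suc m) _ (I.level-euler (suc (double m)) (suc (double m)) (ρ-t (suc (double m))))
      }
    ; d-0     = D-1
    ; c-lower = λ n → I.down-lower (suc n) n {I.top (suc n)} (ρ-t (suc n))
    ; atoms   = λ n → I.up n (I.bot n) (I.top n) , I.D-up n n {I.top n} (ρ-t n)
    }

-- The isomorphisms

length-filter-∑ : {A : Set} {R : A → Set} (R? : ∀ z → Dec (R z)) (xs : List A) → length (filter R? xs) ≡ ∑ xs (λ z → R? z ▹ 1)
length-filter-∑ R? []       = refl
length-filter-∑ R? (x ∷ xs) with R? x
... | no  _ = length-filter-∑ R? xs
... | yes _ = cong suc (length-filter-∑ R? xs)

∑-filter : {A : Set} {R : A → Set} (R? : ∀ z → Dec (R z)) (xs : List A) (f : A → ℕ) →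
           ∑ (filter R? xs) f ≡ ∑ xs (λ z → R? z ▹ f z)
∑-filter R? []       f = refl
∑-filter R? (x ∷ xs) f with R? x
... | no  _ = ∑-filter R? xs f
... | yes _ = cong (f x +_) (∑-filter R? xs f)

allVecs : {A : Set} → List A → ∀ n → List (Vec A n)
allVecs xs zero    = [] ∷ []
allVecs xs (suc n) = cartesianProductWith _∷_ xs (allVecs xs n)

length-allVecs : {A : Set} (xs : List A) → ∀ n → length (allVecs xs n) ≡ length xs ^ n
length-allVecs {A} xs zero    = refl
length-allVecs {A} xs (suc n) = trans (go xs) (cong (length xs *_) (length-allVecs xs n))
  where
  vs = allVecs xs n
  go : (ys : List A) → length (cartesianProductWith _∷_ ys vs) ≡ length ys * length vs
  go []       = refl
  go (y ∷ ys) = trans (length-++ (map (y ∷_) vs)) (cong₂ _+_ (length-map (y ∷_) vs) (go ys))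

allVecs-complete : {A : Set} {xs : List A} → (∀ x → x ∈ xs) → ∀ {n} (v : Vec A n) → v ∈ allVecs xs n
allVecs-complete complete []      = here refl
allVecs-complete complete (x ∷ v) = ∈-cartesianProductWith⁺ _∷_ (complete x) (allVecs-complete complete v)

-- A missed value together with the image of `xs` would be more than `length ys` distinct entries of
-- `ys`. Applied to the codes below, this turns order embeddings into isomorphisms.
injective⇒surjective : {A T : Set} (_≟ᵀ_ : (s t : T) → Dec (s ≡ t)) (f : A → T) {xs : List A} {ys : List T} →
  Unique xs → (∀ {z w} → z ∈ xs → w ∈ xs → f z ≡ f w → z ≡ w) → (∀ t → t ∈ ys) → length ys ≤ length xs →
  ∀ t → ∃ λ z → z ∈ xs × f z ≡ t
injective⇒surjective {A} _≟ᵀ_ f {xs} {ys} u inj complete le t with any? (λ z → f z ≟ᵀ t) xs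
... | yes hit = find hit
... | no  miss = contradiction
  (≤-trans (≤-reflexive (cong suc (sym (length-map f xs)))) (length-⊆ (All.tabulate avoid ∷ unique-map u inj) (λ {z} _ → complete z)))
  (≤⇒≯ le)
  where
  avoid : ∀ {s} → s ∈ map f xs → t ≢ s
  avoid s∈ refl with ∈-map⁻ f s∈
  ... | z , z∈ , t≡fz = miss (Any.map (λ { refl → sym t≡fz }) z∈)
  unique-map : ∀ {zs : List A} → Unique zs → (∀ {z w} → z ∈ zs → w ∈ zs → f z ≡ f w → z ≡ w) → Unique (map f zs)
  unique-map []       inj = []
  unique-map (z∉ ∷ u) inj = All.tabulate (λ {s} s∈ z≡s → let w , w∈ , eq = ∈-map⁻ f s∈ in
                              All.lookup z∉ w∈ (inj (here refl) (there w∈) (trans z≡s eq)))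
                            ∷ unique-map u (λ p q → inj (there p) (there q))

listAsVec : {A : Set} {n : ℕ} (xs : List A) → length xs ≡ n → Vec A n
listAsVec xs refl = Vec.fromList xs

∈-listAsVec : {A : Set} {n : ℕ} {xs : List A} (len : length xs ≡ n) {a : A} → a ∈ xs → ∃ λ i → Vec.lookup (listAsVec xs len) i ≡ a
∈-listAsVec refl (here refl) = Fin.zero , refl
∈-listAsVec refl (there a∈) with ∈-listAsVec refl a∈
... | i , eq = Fin.suc i , eq

-- Boolean intervals

module _ (Q : FinPoset) where
  open FinPosetTheory Q

  module BooleanIso {x y : Carrier} {n : ℕ}
      (B : IsBoolean x y) (x⊑y : x ⊑ y) (ρy : ρ y ≡ n + ρ x) where
    open BooleanJoins Q using (atoms-reflect)

    level-choose : ∀ k → k ≤ n → level (k + ρ x) x y ≡ n C k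
    level-choose k k≤n = subst (λ m → level (k + ρ x) x y ≡ m C k) (m+[n∸m]≡n k≤n)
      (*-cancelʳ-≡ _ _ (k ! * j !) {{m*n≢0 (k !) (j !) {{k !≢0}} {{j !≢0}}}}
        (trans (level-! B x⊑y k j (trans ρy (cong (_+ ρ x) (sym (m+[n∸m]≡n k≤n))))) (sym (C-! k j))))
      where
      j = n ∸ k

    inside? : ∀ z → Dec (x ⊑ z × z ⊑ y)
    inside? z = (x ⊑? z) ×-dec (z ⊑? y)

    -- The level sizes are binomial coefficients with sum (1 + 1)^n, the number of available codes.
    size : length (filter inside? elems) ≡ 2 ^ n
    size = ℤ.+-injective (begin
      pos (length (filter inside? elems))
        ≡⟨ length-by-rank (filter inside? elems) (λ z → ρ z ∸ ρ x) (suc n)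
             (λ z∈ → s≤s (≤-trans (∸-monoˡ-≤ (ρ x) (ρ-mono (proj₂ (proj₂ (∈-filter⁻ inside? {xs = elems} z∈)))))
                                  (≤-reflexive (trans (cong (_∸ ρ x) ρy) (m+n∸n≡m n (ρ x)))))) ⟩
      ∑< (suc n) (λ k → pos (∑ (filter inside? elems) (λ z → (ρ z ∸ ρ x ≟ k) ▹ 1)))
        ≡⟨ ∑<-cong (suc n) (λ k k<1+n → trans (cong pos (trans (by-level k) (level-choose k (≤-pred k<1+n)))) (sym (ones k))) ⟩
      binomialSum n (λ k → 1ℤ ℤ.^ k ℤ.* 1ℤ ℤ.^ (n ∸ k))
        ≡⟨ binomialTheorem 1ℤ 1ℤ n ⟩
      pos 2 ℤ.^ n
        ≡⟨ pos-^ 2 n ⟨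
      pos (2 ^ n) ∎)
      where
      open ≡-Reasoning
      ones : ∀ k → pos (n C k) ℤ.* (1ℤ ℤ.^ k ℤ.* 1ℤ ℤ.^ (n ∸ k)) ≡ pos (n C k)
      ones k = trans (cong₂ (λ a b → pos (n C k) ℤ.* (a ℤ.* b)) (ℤ.^-zeroˡ k) (ℤ.^-zeroˡ (n ∸ k))) (ℤ.*-identityʳ _)
      by-level : ∀ k → ∑ (filter inside? elems) (λ z → (ρ z ∸ ρ x ≟ k) ▹ 1) ≡ level (k + ρ x) x y
      by-level k = trans (∑-filter inside? elems _) (∑-cong elems (λ {z} _ → trans (▹-▹ (inside? z) (ρ z ∸ ρ x ≟ k))
        (▹-cong (inside? z ×-dec (ρ z ∸ ρ x ≟ k)) (within? (k + ρ x) x y z)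
          (λ { (in′@(x⊑z , _) , eq) → in′ , trans (sym (m∸n+n≡m (ρ-mono x⊑z))) (cong (_+ ρ x) eq) })
          (λ { (in′ , eq) → in′ , trans (cong (_∸ ρ x) eq) (m+n∸n≡m k (ρ x)) }) (λ _ _ → refl))))

    private
      atoms : List Carrier
      atoms = filter (up? x y) elems

      atoms-length : length atoms ≡ n
      atoms-length = trans (length-filter-∑ (up? x y) elems) (proj₁ (B n ⊑-refl x⊑y ⊑-refl ρy))

      atomVec : Vec Carrier n
      atomVec = listAsVec atoms atoms-length

    encode : Carrier → Subset n
    encode z = Vec.map (λ a → does (a ⊑? z)) atomVec

    private
      ∈-encode⁺ : ∀ {z i} → Vec.lookup atomVec i ⊑ z → i Subset.∈ encode z
      ∈-encode⁺ {z} {i} a⊑z = Vec.lookup⇒[]= i (encode z) (trans (Vec.lookup-map i _ atomVec) (dec-true (Vec.lookup atomVec i ⊑? z) a⊑z))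

      ∈-encode⁻ : ∀ {z i} → i Subset.∈ encode z → Vec.lookup atomVec i ⊑ z
      ∈-encode⁻ {z} {i} i∈ with Vec.lookup atomVec i ⊑? z | trans (sym (Vec.lookup-map i (λ a → does (a ⊑? z)) atomVec)) (Vec.[]=⇒lookup i∈)
      ... | yes a⊑z | _ = a⊑z

    encode-mono : ∀ {z w} → z ⊑ w → encode z Subset.⊆ encode w
    encode-mono z⊑w i∈ = ∈-encode⁺ (⊑-trans (∈-encode⁻ i∈) z⊑w)

    encode-reflect : ∀ {z w} → x ⊑ z → x ⊑ w → z ⊑ y → w ⊑ y → encode z Subset.⊆ encode w → z ⊑ w
    encode-reflect {z} {w} x⊑z x⊑w z⊑y w⊑y sub with rank-gap x⊑z
    ... | k , ρz = atoms-reflect B k ρz x⊑z z⊑y x⊑w w⊑y below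
      where
      below : ∀ {a} → x ◃ a → a ⊑ z → a ⊑ w
      below {a} x◃a a⊑z with ∈-listAsVec atoms-length (∈-filter⁺ (up? x y) (elems-complete a) (x◃a , ⊑-trans a⊑z z⊑y))
      ... | i , eq = subst (_⊑ w) eq (∈-encode⁻ (sub (∈-encode⁺ (subst (_⊑ z) (sym eq) a⊑z))))

    private
      preimage : ∀ s → ∃ λ z → z ∈ filter inside? elems × encode z ≡ s
      preimage = injective⇒surjective (Vec.≡-dec _≟ᵇ_) encode {ys = allVecs (true ∷ false ∷ []) n}
        (Unique.filter⁺ inside? elems-unique)
        (λ {z} {w} z∈ w∈ eq → let _ , x⊑z , z⊑y = ∈-filter⁻ inside? {xs = elems} z∈
                                  _ , x⊑w , w⊑y = ∈-filter⁻ inside? {xs = elems} w∈ in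
          ⊑-antisym (encode-reflect x⊑z x⊑w z⊑y w⊑y (subst (encode z Subset.⊆_) eq Subset.⊆-refl))
                    (encode-reflect x⊑w x⊑z w⊑y z⊑y (subst (encode w Subset.⊆_) (sym eq) Subset.⊆-refl)))
        (allVecs-complete λ { true → here refl ; false → there (here refl) })
        (≤-reflexive (trans (length-allVecs (true ∷ false ∷ []) n) (sym size)))

    decode : Subset n → Carrier
    decode s = proj₁ (preimage s)

    decode-inside : ∀ s → x ⊑ decode s × decode s ⊑ y
    decode-inside s = proj₂ (∈-filter⁻ inside? {xs = elems} (proj₁ (proj₂ (preimage s))))

    encode-decode : ∀ s → encode (decode s) ≡ s
    encode-decode s = proj₂ (proj₂ (preimage s))

    decode-encode : ∀ {z} → x ⊑ z → z ⊑ y → decode (encode z) ≡ z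
    decode-encode {z} x⊑z z⊑y = ⊑-antisym
      (encode-reflect x⊑d x⊑z d⊑y z⊑y (subst (Subset._⊆ encode z) (sym (encode-decode (encode z))) Subset.⊆-refl))
      (encode-reflect x⊑z x⊑d z⊑y d⊑y (subst (encode z Subset.⊆_) (sym (encode-decode (encode z))) Subset.⊆-refl))
      where
      x⊑d = proj₁ (decode-inside (encode z))
      d⊑y = proj₂ (decode-inside (encode z))

-- Dual suspensions

module _ (Q : FinPoset) where
  open FinPosetTheory Q

  module SuspensionIso {m : ℕ} (ρt : ρ top ≡ 2 + m)
      (upper-IsBoolean : ∀ {x y} → x ≢ bot → IsBoolean x y)
      (two-atoms : ∀ {k z} → ρ z ≡ 2 + k → up bot z ≡ 2) where

    private
      first : ∃ λ a → bot ◃ a × a ⊑ top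
      first = #-exists (up? bot top) (subst (0 <_) (sym (two-atoms ρt)) z<s)

      a₁ = proj₁ first

      other? : ∀ z → Dec ((bot ◃ z × z ⊑ top) × z ≢ a₁)
      other? z = up? bot top z ×-dec ¬? (z ≟ᶜ a₁)

      other-count : # other? ≡ 1
      other-count = suc-injective (trans (sym (#-remove (up? bot top) (λ _ → 1) (proj₂ first))) (two-atoms ρt))

      second : ∃ λ a → (bot ◃ a × a ⊑ top) × a ≢ a₁
      second = #-exists other? (subst (0 <_) (sym other-count) z<s)

      a₂ = proj₁ second
      a₂≢a₁ = proj₂ (proj₂ second)

      ρa₁ : ρ a₁ ≡ 1
      ρa₁ = trans (proj₂ (proj₁ (proj₂ first))) (cong suc ρ-bot)

      ρa₂ : ρ a₂ ≡ 1
      ρa₂ = trans (proj₂ (proj₁ (proj₁ (proj₂ second)))) (cong suc ρ-bot)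

      a₁≢bot : a₁ ≢ bot
      a₁≢bot = ρ-suc⇒≢bot ρa₁

      a₂≢bot : a₂ ≢ bot
      a₂≢bot = ρ-suc⇒≢bot ρa₂

      -- The atoms below z are among the atoms below the top, and there are two of each kind, so the
      -- two sets coincide.
      above-atoms : ∀ {k z a} → ρ z ≡ 2 + k → bot ◃ a → a ⊑ z
      above-atoms {z = z} {a} ρz bot◃a = proj₂ (proj₁ (▹-pos (up? bot z a) (subst (0 <_)
        (sym (∑-squeeze elems (λ {w} _ → ▹-mono (up? bot z w) (up? bot top w) (λ { (p , _) → p , top-max w }))
               (≤-reflexive (trans (two-atoms ρt) (sym (two-atoms ρz)))) (elems-complete a)))
        (subst (0 <_) (sym (▹-yes (up? bot top a) (bot◃a , top-max a))) z<s))))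

      -- Everything of rank at least 2 lies above a₁, so [a₁, top] stands in for the Boolean algebra
      -- under the suspension, except that its minimum a₁ is coded as a new point and the empty set
      -- is given to the bottom.
      module I = BooleanIso Q {a₁} {top} {suc m} (upper-IsBoolean a₁≢bot) (top-max a₁)
                   (trans ρt (trans (sym (+-comm (suc m) 1)) (cong (suc m +_) (sym ρa₁))))

      encode-a₁ : I.encode a₁ ≡ Subset.⊥
      encode-a₁ = Subset.⊆-antisym
        (subst (I.encode a₁ Subset.⊆_) (I.encode-decode Subset.⊥) (I.encode-mono (proj₁ (I.decode-inside Subset.⊥))))
        (Subset.⊆-min _)

      data View (z : Carrier) : Set where
        is-bot    : z ≡ bot → View z
        is-first  : z ≡ a₁ → View z
        is-second : z ≡ a₂ → View z
        is-big    : a₁ ⊑ z → a₂ ⊑ z → z ≢ a₁ → z ≢ a₂ → View z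

      view : ∀ z → View z
      view z with ρ z in ρz
      ... | zero = is-bot (sym (ρ≡0⇒bot ρz))
      ... | suc (suc k) = is-big (above-atoms ρz (proj₁ (proj₂ first))) (above-atoms ρz (proj₁ (proj₁ (proj₂ second))))
                                 (λ { refl → 1+n≢0 (suc-injective (trans (sym ρz) ρa₁)) })
                                 (λ { refl → 1+n≢0 (suc-injective (trans (sym ρz) ρa₂)) })
      ... | suc zero with z ≟ᶜ a₁
      ...   | yes z≡a₁ = is-first z≡a₁
      ...   | no  z≢a₁ = is-second (#≤1⇒unique other? (≤-reflexive other-count)
                (((bot-min z , trans ρz (cong suc (sym ρ-bot))) , top-max z) , z≢a₁) (proj₂ second))

      code : ∀ {z} → View z → DSBool (suc m)
      code (is-bot _)           = old Subset.⊥
      code (is-first _)         = new Fin.zero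
      code (is-second _)        = new (Fin.suc Fin.zero)
      code {z} (is-big _ _ _ _) = old (I.encode z)

      encode-big : ∀ {z} → a₁ ⊑ z → z ≢ a₁ → I.encode z ≢ Subset.⊥
      encode-big a₁⊑z z≢a₁ eq = z≢a₁ (⊑-antisym
        (I.encode-reflect a₁⊑z ⊑-refl (top-max _) (top-max _) (subst (Subset._⊆ I.encode a₁) (sym eq) (Subset.⊆-min _))) a₁⊑z)

      Code-≤ : DSBool (suc m) → DSBool (suc m) → Set
      Code-≤ = DSBool-≤ (suc m)

      old-old : ∀ {s t} → Code-≤ (old s) (old t) → s Subset.⊆ t
      old-old (old≤old s⊆t) = s⊆t

      old-new : ∀ {s i} → Code-≤ (old s) (new i) → s ≡ Subset.⊥
      old-new bot≤new = refl

      new-old : ∀ {s i} → Code-≤ (new i) (old s) → s ≢ Subset.⊥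
      new-old (new≤old s≢⊥) = s≢⊥

      atoms-incomparable : ∀ {a b} → ρ a ≡ 1 → ρ b ≡ 1 → a ⊑ b → a ≡ b
      atoms-incomparable ρa ρb a⊑b = ρ-eq a⊑b (≤-reflexive (trans ρb (sym ρa)))

      code-mono : ∀ {z w} (v : View z) (u : View w) → z ⊑ w → Code-≤ (code v) (code u)
      code-mono (is-bot refl)    (is-bot refl)       _   = old≤old Subset.⊆-refl
      code-mono (is-bot refl)    (is-first refl)     _   = bot≤new
      code-mono (is-bot refl)    (is-second refl)    _   = bot≤new
      code-mono (is-bot refl)    (is-big _ _ _ _)    _   = old≤old (Subset.⊆-min _)
      code-mono (is-first refl)  (is-bot refl)       z⊑w = contradiction (bot-least z⊑w) a₁≢bot
      code-mono (is-first refl)  (is-first refl)     _   = new≤new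
      code-mono (is-first refl)  (is-second refl)    z⊑w = contradiction (sym (atoms-incomparable ρa₁ ρa₂ z⊑w)) a₂≢a₁
      code-mono (is-first refl)  (is-big p _ q _)    _   = new≤old (encode-big p q)
      code-mono (is-second refl) (is-bot refl)       z⊑w = contradiction (bot-least z⊑w) a₂≢bot
      code-mono (is-second refl) (is-first refl)     z⊑w = contradiction (atoms-incomparable ρa₂ ρa₁ z⊑w) a₂≢a₁
      code-mono (is-second refl) (is-second refl)    _   = new≤new
      code-mono (is-second refl) (is-big p _ q _)    _   = new≤old (encode-big p q)
      code-mono (is-big p _ _ _) (is-bot refl)       z⊑w = contradiction (bot-least (⊑-trans p z⊑w)) a₁≢bot
      code-mono (is-big p _ q _) (is-first refl)     z⊑w = contradiction (⊑-antisym z⊑w p) q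
      code-mono (is-big _ p _ q) (is-second refl)    z⊑w = contradiction (⊑-antisym z⊑w p) q
      code-mono (is-big _ _ _ _) (is-big _ _ _ _)    z⊑w = old≤old (I.encode-mono z⊑w)

      code-reflect : ∀ {z w} (v : View z) (u : View w) → Code-≤ (code v) (code u) → z ⊑ w
      code-reflect (is-bot refl)    _                   _  = bot-min _
      code-reflect (is-first refl)  (is-bot refl)       le = contradiction refl (new-old le)
      code-reflect (is-first refl)  (is-first refl)     _  = ⊑-refl
      code-reflect (is-first refl)  (is-big p _ _ _)    _  = p
      code-reflect (is-second refl) (is-bot refl)       le = contradiction refl (new-old le)
      code-reflect (is-second refl) (is-second refl)    _  = ⊑-refl
      code-reflect (is-second refl) (is-big _ p _ _)    _  = p
      code-reflect (is-big p _ q _) (is-bot refl)       le = contradiction (Subset.⊆-antisym (old-old le) (Subset.⊆-min _)) (encode-big p q)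
      code-reflect (is-big p _ q _) (is-first refl)     le = contradiction (old-new le) (encode-big p q)
      code-reflect (is-big p _ q _) (is-second refl)    le = contradiction (old-new le) (encode-big p q)
      code-reflect (is-big p _ _ _) (is-big q _ _ _)    le = I.encode-reflect p q (top-max _) (top-max _) (old-old le)

      Code-antisym : ∀ {a b} → Code-≤ a b → Code-≤ b a → a ≡ b
      Code-antisym (old≤old p)   (old≤old q)   = cong old (Subset.⊆-antisym p q)
      Code-antisym new≤new       _             = refl
      Code-antisym bot≤new       (new≤old s≢⊥) = contradiction refl s≢⊥
      Code-antisym (new≤old s≢⊥) bot≤new       = contradiction refl s≢⊥

    encode : Carrier → DSBool (suc m)
    encode z = code (view z)

    encode-⇔ : ∀ z w → (z ⊑ w → DSBool-≤ (suc m) (encode z) (encode w)) × (DSBool-≤ (suc m) (encode z) (encode w) → z ⊑ w)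
    encode-⇔ z w = code-mono (view z) (view w) , code-reflect (view z) (view w)

    private
      _≟ˢ_ : (s t : Subset (suc m)) → Dec (s ≡ t)
      _≟ˢ_ = Vec.≡-dec _≟ᵇ_

    decode : DSBool (suc m) → Carrier
    -- The empty set belongs to the bottom, whereas `I.decode` would return a₁ for it.
    decode (old s) with s ≟ˢ Subset.⊥
    ... | yes _ = bot
    ... | no  _ = I.decode s
    decode (new Fin.zero)    = a₁
    decode (new (Fin.suc _)) = a₂

    private
      decode-view : ∀ a → ∃ λ (v : View (decode a)) → code v ≡ a
      decode-view (old s) with s ≟ˢ Subset.⊥
      ... | yes refl = is-bot refl , refl
      ... | no  s≢⊥  = is-big a₁⊑d (above-a₂ (view (I.decode s))) d≢a₁ d≢a₂ , cong old (I.encode-decode s)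
        where
        a₁⊑d = proj₁ (I.decode-inside s)
        d≢a₁ : I.decode s ≢ a₁
        d≢a₁ eq = s≢⊥ (trans (sym (I.encode-decode s)) (trans (cong I.encode eq) encode-a₁))
        d≢a₂ : I.decode s ≢ a₂
        d≢a₂ eq = a₂≢a₁ (sym (atoms-incomparable ρa₁ ρa₂ (subst (a₁ ⊑_) eq a₁⊑d)))
        above-a₂ : View (I.decode s) → a₂ ⊑ I.decode s
        above-a₂ (is-bot eq)      = contradiction (bot-least (subst (a₁ ⊑_) eq a₁⊑d)) a₁≢bot
        above-a₂ (is-first eq)    = contradiction eq d≢a₁
        above-a₂ (is-second eq)   = contradiction eq d≢a₂
        above-a₂ (is-big _ p _ _) = p
      decode-view (new Fin.zero)             = is-first refl , refl
      decode-view (new (Fin.suc Fin.zero))   = is-second refl , refl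

    encode-decode : ∀ a → encode (decode a) ≡ a
    encode-decode a with decode-view a
    -- The computed view of an element may differ from `v` in form; monotonicity in both directions
    -- and antisymmetry make their codes equal.
    ... | v , eq = trans (Code-antisym (code-mono (view (decode a)) v ⊑-refl) (code-mono v (view (decode a)) ⊑-refl)) eq

    decode-encode : ∀ z → decode (encode z) ≡ z
    decode-encode z = ⊑-antisym (reflect (encode-decode (encode z))) (reflect′ (encode-decode (encode z)))
      where
      Code-refl : ∀ a → Code-≤ a a
      Code-refl (old s) = old≤old Subset.⊆-refl
      Code-refl (new i) = new≤new
      reflect : encode (decode (encode z)) ≡ encode z → decode (encode z) ⊑ z
      reflect eq = proj₂ (encode-⇔ _ z) (subst (λ a → Code-≤ a (encode z)) (sym eq) (Code-refl (encode z)))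
      reflect′ : encode (decode (encode z)) ≡ encode z → z ⊑ decode (encode z)
      reflect′ eq = proj₂ (encode-⇔ z _) (subst (Code-≤ (encode z)) (sym eq) (Code-refl (encode z)))

-- Cubical lattices

lookup-listAsVec : {A : Set} {n : ℕ} (xs : List A) (len : length xs ≡ n) → ∀ i → Vec.lookup (listAsVec xs len) i ∈ xs
lookup-listAsVec (x ∷ xs) refl Fin.zero    = here refl
lookup-listAsVec (x ∷ xs) refl (Fin.suc i) = there (lookup-listAsVec xs refl i)

module _ {A B : Set} where

  choose : Dec A → Dec B → Π3
  choose (yes _) _       = π0
  choose (no _)  (yes _) = π1
  choose (no _)  (no _)  = π*

  choose-first : (d : Dec A) (e : Dec B) → A → choose d e ≡ π0
  choose-first (yes _) e a = refl
  choose-first (no ¬a) e a = contradiction a ¬a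

  choose-second : (d : Dec A) (e : Dec B) → ¬ A → B → choose d e ≡ π1
  choose-second (yes a) e       ¬a b = contradiction a ¬a
  choose-second (no _)  (yes _) ¬a b = refl
  choose-second (no _)  (no ¬b) ¬a b = contradiction b ¬b

  choose-≤π0 : (d : Dec A) (e : Dec B) → Π-≤ (choose d e) π0 → A
  choose-≤π0 (yes a) e       _  = a
  choose-≤π0 (no _)  (yes _) ()
  choose-≤π0 (no _)  (no _)  ()

  choose-≤π1 : (d : Dec A) (e : Dec B) → Π-≤ (choose d e) π1 → B
  choose-≤π1 (yes _) e       ()
  choose-≤π1 (no _)  (yes b) _  = b
  choose-≤π1 (no _)  (no _)  ()

choose-mono : {A B A′ B′ : Set} (d : Dec A) (e : Dec B) (d′ : Dec A′) (e′ : Dec B′) →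
              (A′ → A) → (B′ → B) → (A → B → ⊥) → Π-≤ (choose d e) (choose d′ e′)
choose-mono d e (yes a′) e′ f g disjoint = subst (λ s → Π-≤ s π0) (sym (choose-first d e (f a′))) Π-refl
choose-mono d e (no _) (yes b′) f g disjoint =
  subst (λ s → Π-≤ s π1) (sym (choose-second d e (λ a → disjoint a (g b′)) (g b′))) Π-refl
choose-mono d e (no _) (no _) f g disjoint = Π-top

module _ (Q : FinPoset) where
  open FinPosetTheory Q

  module CubicalIso {n : ℕ} (ρt : ρ top ≡ suc n)
      (upper-IsBoolean : ∀ {x y} → x ≢ bot → IsBoolean x y)
      (coatom-count : ∀ {k y} → ρ y ≡ 2 + k → down bot y ≡ 2 * suc k)
      (level-count : ∀ k → k ≤ n → level (suc k) bot top ≡ (n C k) * 2 ^ (n ∸ k))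
      (join : ∀ a b → ∃ λ j → a ⊑ j × b ⊑ j × (∀ c → a ⊑ c → b ⊑ c → j ⊑ c)) where

    private
      -- Excluding the bottom makes the count 2k valid in rank 1 as well, where the only lower cover
      -- is the bottom and the count has to be 0.
      wall? : ∀ y c → Dec (c ≢ bot × c ◃ y)
      wall? y c = ¬? (c ≟ᶜ bot) ×-dec (c ◃? y)

      wall-count : ∀ k {y} → ρ y ≡ suc k → # (wall? y) ≡ 2 * k
      wall-count zero    {y} ρy = #≡0 (wall? y) λ { c (c≢bot , _ , ρy′) → c≢bot (sym (ρ≡0⇒bot (suc-injective (trans (sym ρy′) ρy)))) }
      wall-count (suc k) {y} ρy = trans
        (#-cong (wall? y) (down? bot y) (λ { c (_ , c◃y) → bot-min c , c◃y })
          (λ { c (_ , c◃y) → ρ-suc⇒≢bot (suc-injective (trans (sym (proj₂ c◃y)) ρy)) , c◃y }))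
        (coatom-count ρy)

      facet? : ∀ F → Dec (F ≢ bot × F ◃ top)
      facet? = wall? top

      otherFacet? : ∀ F G → Dec ((G ≢ bot × G ◃ top) × G ≢ F)
      otherFacet? F G = facet? G ×-dec ¬? (G ≟ᶜ F)

      facet-≡ : ∀ {F G} → F ◃ top → G ◃ top → F ⊑ G → F ≡ G
      facet-≡ (_ , ρF) (_ , ρG) F⊑G = ρ-eq F⊑G (≤-reflexive (suc-injective (trans (sym ρG) ρF)))

      ridge? : ∀ F G r → Dec ((r ≢ bot × r ◃ F) × r ◃ G)
      ridge? F G r = wall? F r ×-dec (r ◃? G)

      ridges : Carrier → Carrier → ℕ
      ridges F G = # (ridge? F G)

      ridges-sym : ∀ F G → ridges F G ≡ ridges G F
      ridges-sym F G = #-cong (ridge? F G) (ridge? G F) (λ { r ((p , q) , s) → (p , s) , q }) (λ { r ((p , q) , s) → (p , s) , q })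

      -- Two common ridges would join to a common facet.
      ridges≤1 : ∀ {F G} → F ◃ top → G ◃ top → G ≢ F → ridges F G ≤ 1
      ridges≤1 {F} {G} F◃t G◃t G≢F = unique⇒#≤1 (ridge? F G) same
        where
        same : ∀ r s → (r ≢ bot × r ◃ F) × r ◃ G → (s ≢ bot × s ◃ F) × s ◃ G → r ≡ s
        same r s ((_ , r⊑F , ρF) , r⊑G , _) ((_ , s⊑F , ρF′) , s⊑G , _) with r ≟ᶜ s
        ... | yes r≡s = r≡s
        ... | no  r≢s with join r s
        ...   | j , r⊑j , s⊑j , least = contradiction (sym (facet-≡ F◃t G◃t (subst (_⊑ G) j≡F (least G r⊑G s⊑G)))) G≢F
          where
          r≢j : r ≢ j
          r≢j refl = r≢s (sym (ρ-eq s⊑j (≤-reflexive (suc-injective (trans (sym ρF) ρF′)))))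
          j≡F : j ≡ F
          j≡F = ρ-eq (least F r⊑F s⊑F) (≤-trans (≤-reflexive ρF) (ρ-strict r⊑j r≢j))

      -- The interval [r, top] has rank 2 and Boolean cover numbers, so r lies in two facets, one of
      -- which is F.
      facet-through : ∀ {F r} → r ≢ bot → r ◃ F → F ◃ top → # (λ G → (r ◃? G) ×-dec otherFacet? F G) ≡ 1
      facet-through {F} {r} r≢bot (r⊑F , ρF) (F⊑t , ρt′) = suc-injective (begin
        suc (# (λ G → (r ◃? G) ×-dec otherFacet? F G))
          ≡⟨ cong suc (#-cong (λ G → (r ◃? G) ×-dec otherFacet? F G) (λ G → up? r top G ×-dec ¬? (G ≟ᶜ F))
               (λ { G (r◃G , (_ , G◃t) , G≢F) → (r◃G , proj₁ G◃t) , G≢F })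
               (λ { G ((r◃G , G⊑t) , G≢F) → r◃G , (above-≢bot r≢bot (proj₁ r◃G) , G⊑t , trans ρt′ (cong suc (trans ρF (sym (proj₂ r◃G))))) , G≢F })) ⟩
        suc (# (λ G → up? r top G ×-dec ¬? (G ≟ᶜ F)))
          ≡⟨ #-remove (up? r top) (λ _ → 1) ((r⊑F , ρF) , F⊑t) ⟨
        up r top
          ≡⟨ proj₁ (upper-IsBoolean r≢bot 2 ⊑-refl (⊑-trans r⊑F F⊑t) ⊑-refl (trans ρt′ (cong suc ρF))) ⟩
        2 ∎)
        where open ≡-Reasoning

      antipode? : ∀ F G → Dec (((G ≢ bot × G ◃ top) × G ≢ F) × ridges F G ≡ 0)
      antipode? F G = otherFacet? F G ×-dec (ridges F G ≟ 0)

      Antipode : Carrier → Carrier → Set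
      Antipode F G = ((G ≢ bot × G ◃ top) × G ≢ F) × ridges F G ≡ 0

      antipode-sym : ∀ {F G} → F ≢ bot × F ◃ top → Antipode F G → Antipode G F
      antipode-sym {F} {G} facetF ((_ , G≢F) , none) = (facetF , G≢F ∘ sym) , trans (ridges-sym G F) none

      rank-facet : ∀ {F} → F ≢ bot → F ◃ top → ∃ λ k → n ≡ suc k × ρ F ≡ suc k
      rank-facet {F} F≢bot (_ , ρt′) with ρ F in ρF
      ... | zero  = contradiction (sym (ρ≡0⇒bot ρF)) F≢bot
      ... | suc k = k , suc-injective (trans (sym ρt) ρt′) , refl

      -- F has 2n − 2 ridges, each in one further facet, and there are 2n − 1 further facets.
      antipode-count : ∀ {F} → F ≢ bot → F ◃ top → # (antipode? F) ≡ 1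
      antipode-count {F} F≢bot F◃t with rank-facet F≢bot F◃t
      ... | k , n≡ , ρF = +-cancelʳ-≡ (2 * k) _ _ (begin
        # (antipode? F) + 2 * k
          ≡⟨ cong (# (antipode? F) +_) total ⟨
        # (antipode? F) + ∑ elems (λ G → otherFacet? F G ▹ ridges F G)
          ≡⟨ ∑-+ elems _ _ ⟨
        ∑ elems (λ G → antipode? F G ▹ 1 + otherFacet? F G ▹ ridges F G)
          ≡⟨ ∑-cong elems (λ {G} _ → complementary G) ⟩
        # (otherFacet? F)
          ≡⟨ suc-injective (trans (sym (#-remove facet? (λ _ → 1) (F≢bot , F◃t))) (trans (wall-count n ρt) (trans (cong (2 *_) n≡) (double-suc k)))) ⟩
        1 + 2 * k ∎)
        where
        open ≡-Reasoning
        double-suc : ∀ k → 2 * suc k ≡ suc (1 + 2 * k)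
        double-suc = ringℕ
        total : ∑ elems (λ G → otherFacet? F G ▹ ridges F G) ≡ 2 * k
        total = begin
          ∑ elems (λ G → otherFacet? F G ▹ ridges F G)
            ≡⟨ ∑-▹-swap elems elems (otherFacet? F) (λ G r → ridge? F G r) (wall? F) (λ r G → (r ◃? G) ×-dec otherFacet? F G) (λ _ _ → 1)
                 (λ { G r oG (wr , r◃G) → wr , r◃G , oG }) (λ { r G wr (r◃G , oG) → oG , wr , r◃G }) ⟩
          ∑ elems (λ r → wall? F r ▹ # (λ G → (r ◃? G) ×-dec otherFacet? F G))
            ≡⟨ ∑-▹-const elems (wall? F) _ (λ { r (r≢bot , r◃F) → facet-through r≢bot r◃F F◃t }) ⟩
          # (wall? F) * 1
            ≡⟨ *-identityʳ _ ⟩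
          # (wall? F)
            ≡⟨ wall-count k ρF ⟩
          2 * k ∎
        complementary : ∀ G → antipode? F G ▹ 1 + otherFacet? F G ▹ ridges F G ≡ otherFacet? F G ▹ 1
        complementary G = trans (cong (_+ otherFacet? F G ▹ ridges F G) (sym (▹-▹ (otherFacet? F G) (ridges F G ≟ 0))))
          (trans (sym (▹-+ (otherFacet? F G) ((ridges F G ≟ 0) ▹ 1) (ridges F G)))
            (▹-congʳ (otherFacet? F G) (λ { ((_ , G◃t) , G≢F) → zero-or-one (ridges F G) (ridges≤1 F◃t G◃t G≢F) })))
          where
          zero-or-one : ∀ m → m ≤ 1 → (m ≟ 0) ▹ 1 + m ≡ 1
          zero-or-one zero    _ = refl
          zero-or-one (suc zero) _ = refl
          zero-or-one (suc (suc m)) (s≤s ())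

      -- Let F have relative rank k over z. Then F has k ridges above z, each in one further facet,
      -- and there are k further facets above z. No facet takes two of these ridges, so each takes
      -- one. If G lay above z, it would share a ridge with F.
      antipode-disjoint : ∀ {F G z} → F ≢ bot × F ◃ top → Antipode F G → z ≢ bot → z ⊑ F → z ⊑ G → ⊥
      antipode-disjoint {F} {G} {z} (F≢bot , F◃t) (((G≢bot , G◃t) , G≢F) , none) z≢bot z⊑F z⊑G
        with rank-gap z⊑F
      ... | k , ρF = 0≢1+n (trans (sym none) (proj₂ (≤⇒∃suc (≤-trans (≤-reflexive (sym one)) (common≤ridges G)))))
        where
        common? : ∀ H r → Dec ((z ⊑ r × r ◃ F) × r ◃ H)
        common? H r = down? z F r ×-dec (r ◃? H)
        common≤ridges : ∀ H → # (common? H) ≤ ridges F H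
        common≤ridges H = #-mono (common? H) (ridge? F H) (λ { r ((z⊑r , r◃F) , r◃H) → (above-≢bot z≢bot z⊑r , r◃F) , r◃H })
        other? : ∀ H → Dec ((z ⊑ H × H ◃ top) × H ≢ F)
        other? H = down? z top H ×-dec ¬? (H ≟ᶜ F)
        ≤⇒∃suc : ∀ {m} → 1 ≤ m → ∃ λ j → m ≡ suc j
        ≤⇒∃suc {suc m} _ = m , refl
        other-count : # other? ≡ k
        other-count = suc-injective (trans (sym (#-remove (down? z top) (λ _ → 1) (z⊑F , F◃t)))
          (proj₂ (upper-IsBoolean z≢bot (suc k) ⊑-refl (top-max z) ⊑-refl (trans (proj₂ F◃t) (cong suc ρF)))))
        total : ∑ elems (λ H → other? H ▹ # (common? H)) ≡ k
        total = trans
          (∑-▹-swap elems elems other? common? (down? z F) (λ r H → (r ◃? H) ×-dec otherFacet? F H) (λ _ _ → 1)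
            (λ { H r ((z⊑H , H◃t) , H≢F) (zr , r◃H) → zr , r◃H , (above-≢bot z≢bot z⊑H , H◃t) , H≢F })
            (λ { r H (z⊑r , r◃F) (r◃H , (_ , H◃t) , H≢F) → ((⊑-trans z⊑r (proj₁ r◃H) , H◃t) , H≢F) , (z⊑r , r◃F) , r◃H }))
          (trans (∑-▹-const elems (down? z F) _ (λ { r (z⊑r , r◃F) → facet-through (above-≢bot z≢bot z⊑r) r◃F F◃t }))
            (trans (*-identityʳ _) (proj₂ (upper-IsBoolean z≢bot k ⊑-refl z⊑F ⊑-refl ρF))))
        one : # (common? G) ≡ 1
        one = all-≤1⇒all-≡1 other? (λ H → # (common? H))
          (λ { H ((_ , H◃t) , H≢F) → ≤-trans (common≤ridges H) (ridges≤1 F◃t H◃t H≢F) })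
          (≤-reflexive (trans other-count (sym total))) G ((z⊑G , G◃t) , G≢F)

      top≢bot : top ≢ bot
      top≢bot = ρ-suc⇒≢bot ρt

      origin : ∃ λ v → bot ◃ v × v ⊑ top
      origin = ∃-up (bot-min top) (top≢bot ∘ sym)

      v₀ = proj₁ origin

      ρv₀ : ρ v₀ ≡ 1
      ρv₀ = trans (proj₂ (proj₁ (proj₂ origin))) (cong suc ρ-bot)

      v₀≢bot : v₀ ≢ bot
      v₀≢bot = ρ-suc⇒≢bot ρv₀

      baseFacet-count : # (down? v₀ top) ≡ n
      baseFacet-count = proj₂ (upper-IsBoolean v₀≢bot n ⊑-refl (top-max v₀) ⊑-refl
        (trans ρt (trans (+-comm 1 n) (cong (n +_) (sym ρv₀)))))

      antipodeOfBase? : ∀ G H → Dec (Antipode G H × v₀ ⊑ H)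
      antipodeOfBase? G H = antipode? G H ×-dec (v₀ ⊑? H)

      -- Let f G count how many of G and its antipode contain v₀; by disjointness f G ≤ 1. The n
      -- facets through v₀ are counted once as G and once as antipodes, so the values of f add up to
      -- 2n, the number of facets, and each of them is 1.
      facet-cases : ∀ {G} → G ≢ bot → G ◃ top → v₀ ⊑ G ⊎ ∃ λ H → Antipode G H × v₀ ⊑ H
      facet-cases {G} G≢bot G◃t with v₀ ⊑? G
      ... | yes v₀⊑G = inj₁ v₀⊑G
      ... | no  v₀⋢G = inj₂ (#-exists (antipodeOfBase? G) (subst (0 <_) (sym second-one) z<s))
        where
        open ≡-Reasoning
        f : Carrier → ℕ
        f G = (v₀ ⊑? G) ▹ 1 + # (antipodeOfBase? G)
        f≤1 : ∀ G → G ≢ bot × G ◃ top → f G ≤ 1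
        f≤1 G facetG with v₀ ⊑? G
        ... | yes v₀⊑G = ≤-reflexive (cong suc (#≡0 (antipodeOfBase? G) (λ { H (anti , v₀⊑H) → antipode-disjoint facetG anti v₀≢bot v₀⊑G v₀⊑H })))
        ... | no  _    = ≤-trans (#-mono (antipodeOfBase? G) (antipode? G) (λ _ → proj₁)) (≤-reflexive (antipode-count (proj₁ facetG) (proj₂ facetG)))
        base-part : ∑ elems (λ G → facet? G ▹ (v₀ ⊑? G) ▹ 1) ≡ n
        base-part = trans (∑-cong elems (λ {G} _ → trans (▹-▹ (facet? G) (v₀ ⊑? G))
          (▹-cong (facet? G ×-dec (v₀ ⊑? G)) (down? v₀ top G) (λ { ((_ , G◃t) , p) → p , G◃t })
                  (λ { (p , G◃t) → (above-≢bot v₀≢bot p , G◃t) , p }) (λ _ _ → refl)))) baseFacet-count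
        antipode-part : ∑ elems (λ G → facet? G ▹ # (antipodeOfBase? G)) ≡ n
        antipode-part = trans
          (∑-▹-swap elems elems facet? antipodeOfBase? (down? v₀ top) (λ H G → antipode? H G) (λ _ _ → 1)
            (λ { G H facetG (anti , v₀⊑H) → (v₀⊑H , proj₂ (proj₁ (proj₁ anti))) , antipode-sym facetG anti })
            (λ { H G (v₀⊑H , H◃t) anti → proj₁ (proj₁ anti) , antipode-sym (above-≢bot v₀≢bot v₀⊑H , H◃t) anti , v₀⊑H }))
          (trans (∑-▹-const elems (down? v₀ top) _ (λ { H (v₀⊑H , H◃t) → antipode-count (above-≢bot v₀≢bot v₀⊑H) H◃t }))
            (trans (*-identityʳ _) baseFacet-count))
        total : ∑ elems (λ G → facet? G ▹ f G) ≡ # facet?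
        total = begin
          ∑ elems (λ G → facet? G ▹ f G)
            ≡⟨ ∑-cong elems (λ {G} _ → ▹-+ (facet? G) ((v₀ ⊑? G) ▹ 1) (# (antipodeOfBase? G))) ⟩
          ∑ elems (λ G → facet? G ▹ (v₀ ⊑? G) ▹ 1 + facet? G ▹ # (antipodeOfBase? G))
            ≡⟨ ∑-+ elems _ _ ⟩
          ∑ elems (λ G → facet? G ▹ (v₀ ⊑? G) ▹ 1) + ∑ elems (λ G → facet? G ▹ # (antipodeOfBase? G))
            ≡⟨ cong₂ _+_ base-part (trans antipode-part (sym (+-identityʳ n))) ⟩
          2 * n
            ≡⟨ wall-count n ρt ⟨
          # facet? ∎
        second-one : # (antipodeOfBase? G) ≡ 1
        second-one = trans (cong (_+ # (antipodeOfBase? G)) (sym (▹-no (v₀ ⊑? G) v₀⋢G)))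
          (all-≤1⇒all-≡1 facet? f f≤1 (≤-reflexive (sym total)) G (G≢bot , G◃t))

      abstract
        opposite : ∀ F → F ≢ bot × F ◃ top → ∃ (Antipode F)
        opposite F (F≢bot , F◃t) = #-exists (antipode? F) (subst (0 <_) (sym (antipode-count F≢bot F◃t)) z<s)

      baseFacets : List Carrier
      baseFacets = filter (down? v₀ top) elems

      baseFacets-length : length baseFacets ≡ n
      baseFacets-length = trans (length-filter-∑ (down? v₀ top) elems) baseFacet-count

      abstract
        base : Fin n → Carrier
        base i = Vec.lookup (listAsVec baseFacets baseFacets-length) i

        base-facet : ∀ i → base i ≢ bot × base i ◃ top
        base-facet i with ∈-filter⁻ (down? v₀ top) {xs = elems} (lookup-listAsVec baseFacets baseFacets-length i)
        ... | _ , v₀⊑F , F◃t = above-≢bot v₀≢bot v₀⊑F , F◃t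

        base-index : ∀ {F} → v₀ ⊑ F → F ◃ top → ∃ λ i → base i ≡ F
        base-index {F} v₀⊑F F◃t = ∈-listAsVec baseFacets-length (∈-filter⁺ (down? v₀ top) (elems-complete F) (v₀⊑F , F◃t))

      α : Fin n → Carrier
      α i = proj₁ (opposite (base i) (base-facet i))

      α-antipode : ∀ i → Antipode (base i) (α i)
      α-antipode i = proj₂ (opposite (base i) (base-facet i))

      -- The two facets of an antipodal pair act as the faces 0 and 1 of one coordinate, and `π*`
      -- means contained in neither. They are disjoint away from the bottom, so the order of the two
      -- tests does not matter there.
      side : Fin n → Carrier → Π3
      side i z = choose (z ⊑? base i) (z ⊑? α i)

      side-base : ∀ {i z} → z ⊑ base i → side i z ≡ π0
      side-base {i} {z} = choose-first (z ⊑? base i) (z ⊑? α i)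

      α-disjoint : ∀ {i z} → z ≢ bot → z ⊑ base i → z ⊑ α i → ⊥
      α-disjoint {i} = antipode-disjoint (base-facet i) (α-antipode i)

      side-α : ∀ {i z} → z ≢ bot → z ⊑ α i → side i z ≡ π1
      side-α {i} {z} z≢bot z⊑G = choose-second (z ⊑? base i) (z ⊑? α i) (λ z⊑F → α-disjoint {i} z≢bot z⊑F z⊑G) z⊑G

      side-≤π0 : ∀ {i z} → Π-≤ (side i z) π0 → z ⊑ base i
      side-≤π0 {i} {z} = choose-≤π0 (z ⊑? base i) (z ⊑? α i)

      side-≤π1 : ∀ {i z} → Π-≤ (side i z) π1 → z ⊑ α i
      side-≤π1 {i} {z} = choose-≤π1 (z ⊑? base i) (z ⊑? α i)

      side-mono : ∀ i {z w} → z ≢ bot → z ⊑ w → Π-≤ (side i z) (side i w)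
      side-mono i {z} {w} z≢bot z⊑w = choose-mono (z ⊑? base i) (z ⊑? α i) (w ⊑? base i) (w ⊑? α i)
        (⊑-trans z⊑w) (⊑-trans z⊑w) (α-disjoint {i} z≢bot)

    vertexCode : Carrier → Vec Π3 n
    vertexCode z = Vec.tabulate (λ i → side i z)

    vertexCode-mono : ∀ {z w} → z ≢ bot → z ⊑ w → Pointwise Π-≤ (vertexCode z) (vertexCode w)
    vertexCode-mono z≢bot z⊑w = Pointwise.tabulate⁺ (λ i → side-mono i z≢bot z⊑w)

    -- If every facet above w lies above z, then z ∨ w is below as many facets as w, so it has the rank of w.
    vertexCode-reflect : ∀ {z w} → z ≢ bot → w ≢ bot → Pointwise Π-≤ (vertexCode z) (vertexCode w) → z ⊑ w
    vertexCode-reflect {z} {w} z≢bot w≢bot le with join z w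
    ... | j , z⊑j , w⊑j , least = subst (z ⊑_) (sym (ρ-eq w⊑j (≤-reflexive ρj≡ρw))) z⊑j
      where
      facets-above : ∀ G → w ⊑ G → G ◃ top → z ⊑ G
      facets-above G w⊑G G◃t with facet-cases (above-≢bot w≢bot w⊑G) G◃t
      ... | inj₁ v₀⊑G with base-index v₀⊑G G◃t
      ...   | i , refl = side-≤π0 (subst (Π-≤ (side i z)) (side-base w⊑G) (Pointwise.tabulate⁻ le i))
      facets-above G w⊑G G◃t | inj₂ (H , anti , v₀⊑H) with base-index v₀⊑H (proj₂ (proj₁ (proj₁ anti)))
      ...   | i , refl with #≤1⇒unique (antipode? (base i)) (≤-reflexive (antipode-count (proj₁ (base-facet i)) (proj₂ (base-facet i))))
                              (α-antipode i) (antipode-sym (above-≢bot w≢bot w⊑G , G◃t) anti)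
      ...     | α≡G = subst (z ⊑_) α≡G (side-≤π1 (subst (Π-≤ (side i z)) (side-α w≢bot (subst (w ⊑_) (sym α≡G) w⊑G)) (Pointwise.tabulate⁻ le i)))
      same-facets : down j top ≡ down w top
      same-facets = #-cong (down? j top) (down? w top) (λ { G (j⊑G , G◃t) → ⊑-trans w⊑j j⊑G , G◃t })
        (λ { G (w⊑G , G◃t) → least G (facets-above G w⊑G G◃t) w⊑G , G◃t })
      ρj≡ρw : ρ j ≡ ρ w
      ρj≡ρw with rank-gap (top-max j) | rank-gap (top-max w)
      ... | k , ρt₁ | l , ρt₂ = +-cancelˡ-≡ k _ _ (trans (sym ρt₁) (trans ρt₂ (cong (_+ ρ w) (sym k≡l))))
        where
        k≡l : k ≡ l
        k≡l = trans (sym (proj₂ (upper-IsBoolean (above-≢bot w≢bot w⊑j) k ⊑-refl (top-max j) ⊑-refl ρt₁)))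
                    (trans same-facets (proj₂ (upper-IsBoolean w≢bot l ⊑-refl (top-max w) ⊑-refl ρt₂)))

    private
      nonzero? : ∀ z → Dec (z ≢ bot)
      nonzero? z = ¬? (z ≟ᶜ bot)

      ρ-pred : ∀ {z} → z ≢ bot → suc (ρ z ∸ 1) ≡ ρ z
      ρ-pred {z} z≢bot with ρ z in ρz
      ... | zero  = contradiction (sym (ρ≡0⇒bot ρz)) z≢bot
      ... | suc k = refl

      -- The level sizes add up to (1 + 2)^n, the cardinality of Π^n; an injective code is therefore
      -- onto.
      size : length (filter nonzero? elems) ≡ 3 ^ n
      size = ℤ.+-injective (begin
        pos (length (filter nonzero? elems))
          ≡⟨ length-by-rank (filter nonzero? elems) (λ z → ρ z ∸ 1) (suc n)
               (λ {z} _ → s≤s (∸-monoˡ-≤ 1 (≤-trans (ρ-mono (top-max z)) (≤-reflexive ρt)))) ⟩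
        ∑< (suc n) (λ k → pos (∑ (filter nonzero? elems) (λ z → (ρ z ∸ 1 ≟ k) ▹ 1)))
          ≡⟨ ∑<-cong (suc n) (λ k k<1+n → trans (cong pos (trans (by-level k) (level-count k (≤-pred k<1+n)))) (product k)) ⟩
        binomialSum n (λ k → 1ℤ ℤ.^ k ℤ.* pos 2 ℤ.^ (n ∸ k))
          ≡⟨ binomialTheorem 1ℤ (pos 2) n ⟩
        pos 3 ℤ.^ n
          ≡⟨ pos-^ 3 n ⟨
        pos (3 ^ n) ∎)
        where
        open ≡-Reasoning
        product : ∀ k → pos ((n C k) * 2 ^ (n ∸ k)) ≡ pos (n C k) ℤ.* (1ℤ ℤ.^ k ℤ.* pos 2 ℤ.^ (n ∸ k))
        product k = trans (ℤ.pos-* (n C k) (2 ^ (n ∸ k))) (cong (pos (n C k) ℤ.*_) (trans (pos-^ 2 (n ∸ k))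
          (trans (sym (ℤ.*-identityˡ _)) (cong (ℤ._* pos 2 ℤ.^ (n ∸ k)) (sym (ℤ.^-zeroˡ k))))))
        by-level : ∀ k → ∑ (filter nonzero? elems) (λ z → (ρ z ∸ 1 ≟ k) ▹ 1) ≡ level (suc k) bot top
        by-level k = trans (∑-filter nonzero? elems _) (∑-cong elems (λ {z} _ → trans (▹-▹ (nonzero? z) (ρ z ∸ 1 ≟ k))
          (▹-cong (nonzero? z ×-dec (ρ z ∸ 1 ≟ k)) (within? (suc k) bot top z)
            (λ { (z≢bot , eq) → (bot-min z , top-max z) , trans (sym (ρ-pred z≢bot)) (cong suc eq) })
            (λ { (_ , ρz) → ρ-suc⇒≢bot ρz , cong (_∸ 1) ρz }) (λ _ _ → refl))))

      _≟π_ : (a b : Π3) → Dec (a ≡ b)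
      π0 ≟π π0 = yes refl
      π0 ≟π π1 = no λ ()
      π0 ≟π π* = no λ ()
      π1 ≟π π0 = no λ ()
      π1 ≟π π1 = yes refl
      π1 ≟π π* = no λ ()
      π* ≟π π0 = no λ ()
      π* ≟π π1 = no λ ()
      π* ≟π π* = yes refl

      vertexCode-injective : ∀ {z w} → z ≢ bot → w ≢ bot → vertexCode z ≡ vertexCode w → z ≡ w
      vertexCode-injective {z} {w} z≢bot w≢bot eq = ⊑-antisym
        (vertexCode-reflect z≢bot w≢bot (subst (Pointwise Π-≤ (vertexCode z)) eq (Pointwise.refl Π-refl)))
        (vertexCode-reflect w≢bot z≢bot (subst (Pointwise Π-≤ (vertexCode w)) (sym eq) (Pointwise.refl Π-refl)))

      preimage : ∀ v → ∃ λ z → z ∈ filter nonzero? elems × vertexCode z ≡ v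
      preimage = injective⇒surjective (Vec.≡-dec _≟π_) vertexCode {ys = allVecs (π0 ∷ π1 ∷ π* ∷ []) n}
        (Unique.filter⁺ nonzero? elems-unique)
        (λ z∈ w∈ → vertexCode-injective (proj₂ (∈-filter⁻ nonzero? {xs = elems} z∈)) (proj₂ (∈-filter⁻ nonzero? {xs = elems} w∈)))
        (allVecs-complete λ { π0 → here refl ; π1 → there (here refl) ; π* → there (there (here refl)) })
        (≤-reflexive (trans (length-allVecs (π0 ∷ π1 ∷ π* ∷ []) n) (sym size)))

      preimage≢bot : ∀ v → proj₁ (preimage v) ≢ bot
      preimage≢bot v = proj₂ (∈-filter⁻ nonzero? {xs = elems} (proj₁ (proj₂ (preimage v))))

    encode : Carrier → Cube (suc n)
    encode z with z ≟ᶜ bot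
    ... | yes _ = nothing
    ... | no  _ = just (vertexCode z)

    decode : Cube (suc n) → Carrier
    decode nothing  = bot
    decode (just v) = proj₁ (preimage v)

    encode-decode : ∀ v → encode (decode v) ≡ v
    encode-decode nothing with bot ≟ᶜ bot
    ... | yes _ = refl
    ... | no  bot≢bot = contradiction refl bot≢bot
    encode-decode (just v) with proj₁ (preimage v) ≟ᶜ bot
    ... | yes eq = contradiction eq (preimage≢bot v)
    ... | no  _  = cong just (proj₂ (proj₂ (preimage v)))

    decode-encode : ∀ z → decode (encode z) ≡ z
    decode-encode z with z ≟ᶜ bot
    ... | yes z≡bot = sym z≡bot
    ... | no  z≢bot = vertexCode-injective (preimage≢bot (vertexCode z)) z≢bot (proj₂ (proj₂ (preimage (vertexCode z))))

    encode-mono : ∀ z w → z ⊑ w → Cube-≤ (suc n) (encode z) (encode w)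
    encode-mono z w z⊑w with z ≟ᶜ bot | w ≟ᶜ bot
    ... | yes _     | _        = bot≤
    ... | no  z≢bot | yes refl = contradiction (bot-least z⊑w) z≢bot
    ... | no  z≢bot | no  _    = vec≤ (vertexCode-mono z≢bot z⊑w)

    encode-reflect : ∀ z w → Cube-≤ (suc n) (encode z) (encode w) → z ⊑ w
    encode-reflect z w le with z ≟ᶜ bot | w ≟ᶜ bot
    encode-reflect z w le        | yes refl  | _         = bot-min w
    encode-reflect z w (vec≤ le) | no  z≢bot | no  w≢bot = vertexCode-reflect z≢bot w≢bot le

-- Transfer to the given poset and assembly

interval-iso : (P : GradedPoset) (y : GradedPoset.Carrier P) (A : Set) (_≼_ : Rel A 0ℓ) →
  let open FinPoset (LowerInterval.finPoset P y) in
  (encode : Carrier → A) (decode : A → Carrier) → (∀ z → decode (encode z) ≡ z) → (∀ a → encode (decode a) ≡ a) →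
  (∀ z w → z ⊑ w → encode z ≼ encode w) → (∀ z w → encode z ≼ encode w → z ⊑ w) → IntervalIso P y A _≼_
interval-iso P y A _≼_ encode decode decode-encode encode-decode mono reflect =
  (λ (z , z⊑y) → encode ⟨ z , z⊑y ⟩) ,
  (λ a → el (decode a) , bound′ (decode a)) ,
  (λ (z , z⊑y) → cong el (decode-encode ⟨ z , z⊑y ⟩)) ,
  encode-decode ,
  (λ (z , z⊑y) (w , w⊑y) → mk⇔ (mono ⟨ z , z⊑y ⟩ ⟨ w , w⊑y ⟩) (reflect ⟨ z , z⊑y ⟩ ⟨ w , w⊑y ⟩))
  where open LowerInterval P y

module ShefferTheorem (P : GradedPoset) (D : ℕ → ℕ) (eulerian : IsEulerian P) (sheffer : IsSheffer P D _!) where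
  open GradedPosetTheory P using (Carrier; 𝟘; 𝟘-min; ρ; ρ-𝟘; ρ-eq; _≟ᶜ_; ⊑-refl; module MaximalChains)
  open GradedPoset P using () renaming (_≤_ to _⊑_)
  open ShefferNumbersOf P D eulerian sheffer

  ≢𝟘⇒ρ : ∀ {y} → y ≢ 𝟘 → ∃ λ n → ρ y ≡ suc n
  ≢𝟘⇒ρ {y} y≢𝟘 with ρ y in ρy
  ... | zero  = contradiction (sym (ρ-eq (𝟘-min y) (≤-trans (≤-reflexive ρy) z≤n))) y≢𝟘
  ... | suc n = n , refl

  suspension-iso : (∀ n → D (suc n) ≡ d-suspension n) → ∀ y → 2 ≤ ρ y → IntervalIso P y (DSBool (ρ y ∸ 1)) (DSBool-≤ (ρ y ∸ 1))
  suspension-iso D≡ y 2≤ρ = subst (λ n → IntervalIso P y (DSBool n) (DSBool-≤ n)) (cong (_∸ 1) (sym ρy))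
    (interval-iso P y (DSBool (suc m)) (DSBool-≤ (suc m)) encode decode decode-encode encode-decode (λ z w → proj₁ (encode-⇔ z w)) (λ z w → proj₂ (encode-⇔ z w)))
    where
    module I = Interval y
    m = ρ y ∸ 2
    ρy : ρ y ≡ 2 + m
    ρy = sym (m+[n∸m]≡n 2≤ρ)
    open SuspensionIso (LowerInterval.finPoset P y) ρy (λ {x} {y} → I.upper-IsBoolean {x} {y})
      -- D(k + 2) is the number of atoms times (k + 1)! on the one hand and 2 (k + 1)! on the other.
      (λ {k} {z} ρz → *-cancelʳ-≡ (I.up I.bot z) 2 (suc k !) {{suc k !≢0}} (trans (sym (I.D-up (suc k) {z} ρz)) (D≡ (suc k))))

  -- With D(k) = k! the intervals starting at the bottom have factorially many chains too, so the
  -- criterion used above the bottom now covers the whole interval.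
  boolean-iso : (∀ n → D (suc n) ≡ d-boolean n) → ∀ y → IntervalIso P y (Subset (ρ y)) Bool-≤
  boolean-iso D≡ y = interval-iso P y (Subset (ρ y)) Bool-≤ encode decode
    (λ z → decode-encode {z} (I.bot-min z) (I.top-max z)) encode-decode (λ z w → encode-mono {z} {w})
    (λ z w → encode-reflect {z} {w} (I.bot-min z) (I.bot-min w) (I.top-max z) (I.top-max w))
    where
    module I = Interval y
    factorials : ∀ k {u w} → I.bot I.⊑ u → u I.⊑ w → w I.⊑ I.top → I.ρ w ≡ k + I.ρ u → I.chains k u w ≡ k !
    factorials zero    _ _ _ _ = refl
    factorials (suc k) {u} {w} _ u⊑w _ ρw with u I.≟ᶜ I.bot
    ... | yes refl = trans (I.lower (suc k) (I.ρ-suc⇒≢bot {w} ρw) (trans ρw (trans (cong (suc k +_) I.ρ-bot) (+-identityʳ (suc k))))) (D≡ k)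
    ... | no  u≢bot = I.upper (suc k) u≢bot u⊑w ρw
    boolean : I.IsBoolean I.bot I.top
    boolean {u} {w} = I.factorials⇒IsBoolean {I.bot} {I.top} (λ k {u} {w} → factorials k {u} {w}) {u} {w}
    open BooleanIso (LowerInterval.finPoset P y) {I.bot} {I.top} {ρ y} (λ {u} {w} → boolean {u} {w}) (I.bot-min I.top) (I.bot-gap {I.top} refl)

  isBinomial : (∀ n → D (suc n) ≡ d-boolean n) → IsBinomial P
  isBinomial D≡ = _! , count
    where
    count : ∀ x y → x ⊑ y → NumMaxChains P x y ((ρ y ∸ ρ x) !)
    count x y x⊑y with x ≟ᶜ 𝟘
    ... | no  x≢𝟘 = proj₂ sheffer x y x≢𝟘 x⊑y
    ... | yes refl with y ≟ᶜ 𝟘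
    ...   | no y≢𝟘 = subst (NumMaxChains P 𝟘 y)
              (trans (trans (cong D (proj₂ (≢𝟘⇒ρ y≢𝟘))) (trans (D≡ _) (cong _! (sym (proj₂ (≢𝟘⇒ρ y≢𝟘)))))) (cong (λ r → (ρ y ∸ r) !) (sym ρ-𝟘)))
              (proj₁ sheffer y y≢𝟘)
    -- The Sheffer condition is silent about the interval from 𝟘 to 𝟘; its single maximal chain is
    -- supplied directly.
    ...   | yes refl = subst (λ n → NumMaxChains P 𝟘 𝟘 (n !)) (sym (n∸n≡0 (ρ 𝟘)))
              ((λ _ → 𝟘 ∷ []) , (λ { {Fin.zero} {Fin.zero} _ → refl }) , (λ _ → sound 0 ⊑-refl refl (here refl)) ,
               (λ l max → Fin.zero , singleton (complete 0 ⊑-refl ⊑-refl refl max)))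
      where
      open MaximalChains 𝟘
      singleton : ∀ {l} → l ∈ chainLists 0 𝟘 𝟘 → 𝟘 ∷ [] ≡ l
      singleton (here refl) = refl

  cubical-iso : (∀ n → D (suc n) ≡ d-cubical n) → ∀ y → y ≢ 𝟘 → IsLatticeBelow P y → IntervalIso P y (Cube (ρ y)) (Cube-≤ (ρ y))
  cubical-iso D≡ y y≢𝟘 (joins , _) = subst (λ r → IntervalIso P y (Cube r) (Cube-≤ r)) (sym ρy)
    (interval-iso P y (Cube (suc n)) (Cube-≤ (suc n)) encode decode decode-encode encode-decode encode-mono encode-reflect)
    where
    module I = Interval y
    module T = EulerSystem cubicalSystem
    open LowerInterval P y using (⟨_,_⟩; el; bound′)
    n = proj₁ (≢𝟘⇒ρ y≢𝟘)
    ρy : ρ y ≡ suc n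
    ρy = proj₂ (≢𝟘⇒ρ y≢𝟘)

    coatoms : ∀ {k z} → I.ρ z ≡ 2 + k → I.down I.bot z ≡ 2 * suc k
    coatoms {k} {z} ρz = *-cancelʳ-≡ _ _ (d-cubical k) {{T.d-nonZero k}}
      (trans (cong (I.down I.bot z *_) (sym (D≡ k))) (trans (sym (I.D-down k {z} ρz)) (trans (D≡ (suc k)) (T.d-suc k))))

    levels : ∀ k → k ≤ n → I.level (suc k) I.bot I.top ≡ (n C k) * 2 ^ (n ∸ k)
    levels k k≤n = subst (λ m → I.level (suc k) I.bot I.top ≡ T.f m k) (m∸n+n≡m k≤n)
      (*-cancelʳ-≡ _ _ (d-cubical k * j !) {{m*n≢0 (d-cubical k) (j !) {{T.d-nonZero k}} {{j !≢0}}}}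
        (trans (cong (λ d → I.level (suc k) I.bot I.top * (d * j !)) (sym (D≡ k)))
          (trans (I.level-D k j {I.top} (trans ρy (cong suc (sym (m∸n+n≡m k≤n))))) (trans (D≡ (j + k)) (sym (T.f-eq j k))))))
      where
      j = n ∸ k

    join : ∀ a b → ∃ λ j → a I.⊑ j × b I.⊑ j × (∀ c → a I.⊑ c → b I.⊑ c → j I.⊑ c)
    join a b with joins (el a) (el b) (bound′ a) (bound′ b)
    ... | j , j⊑y , a⊑j , b⊑j , least = ⟨ j , j⊑y ⟩ , a⊑j , b⊑j , λ c → least (el c) (bound′ c)

    open CubicalIso (LowerInterval.finPoset P y) ρy (λ {x} {y} → I.upper-IsBoolean {x} {y}) (λ {k} {z} → coatoms {k} {z}) levels join

theorem4p1 : (P : GradedPoset) (D : ℕ → ℕ) →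
    let open GradedPoset P using (ρ) renaming (𝟘 to bot) in
    IsEulerian P →
    IsSheffer P D (λ n → n !) →
    ((∀ n → 2 ≤ n → D n ≡ 2 * (n ∸ 1) !) ×
    (∀ y → 2 ≤ ρ y → IntervalIso P y (DSBool (ρ y ∸ 1)) (DSBool-≤ (ρ y ∸ 1))))
    ⊎ (((∀ n → 1 ≤ n → D n ≡ n !) × IsBinomial P) ×
    (∀ y → y ≢ bot → IntervalIso P y (Subset (ρ y)) Bool-≤))
    ⊎ ((∀ n → 1 ≤ n → D n ≡ 2 ^ (n ∸ 1) * (n ∸ 1) !) ×
    (∀ y → y ≢ bot → IsLatticeBelow P y → IntervalIso P y (Cube (ρ y)) (Cube-≤ (ρ y))))
theorem4p1 P D eulerian sheffer = Sum.map
  (λ D≡ → (λ { (suc (suc n)) _ → D≡ (suc n) ; (suc zero) (s≤s ()) }) , suspension-iso D≡)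
  (Sum.map
    (λ D≡ → ((λ { (suc n) _ → D≡ n }) , isBinomial D≡) , λ y _ → boolean-iso D≡ y)
    (λ D≡ → (λ { (suc n) _ → D≡ n }) , cubical-iso D≡))
  (Classification.classification (ShefferNumbersOf.shefferNumbers P D eulerian sheffer))
  where open ShefferTheorem P D eulerian sheffer
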